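{- For positive integers $N,S$, let $e_n(s)$ ($1\le n\le N$, $1\le s\le S$) be drawn independently and uniformly at random from $\{ -1,1\}$ and write $G_{N,S}(s)=(e_1(s),\dots,e_N(s))$. For every $\varepsilon>0$, \[ \mathbb{P}\Bigg[\Phi_k(G_{N,S})\le(1+\varepsilon)\sqrt{2N\log\left(\binom{SN}{k}-\binom{S(N-1)}{k}\right)}\ \text{ for all } k \text{ with } 2\le k<SN\Bigg]\to 1 \] as $N\to\infty$.
   Context: For a map $G_{N,S}:\{1,\dots,S\}\to\{ -1,+1\}^N$, $G_{N,S}(s)=(e_1(s),\dots,e_N(s))$, the cross-correlation measure of order $k$ is \[ \Phi_k(G_{N,S})=\max\left|\sum_{n=1}^M e_{n+d_1}(s_1)\cdots e_{n+d_k}(s_k)\right|, \] the maximum taken over all integers $M,d_1,\dots,d_k$ and $1\le s_1,\dots,s_k\le S$ with $0\le d_1\le\dots\le d_k<M+d_k\le N$ and $d_i\ne d_j$ whenever $s_i=s_j$. $\log$ is the natural logarithm. -}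

module Defs where

open import Data.Nat.Base as ℕ using (ℕ; zero; suc; NonZero)
import Data.Nat.Properties as ℕ
open import Data.Integer.Base as ℤ using (ℤ; +_; 0ℤ; 1ℤ; _◃_)
import Data.Integer.Properties as ℤ
open import Data.Rational.Base as ℚ
  using (ℚ; 0ℚ; 1ℚ; ½; _+_; _-_; _*_; -_; _/_; _≤_; _<_; ∣_∣; _⊔_; _⊓_)
import Data.Rational.Properties as ℚ
open import Data.Rational.Solver using (module +-*-Solver)
open import Data.Sign.Base using (Sign)
open import Data.Fin.Base as Fin using (Fin; toℕ)
import Data.Fin.Properties as Fin
open import Data.Vec.Base as Vec using (Vec; []; _∷_; lookup)
open import Data.List.Base as List
  using (List; map; filter; length; upTo; allFin; cartesianProduct; cartesianProductWith)
import Data.List.Properties as List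
open import Data.List.Extrema.Nat using (max)
open import Data.Product.Base using (Σ-syntax; ∃; ∃-syntax; _×_; _,_; proj₁; proj₂)
open import Data.Sum.Base using (_⊎_; inj₁; inj₂)
open import Data.Empty using (⊥; ⊥-elim)
open import Function.Base using (_∘_; _$_)
open import Relation.Nullary using (Dec; ¬?; _×-dec_; _→-dec_)
open import Relation.Unary using (Pred; Decidable; _⊆_)
open import Relation.Binary.Definitions using (tri<; tri≈; tri>)
open import Relation.Binary.PropositionalEquality
open import Level using (0ℓ)
import Algebra.Properties.Monoid.Sum ℤ.+-0-monoid as Sum
import Algebra.Properties.Monoid.Sum ℤ.*-1-monoid as Product
open import Data.Rational.Unnormalised.Base as ℚᵘ using (mkℚᵘ; *≡*; *≤*; *<*)
import Data.Rational.Unnormalised.Properties as ℚᵘ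

module Rational where
  open +-*-Solver

  ι : ℕ → ℚ
  ι n = (+ n) / 1

  h : ℕ → ℚ
  h a = 1ℤ / suc a

  abstract
    <⇒0<- : ∀ {p q} → p < q → 0ℚ < q - p
    <⇒0<- {p} {q} p<q = subst (_< q - p) (ℚ.+-inverseʳ p) (ℚ.+-monoˡ-< (- p) p<q)

    ≤⇒0≤- : ∀ {p q} → p ≤ q → 0ℚ ≤ q - p
    ≤⇒0≤- {p} {q} p≤q = subst (_≤ q - p) (ℚ.+-inverseʳ p) (ℚ.+-monoˡ-≤ (- p) p≤q)

    -- p and q differ by a nonnegative (positive) amount given in another form
    by-≤ : ∀ {p q d} → 0ℚ ≤ d → p + d ≡ q → p ≤ q
    by-≤ {p} {q} {d} 0≤d eq =
      subst₂ _≤_ (ℚ.+-identityʳ p) eq (ℚ.+-monoʳ-≤ p 0≤d)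

    by-< : ∀ {p q d} → 0ℚ < d → p + d ≡ q → p < q
    by-< {p} {q} {d} 0<d eq =
      subst₂ _<_ (ℚ.+-identityʳ p) eq (ℚ.+-monoʳ-< p 0<d)

    *-pos : ∀ {p q} → 0ℚ < p → 0ℚ < q → 0ℚ < p * q
    *-pos {p} {q} 0<p 0<q =
      subst (_< p * q) (ℚ.*-zeroʳ p) (ℚ.*-monoʳ-<-pos p {{ℚ.positive 0<p}} 0<q)

    *-nonNeg : ∀ {p q} → 0ℚ ≤ p → 0ℚ ≤ q → 0ℚ ≤ p * q
    *-nonNeg {p} {q} 0≤p 0≤q =
      subst (_≤ p * q) (ℚ.*-zeroʳ p) (ℚ.*-monoˡ-≤-nonNeg p {{ℚ.nonNegative 0≤p}} 0≤q)

    +-pos : ∀ {p q} → 0ℚ < p → 0ℚ < q → 0ℚ < p + q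
    +-pos 0<p 0<q = ℚ.+-mono-< 0<p 0<q

    0<1 : 0ℚ < 1ℚ
    0<1 = ℚ.positive⁻¹ 1ℚ

    0<½ : 0ℚ < ½
    0<½ = ℚ.positive⁻¹ ½

    square-mono-< : ∀ {p q} → 0ℚ < p → p < q → p * p < q * q
    square-mono-< {p} {q} 0<p p<q =
      by-< (*-pos (<⇒0<- p<q) (+-pos 0<p (ℚ.<-trans 0<p p<q)))
           (solve 2 (λ p q → p :* p :+ (q :- p) :* (p :+ q) := q :* q) refl p q)

    p≤∣p∣ : ∀ p → p ≤ ∣ p ∣
    p≤∣p∣ p with ℚ.≤-total 0ℚ p
    ... | inj₁ 0≤p = ℚ.≤-reflexive (sym (ℚ.0≤p⇒∣p∣≡p 0≤p))
    ... | inj₂ p≤0 = ℚ.≤-trans p≤0 (ℚ.0≤∣p∣ p)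

    -p≤∣p∣ : ∀ p → - p ≤ ∣ p ∣
    -p≤∣p∣ p = subst (- p ≤_) (ℚ.∣-p∣≡∣p∣ p) (p≤∣p∣ (- p))

    ∣∣-bound : ∀ {p b} → p ≤ b → - p ≤ b → ∣ p ∣ ≤ b
    ∣∣-bound {p} p≤b -p≤b with ℚ.∣p∣≡p∨∣p∣≡-p p
    ... | inj₁ eq = subst (_≤ _) (sym eq) p≤b
    ... | inj₂ eq = subst (_≤ _) (sym eq) -p≤b

    ∣∣-between : ∀ {a b t} → a ≤ t → t ≤ b → ∣ t ∣ ≤ ∣ a ∣ ⊔ ∣ b ∣
    ∣∣-between {a} {b} a≤t t≤b = ∣∣-bound
      (ℚ.≤-trans t≤b (ℚ.≤-trans (p≤∣p∣ b) (ℚ.p≤q⊔p ∣ a ∣ ∣ b ∣)))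
      (ℚ.≤-trans (ℚ.neg-antimono-≤ a≤t) (ℚ.≤-trans (-p≤∣p∣ a) (ℚ.p≤p⊔q ∣ a ∣ ∣ b ∣)))

    ∣∣*∣∣-mono : ∀ {p q a b} → ∣ p ∣ ≤ a → ∣ q ∣ ≤ b → ∣ p * q ∣ ≤ a * b
    ∣∣*∣∣-mono {p} {q} {a} {b} p≤a q≤b = begin
      ∣ p * q ∣     ≡⟨ ℚ.∣p*q∣≡∣p∣*∣q∣ p q ⟩
      ∣ p ∣ * ∣ q ∣ ≤⟨ ℚ.*-monoʳ-≤-nonNeg ∣ q ∣ {{ℚ.∣-∣-nonNeg q}} p≤a ⟩
      a * ∣ q ∣     ≤⟨ ℚ.*-monoˡ-≤-nonNeg a {{ℚ.nonNegative 0≤a}} q≤b ⟩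
      a * b         ∎
      where open ℚ.≤-Reasoning
            0≤a : 0ℚ ≤ a
            0≤a = ℚ.≤-trans (ℚ.0≤∣p∣ p) p≤a

    quarter : ℚ → ℚ → ℚ
    quarter p q = ½ * (½ * (q - p))

    middle : ℚ → ℚ → ℚ
    middle p q = ½ * (p + q)

    0<quarter : ∀ {p q} → p < q → 0ℚ < quarter p q
    0<quarter p<q = *-pos 0<½ (*-pos 0<½ (<⇒0<- p<q))

    middle<⇒ : ∀ {p q c} → p < q → middle p q < c → p < c - quarter p q
    middle<⇒ {p} {q} {c} p<q m<c = by-< (+-pos (<⇒0<- m<c) (0<quarter p<q))
      (solve 3 (λ p q c → let d = con ½ :* (con ½ :* (q :- p)) in
         p :+ ((c :- con ½ :* (p :+ q)) :+ d) := c :- d) refl p q c)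

    ≤middle⇒ : ∀ {p q c} → p < q → c ≤ middle p q → c + quarter p q < q
    ≤middle⇒ {p} {q} {c} p<q c≤m = by-< (ℚ.+-mono-≤-< (≤⇒0≤- c≤m) (0<quarter p<q))
      (solve 3 (λ p q c → let d = con ½ :* (con ½ :* (q :- p)) in
         c :+ d :+ ((con ½ :* (p :+ q) :- c) :+ d) := q) refl p q c)

    sum<⇒ : ∀ {p q a b} → p < q → a + b ≤ p → (a + quarter p q) + (b + quarter p q) < q
    sum<⇒ {p} {q} {a} {b} p<q ≤p =
      by-< (ℚ.+-mono-≤-< (≤⇒0≤- ≤p) (+-pos (0<quarter p<q) (0<quarter p<q)))
        (solve 4 (λ a b p q → let d = con ½ :* (con ½ :* (q :- p)) in
           (a :+ d) :+ (b :+ d) :+ ((p :- (a :+ b)) :+ (d :+ d)) := q) refl a b p q)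

    -+cancel : ∀ p q → (q - p) + p ≡ q
    -+cancel = solve 2 (λ p q → (q :- p) :+ p := q) refl

    p-1<p : ∀ p → p - 1ℚ < p
    p-1<p p = by-< 0<1 (solve 1 (λ t → t :- con 1ℚ :+ con 1ℚ := t) refl p)

    p<p+1 : ∀ p → p < p + 1ℚ
    p<p+1 p = by-< 0<1 refl

    ++1-pos : ∀ {p q} → 0ℚ ≤ p → 0ℚ ≤ q → 0ℚ < p + q + 1ℚ
    ++1-pos 0≤p 0≤q = ℚ.+-mono-≤-< (ℚ.+-mono-≤ 0≤p 0≤q) 0<1

    1+-pos : ∀ {p} → 0ℚ ≤ p → 0ℚ < 1ℚ + p
    1+-pos 0≤p = ℚ.<-≤-trans 0<1 (by-≤ 0≤p refl)

    <1+-square : ∀ {p} → 0ℚ ≤ p → p < (1ℚ + p) * (1ℚ + p)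
    <1+-square {p} 0≤p = by-< (ℚ.+-mono-<-≤ 0<1 (ℚ.+-mono-≤ 0≤p (*-nonNeg 0≤p 0≤p)))
      (solve 1 (λ t → t :+ (con 1ℚ :+ (t :+ t :* t)) := (con 1ℚ :+ t) :* (con 1ℚ :+ t)) refl p)

    half : ℚ → ℚ
    half p = ½ * p

    0<half : ∀ {p} → 0ℚ < p → 0ℚ < half p
    0<half = *-pos 0<½

    half+half : ∀ a p → a + (half p + half p) ≡ a + p
    half+half = solve 2 (λ a d → a :+ (con ½ :* d :+ con ½ :* d) := a :+ d) refl

    ∣-∣≤⇒lower : ∀ {t c η} → ∣ t - c ∣ ≤ η → c - η ≤ t
    ∣-∣≤⇒lower {t} {c} {η} le = by-≤ (≤⇒0≤- (ℚ.≤-trans (-p≤∣p∣ (t - c)) le))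
      (solve 3 (λ t c e → c :- e :+ (e :- (:- (t :- c))) := t) refl t c η)

    ∣-∣≤⇒upper : ∀ {t c η} → ∣ t - c ∣ ≤ η → t ≤ c + η
    ∣-∣≤⇒upper {t} {c} {η} le = by-≤ (≤⇒0≤- (ℚ.≤-trans (p≤∣p∣ (t - c)) le))
      (solve 3 (λ t c e → t :+ (e :- (t :- c)) := c :+ e) refl t c η)

    close : ∀ {c t δ} → c ≤ t → t ≤ c + δ → ∣ t - c ∣ ≤ δ
    close {c} {t} {δ} c≤t t≤ = subst (_≤ δ) (sym (ℚ.0≤p⇒∣p∣≡p (≤⇒0≤- c≤t)))
      (by-≤ (≤⇒0≤- t≤) (solve 3 (λ c t d → (t :- c) :+ (c :+ d :- t) := d) refl c t δ))

    product-close : ∀ {u v a b X Y δ} → ∣ u ∣ ≤ X → ∣ b ∣ ≤ Y → ∣ u - a ∣ ≤ δ → ∣ v - b ∣ ≤ δ →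
                    0ℚ ≤ δ → ∣ u * v - a * b ∣ ≤ (X + Y + 1ℚ) * δ
    product-close {u} {v} {a} {b} {X} {Y} {δ} ∣u∣≤X ∣b∣≤Y ∣u-a∣≤δ ∣v-b∣≤δ 0≤δ = begin
      ∣ u * v - a * b ∣
        ≡⟨ cong ∣_∣ (solve 4 (λ u v a b → u :* v :- a :* b
                             := u :* (v :- b) :+ (u :- a) :* b) refl u v a b) ⟩
      ∣ u * (v - b) + (u - a) * b ∣
        ≤⟨ ℚ.∣p+q∣≤∣p∣+∣q∣ (u * (v - b)) ((u - a) * b) ⟩
      ∣ u * (v - b) ∣ + ∣ (u - a) * b ∣
        ≤⟨ ℚ.+-mono-≤ (∣∣*∣∣-mono ∣u∣≤X ∣v-b∣≤δ) (∣∣*∣∣-mono ∣u-a∣≤δ ∣b∣≤Y) ⟩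
      X * δ + δ * Y
        ≤⟨ by-≤ 0≤δ (solve 3 (λ X Y d → X :* d :+ d :* Y :+ d
                                   := (X :+ Y :+ con 1ℚ) :* d) refl X Y δ) ⟩
      (X + Y + 1ℚ) * δ ∎
      where open ℚ.≤-Reasoning

    gap : ∀ {p q} K → p < q → 0ℚ < K → ∃[ δ ] 0ℚ < δ × K * δ ≡ quarter p q
    gap {p} {q} K p<q 0<K = ℚ.1/_ K {{nz}} * g
                      , *-pos {ℚ.1/_ K {{nz}}} (ℚ.positive⁻¹ _ {{ℚ.1/pos⇒pos K {{ℚ.positive 0<K}}}}) 0<g
                      , trans (sym (ℚ.*-assoc K (ℚ.1/_ K {{nz}}) g))
                              (trans (cong (_* g) (ℚ.*-inverseʳ K {{nz}})) (ℚ.*-identityˡ g))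
      where nz : ℚ.NonZero K
            nz = ℚ.pos⇒nonZero K {{ℚ.positive 0<K}}
            g : ℚ
            g = ½ * (½ * (q - p))
            0<g : 0ℚ < g
            0<g = *-pos 0<½ (*-pos 0<½ (<⇒0<- p<q))

    ι-suc : ∀ n → ι (suc n) ≡ 1ℚ + ι n
    ι-suc n = ℚ.toℚᵘ-injective (begin
      ℚ.toℚᵘ (ι (suc n))            ≈⟨ ℚ.toℚᵘ-fromℚᵘ (mkℚᵘ (+ suc n) 0) ⟩
      mkℚᵘ (+ suc n) 0              ≈⟨ *≡* (cong (ℤ._* 1ℤ) (cong (ℤ._+_ 1ℤ) (sym (ℤ.*-identityʳ (+ n))))) ⟩
      mkℚᵘ (+ 1) 0 ℚᵘ.+ mkℚᵘ (+ n) 0 ≈⟨ ℚᵘ.+-congʳ (mkℚᵘ (+ 1) 0) (ℚᵘ.≃-sym (ℚ.toℚᵘ-fromℚᵘ (mkℚᵘ (+ n) 0))) ⟩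
      ℚ.toℚᵘ 1ℚ ℚᵘ.+ ℚ.toℚᵘ (ι n)   ≈⟨ ℚᵘ.≃-sym (ℚ.toℚᵘ-homo-+ 1ℚ (ι n)) ⟩
      ℚ.toℚᵘ (1ℚ + ι n)             ∎)
      where open ℚᵘ.≃-Reasoning

    0≤h : ∀ a → 0ℚ ≤ h a
    0≤h a = ℚ.<⇒≤ (ℚ.positive⁻¹ (h a) {{ℚ.normalize-pos 1 (suc a)}})

    h-anti : ∀ {a b} → a ℕ.≤ b → h b ≤ h a
    h-anti {a} {b} a≤b = ℚ.toℚᵘ-cancel-≤ (begin
      ℚ.toℚᵘ (h b)  ≃⟨ ℚ.toℚᵘ-fromℚᵘ (mkℚᵘ 1ℤ b) ⟩
      mkℚᵘ 1ℤ b     ≤⟨ *≤* (ℤ.*-monoˡ-≤-nonNeg 1ℤ (ℤ.+≤+ (ℕ.s≤s a≤b))) ⟩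
      mkℚᵘ 1ℤ a     ≃⟨ ℚᵘ.≃-sym (ℚ.toℚᵘ-fromℚᵘ (mkℚᵘ 1ℤ a)) ⟩
      ℚ.toℚᵘ (h a)  ∎)
      where open ℚᵘ.≤-Reasoning

    h-scale : ∀ c a → ι (suc c) * h (a ℕ.+ c ℕ.* suc a) ≡ h a
    h-scale c a = ℚ.toℚᵘ-injective (begin
      ℚ.toℚᵘ (ι (suc c) * h d)              ≈⟨ ℚ.toℚᵘ-homo-* (ι (suc c)) (h d) ⟩
      ℚ.toℚᵘ (ι (suc c)) ℚᵘ.* ℚ.toℚᵘ (h d)  ≈⟨ ℚᵘ.*-cong (ℚ.toℚᵘ-fromℚᵘ (mkℚᵘ (+ suc c) 0)) (ℚ.toℚᵘ-fromℚᵘ (mkℚᵘ 1ℤ d)) ⟩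
      mkℚᵘ (+ suc c) 0 ℚᵘ.* mkℚᵘ 1ℤ d       ≈⟨ *≡* eq ⟩
      mkℚᵘ 1ℤ a                             ≈⟨ ℚᵘ.≃-sym (ℚ.toℚᵘ-fromℚᵘ (mkℚᵘ 1ℤ a)) ⟩
      ℚ.toℚᵘ (h a)                          ∎)
      where
      open ℚᵘ.≃-Reasoning
      d : ℕ
      d = a ℕ.+ c ℕ.* suc a
      eq : (+ suc c ℤ.* 1ℤ) ℤ.* + suc a ≡ 1ℤ ℤ.* (+ 1 ℤ.* + suc d)
      eq = trans (cong (ℤ._* + suc a) (ℤ.*-identityʳ (+ suc c)))
             (sym (trans (ℤ.*-identityˡ _) (ℤ.*-identityˡ (+ suc d))))

    h-small : ∀ {δ} → 0ℚ < δ → ∃[ a ] h a < δ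
    h-small {δ@(ℚ.mkℚ n d-1 _)} 0<δ = suc d-1 , ℚ.toℚᵘ-cancel-< (begin-strict
      ℚ.toℚᵘ (h (suc d-1))  ≃⟨ ℚ.toℚᵘ-fromℚᵘ (mkℚᵘ 1ℤ (suc d-1)) ⟩
      mkℚᵘ 1ℤ (suc d-1)     <⟨ lt n (ℚ.positive 0<δ) ⟩
      ℚ.toℚᵘ δ              ∎)
      where
      open ℚᵘ.≤-Reasoning
      lt : ∀ n → ℤ.Positive n → mkℚᵘ 1ℤ (suc d-1) ℚᵘ.< mkℚᵘ n d-1
      lt ℤ.+[1+ m ] _ = *<* (ℤ.<-≤-trans
        (subst (ℤ._< + suc (suc d-1)) (sym (ℤ.*-identityˡ (+ suc d-1))) (ℤ.+<+ ℕ.≤-refl))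
        (ℤ.+≤+ (ℕ.m≤m+n (suc (suc d-1)) (m ℕ.* suc (suc d-1)))))

    archimedean : ∀ p → ∃[ n ] p ≤ ι n
    archimedean p@(ℚ.mkℚ n d-1 _) = ℤ.∣ n ∣ , ℚ.toℚᵘ-cancel-≤ (begin
      ℚ.toℚᵘ p              ≤⟨ le n ⟩
      mkℚᵘ (+ ℤ.∣ n ∣) 0    ≃⟨ ℚᵘ.≃-sym (ℚ.toℚᵘ-fromℚᵘ (mkℚᵘ (+ ℤ.∣ n ∣) 0)) ⟩
      ℚ.toℚᵘ (ι ℤ.∣ n ∣)    ∎)
      where
      open ℚᵘ.≤-Reasoning
      le : ∀ n → mkℚᵘ n d-1 ℚᵘ.≤ mkℚᵘ (+ ℤ.∣ n ∣) 0
      le (+ m)      = *≤* (subst₂ ℤ._≤_ (sym (ℤ.*-identityʳ (+ m))) (ℤ.pos-* m (suc d-1)) (ℤ.+≤+ (ℕ.m≤m*n m (suc d-1))))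
      le (ℤ.-[1+ m ]) = *≤* (ℤ.≤-trans ℤ.-≤+ (ℤ.≤-reflexive (ℤ.pos-* (suc m) (suc d-1))))

    ≤∨< : ∀ p q → p ≤ q ⊎ q < p
    ≤∨< p q with ℚ.<-cmp p q
    ... | tri< p<q _ _ = inj₁ (ℚ.<⇒≤ p<q)
    ... | tri≈ _ eq _  = inj₁ (ℚ.≤-reflexive eq)
    ... | tri> _ _ q<p = inj₂ q<p

    step : ∀ l n δ → l + ι (suc n) * δ ≡ l + δ + ι n * δ
    step l n δ = trans (cong (λ t → l + t * δ) (ι-suc n))
      (solve 3 (λ l d n → l :+ (con 1ℚ :+ n) :* d := l :+ d :+ n :* d) refl l δ (ι n))

    no-steps : ∀ l δ → l + ι 0 * δ ≡ l
    no-steps = solve 2 (λ l d → l :+ con 0ℚ :* d := l) refl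

    double : ∀ l {δ} → 0ℚ < δ → l + δ < l + (δ + δ)
    double l {δ} 0<δ = by-< 0<δ (solve 2 (λ l d → l :+ d :+ d := l :+ (d :+ d)) refl l δ)

    enough-steps : ∀ l u {η} → 0ℚ < η → ∃[ n ] u < l + ι n * η
    enough-steps l u {η} 0<η = suc n , by-< (ℚ.+-mono-<-≤ 0<η (*-nonNeg (≤⇒0≤- n≥) (ℚ.<⇒≤ 0<η)))
      (begin
        u + (η + (ι n - (u - l) * η⁻¹) * η)
          ≡⟨ solve 5 (λ u l n e i → u :+ (e :+ (n :- (u :- l) :* i) :* e)
                                  := u :+ e :+ n :* e :- (u :- l) :* (i :* e)) refl u l (ι n) η η⁻¹ ⟩
        u + η + ι n * η - (u - l) * (η⁻¹ * η)
          ≡⟨ cong (λ t → u + η + ι n * η - (u - l) * t) (ℚ.*-inverseˡ η {{nz}}) ⟩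
        u + η + ι n * η - (u - l) * 1ℚ
          ≡⟨ solve 4 (λ u l e m → u :+ e :+ m :- (u :- l) :* con 1ℚ := l :+ e :+ m)
                   refl u l η (ι n * η) ⟩
        l + η + ι n * η
          ≡⟨ step l n η ⟨
        l + ι (suc n) * η ∎)
      where
      open ≡-Reasoning
      nz : ℚ.NonZero η
      nz = ℚ.pos⇒nonZero η {{ℚ.positive 0<η}}
      η⁻¹ : ℚ
      η⁻¹ = ℚ.1/_ η {{nz}}
      n : ℕ
      n = proj₁ (archimedean ((u - l) * η⁻¹))
      n≥ : (u - l) * η⁻¹ ≤ ι n
      n≥ = proj₂ (archimedean ((u - l) * η⁻¹))

open Rational

-- Two-sided Dedekind cuts.

record ℝ : Set₁ where
  field
    L U         : Pred ℚ 0ℓ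
    L-inhabited : ∃ L
    U-inhabited : ∃ U
    L-lower     : ∀ {p q} → p < q → L q → L p
    U-upper     : ∀ {p q} → p < q → U p → U q
    L-open      : ∀ {p} → L p → ∃[ q ] p < q × L q
    U-open      : ∀ {q} → U q → ∃[ p ] p < q × U p
    disjoint    : ∀ {q} → L q → U q → ⊥
    located     : ∀ {p q} → p < q → L p ⊎ U q

open ℝ

infix 4 _≤ᴿ_ _<ᴿ_
infixl 6 _+ᴿ_
infixl 7 _*ᴿ_

_≤ᴿ_ : ℝ → ℝ → Set
x ≤ᴿ y = U y ⊆ U x

_<ᴿ_ : ℝ → ℝ → Set
x <ᴿ y = ∃[ q ] U x q × L y q

fromℚ : ℚ → ℝ
fromℚ x = record
  { L = _< x
  ; U = x <_
  ; L-inhabited = x - 1ℚ , p-1<p x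
  ; U-inhabited = x + 1ℚ , p<p+1 x
  ; L-lower = ℚ.<-trans
  ; U-upper = λ p<q x<p → ℚ.<-trans x<p p<q
  ; L-open = λ p<x → let r , p<r , r<x = ℚ.<-dense p<x in r , p<r , r<x
  ; U-open = λ x<q → let r , x<r , r<q = ℚ.<-dense x<q in r , r<q , x<r
  ; disjoint = λ q<x x<q → ℚ.<-asym q<x x<q
  ; located = loc
  }
  where
  loc : ∀ {p q} → p < q → p < x ⊎ x < q
  loc {p} p<q with ≤∨< x p
  ... | inj₁ x≤p = inj₂ (ℚ.≤-<-trans x≤p p<q)
  ... | inj₂ p<x = inj₁ p<x

fromℕ : ℕ → ℝ
fromℕ n = fromℚ (+ n / 1)

0ᴿ 1ᴿ : ℝ
0ᴿ = fromℕ 0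
1ᴿ = fromℕ 1

module Cut (x : ℝ) where

  L<U : ∀ {p q} → L x p → U x q → p < q
  L<U {p} {q} Lp Uq with ≤∨< q p
  ... | inj₂ p<q = p<q
  ... | inj₁ q≤p with ℚ.<-cmp q p
  ...   | tri< q<p _ _  = ⊥-elim (disjoint x Lp (U-upper x q<p Uq))
  ...   | tri≈ _ refl _ = ⊥-elim (disjoint x Lp Uq)
  ...   | tri> _ _ p<q  = p<q

  L-⊔ : ∀ p q → L x p → L x q → L x (p ⊔ q)
  L-⊔ p q Lp Lq with ℚ.⊔-sel p q
  ... | inj₁ eq = subst (L x) (sym eq) Lp
  ... | inj₂ eq = subst (L x) (sym eq) Lq

  U-⊓ : ∀ p q → U x p → U x q → U x (p ⊓ q)
  U-⊓ p q Up Uq with ℚ.⊓-sel p q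
  ... | inj₁ eq = subst (U x) (sym eq) Up
  ... | inj₂ eq = subst (U x) (sym eq) Uq

  abstract
    search : ∀ {δ} → 0ℚ < δ → ∀ n {l} → L x l → U x (l + ι n * δ) →
             ∃[ a ] L x a × U x (a + (δ + δ))
    search {δ} 0<δ zero {l} Ll Ul = ⊥-elim (disjoint x Ll (subst (U x) (no-steps l δ) Ul))
    search {δ} 0<δ (suc n) {l} Ll Ul with located x (double l 0<δ)
    ... | inj₂ U′ = l , Ll , U′
    ... | inj₁ L′ = search 0<δ n L′ (subst (U x) (step l n δ) Ul)

    approx : ∀ {δ} → 0ℚ < δ → ∃[ a ] ∃[ b ] L x a × U x b × b ≤ a + δ
    approx {δ} 0<δ with L-inhabited x | U-inhabited x
    ... | l , Ll | u , Uu with enough-steps l u (0<half 0<δ)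
    ...   | n , u< with search (0<half 0<δ) n Ll (U-upper x u< Uu)
    ...     | a , La , Ua = a , _ , La , Ua , ℚ.≤-reflexive (half+half a δ)

_+ᴿ_ : ℝ → ℝ → ℝ
x +ᴿ y = record
  { L = L′
  ; U = U′
  ; L-inhabited =
      let a , La = L-inhabited x ; b , Lb = L-inhabited y
      in a + b - 1ℚ , a , b , La , Lb , p-1<p (a + b)
  ; U-inhabited =
      let a , Ua = U-inhabited x ; b , Ub = U-inhabited y
      in a + b + 1ℚ , a , b , Ua , Ub , p<p+1 (a + b)
  ; L-lower = λ p<q (a , b , La , Lb , q<) → a , b , La , Lb , ℚ.<-trans p<q q<
  ; U-upper = λ p<q (a , b , Ua , Ub , <p) → a , b , Ua , Ub , ℚ.<-trans <p p<q
  ; L-open = λ (a , b , La , Lb , q<) →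
      let r , q<r , r< = ℚ.<-dense q< in r , q<r , a , b , La , Lb , r<
  ; U-open = λ (a , b , Ua , Ub , <q) →
      let r , <r , r<q = ℚ.<-dense <q in r , r<q , a , b , Ua , Ub , <r
  ; disjoint = λ (a , b , La , Lb , q<) (a′ , b′ , Ua , Ub , <q) →
      ℚ.<-asym (ℚ.+-mono-< (Cut.L<U x La Ua) (Cut.L<U y Lb Ub)) (ℚ.<-trans <q q<)
  ; located = loc
  }
  where
  L′ U′ : Pred ℚ 0ℓ
  L′ q = ∃[ a ] ∃[ b ] L x a × L y b × q < a + b
  U′ q = ∃[ a ] ∃[ b ] U x a × U y b × a + b < q

  loc : ∀ {p q} → p < q → L′ p ⊎ U′ q
  loc {p} {q} p<q with Cut.approx x (0<quarter p<q) | Cut.approx y (0<quarter p<q)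
  ... | a , a′ , La , Ua , a′≤ | b , b′ , Lb , Ub , b′≤ with ≤∨< (a + b) p
  ...   | inj₂ p< = inj₁ (a , b , La , Lb , p<)
  ...   | inj₁ ≤p = inj₂ (a′ , b′ , Ua , Ub ,
          ℚ.≤-<-trans (ℚ.+-mono-≤ {a′} {a + quarter p q} {b′} {b + quarter p q} a′≤ b′≤) (sum<⇒ {a = a} {b} p<q ≤p))

-- Interval arithmetic: q lies below (above) x * y when some rational
-- enclosures of x and y have all their products above (below) q, with a
-- margin.
record Enclosure (x y : ℝ) : Set where
  field
    {a a′ b b′} : ℚ
    La : L x a
    Ua : U x a′
    Lb : L y b
    Ub : U y b′

  Everywhere : Pred ℚ 0ℓ → Set
  Everywhere P = ∀ u v → a ≤ u → u ≤ a′ → b ≤ v → v ≤ b′ → P (u * v)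

open Enclosure using (Everywhere)

abstract
  common : ∀ {x y} (e e′ : Enclosure x y) {P Q : Pred ℚ 0ℓ} →
           Everywhere e P → Everywhere e′ Q → ∃[ t ] P t × Q t
  common {x} {y} e e′ f g =
    let open Enclosure
        u = a e ⊔ a e′
        v = b e ⊔ b e′
        Lu = Cut.L-⊔ x (a e) (a e′) (La e) (La e′)
        Lv = Cut.L-⊔ y (b e) (b e′) (Lb e) (Lb e′)
    in u * v
     , f u v (ℚ.p≤p⊔q (a e) (a e′)) (ℚ.<⇒≤ (Cut.L<U x Lu (Ua e)))
             (ℚ.p≤p⊔q (b e) (b e′)) (ℚ.<⇒≤ (Cut.L<U y Lv (Ub e)))
     , g u v (ℚ.p≤q⊔p (a e) (a e′)) (ℚ.<⇒≤ (Cut.L<U x Lu (Ua e′)))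
             (ℚ.p≤q⊔p (b e) (b e′)) (ℚ.<⇒≤ (Cut.L<U y Lv (Ub e′)))

  -- an enclosure on which the product varies little about some c
  tight : ∀ x y {p q} → p < q → Σ[ e ∈ Enclosure x y ] ∃[ c ]
          Everywhere e (λ t → ∣ t - c ∣ ≤ quarter p q)
  tight x y {p} {q} p<q with L-inhabited x | U-inhabited x | L-inhabited y | U-inhabited y
  ... | a₀ , La₀ | a₀′ , Ua₀′ | b₀ , Lb₀ | b₀′ , Ub₀′
    with gap ((∣ a₀ ∣ ⊔ ∣ a₀′ ∣) + (∣ b₀ ∣ ⊔ ∣ b₀′ ∣) + 1ℚ) p<q
           (++1-pos {∣ a₀ ∣ ⊔ ∣ a₀′ ∣} {∣ b₀ ∣ ⊔ ∣ b₀′ ∣} (ℚ.≤-trans (ℚ.0≤∣p∣ a₀) (ℚ.p≤p⊔q ∣ a₀ ∣ ∣ a₀′ ∣))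
                    (ℚ.≤-trans (ℚ.0≤∣p∣ b₀) (ℚ.p≤p⊔q ∣ b₀ ∣ ∣ b₀′ ∣)))
  ... | δ , 0<δ , Kδ≡ with Cut.approx x 0<δ | Cut.approx y 0<δ
  ... | a₁ , a₁′ , La₁ , Ua₁′ , a₁′≤ | b₁ , b₁′ , Lb₁ , Ub₁′ , b₁′≤ =
    record { a = a₀ ⊔ a₁ ; a′ = a₀′ ⊓ a₁′ ; b = b₀ ⊔ b₁ ; b′ = b₀′ ⊓ b₁′
           ; La = Cut.L-⊔ x a₀ a₁ La₀ La₁ ; Ua = Cut.U-⊓ x a₀′ a₁′ Ua₀′ Ua₁′
           ; Lb = Lb ; Ub = Ub }
    , (a₀ ⊔ a₁) * (b₀ ⊔ b₁)
    , λ u v a≤u u≤a′ b≤v v≤b′ → subst (∣ u * v - (a₀ ⊔ a₁) * (b₀ ⊔ b₁) ∣ ≤_) Kδ≡ (product-close {u} {v} {a₀ ⊔ a₁} {b₀ ⊔ b₁}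
        (∣∣-between (ℚ.≤-trans (ℚ.p≤p⊔q a₀ a₁) a≤u) (ℚ.≤-trans u≤a′ (ℚ.p⊓q≤p a₀′ a₁′)))
        (∣∣-between (ℚ.p≤p⊔q b₀ b₁)
           (ℚ.≤-trans (ℚ.<⇒≤ (Cut.L<U y Lb Ub)) (ℚ.p⊓q≤p b₀′ b₁′)))
        (close {a₀ ⊔ a₁} {u} {δ} a≤u (ℚ.≤-trans u≤a′ (ℚ.≤-trans (ℚ.p⊓q≤q a₀′ a₁′)
           (ℚ.≤-trans a₁′≤ (ℚ.+-monoˡ-≤ δ (ℚ.p≤q⊔p a₀ a₁))))))
        (close {b₀ ⊔ b₁} {v} {δ} b≤v (ℚ.≤-trans v≤b′ (ℚ.≤-trans (ℚ.p⊓q≤q b₀′ b₁′)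
           (ℚ.≤-trans b₁′≤ (ℚ.+-monoˡ-≤ δ (ℚ.p≤q⊔p b₀ b₁))))))
        (ℚ.<⇒≤ 0<δ))
    where
    Lb : L y (b₀ ⊔ b₁)
    Lb = Cut.L-⊔ y b₀ b₁ Lb₀ Lb₁
    Ub : U y (b₀′ ⊓ b₁′)
    Ub = Cut.U-⊓ y b₀′ b₁′ Ub₀′ Ub₁′

_*ᴿ_ : ℝ → ℝ → ℝ
x *ᴿ y = record
  { L = L′
  ; U = U′
  ; L-inhabited =
      let e , c , f = tight x y 0<1
      in c - quarter 0ℚ 1ℚ - 1ℚ , e , c - quarter 0ℚ 1ℚ , p-1<p (c - quarter 0ℚ 1ℚ)
         , λ u v p q r s → ∣-∣≤⇒lower {u * v} {c} {quarter 0ℚ 1ℚ} (f u v p q r s)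
  ; U-inhabited =
      let e , c , f = tight x y 0<1
      in c + quarter 0ℚ 1ℚ + 1ℚ , e , c + quarter 0ℚ 1ℚ , p<p+1 (c + quarter 0ℚ 1ℚ)
         , λ u v p q r s → ∣-∣≤⇒upper {u * v} {c} {quarter 0ℚ 1ℚ} (f u v p q r s)
  ; L-lower = λ p<q (e , r , q<r , f) → e , r , ℚ.<-trans p<q q<r , f
  ; U-upper = λ p<q (e , r , r<p , f) → e , r , ℚ.<-trans r<p p<q , f
  ; L-open = λ (e , r , q<r , f) →
      let s , q<s , s<r = ℚ.<-dense q<r in s , q<s , e , r , s<r , f
  ; U-open = λ (e , r , r<q , f) →
      let s , r<s , s<q = ℚ.<-dense r<q in s , s<q , e , r , r<s , f
  ; disjoint = λ (e , r , q<r , f) (e′ , r′ , r′<q , f′) →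
      let t , r≤t , t≤r′ = common e e′ {r ≤_} {_≤ r′} f f′
      in ℚ.<-irrefl refl (ℚ.<-≤-trans (ℚ.<-trans r′<q q<r) (ℚ.≤-trans r≤t t≤r′))
  ; located = loc
  }
  where
  L′ U′ : Pred ℚ 0ℓ
  L′ q = Σ[ e ∈ Enclosure x y ] ∃[ r ] q < r × Everywhere e (r ≤_)
  U′ q = Σ[ e ∈ Enclosure x y ] ∃[ r ] r < q × Everywhere e (_≤ r)

  loc : ∀ {p q} → p < q → L′ p ⊎ U′ q
  loc {p} {q} p<q with tight x y p<q
  ... | e , c , f with ≤∨< c (middle p q)
  ...   | inj₂ m<c = inj₁ (e , c - quarter p q , middle<⇒ p<q m<c
          , λ u v a b c′ d → ∣-∣≤⇒lower {u * v} {c} {quarter p q} (f u v a b c′ d))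
  ...   | inj₁ c≤m = inj₂ (e , c + quarter p q , ≤middle⇒ p<q c≤m
          , λ u v a b c′ d → ∣-∣≤⇒upper {u * v} {c} {quarter p q} (f u v a b c′ d))

-- The square root of max(x , 0).
√ : ℝ → ℝ
√ x = record
  { L = L′
  ; U = U′
  ; L-inhabited = - 1ℚ , 0ℚ , ℚ.negative⁻¹ (- 1ℚ) , inj₁ ℚ.≤-refl
  ; U-inhabited =
      let u , Uu = U-inhabited x
      in 1ℚ + ∣ u ∣ + 1ℚ , 1ℚ + ∣ u ∣ , p<p+1 (1ℚ + ∣ u ∣) , 1+-pos {∣ u ∣} (ℚ.0≤∣p∣ u)
         , U-upper x (ℚ.≤-<-trans (p≤∣p∣ u) (<1+-square {∣ u ∣} (ℚ.0≤∣p∣ u))) Uu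
  ; L-lower = λ p<q (r , q<r , s) → r , ℚ.<-trans p<q q<r , s
  ; U-upper = λ p<q (r , r<p , s) → r , ℚ.<-trans r<p p<q , s
  ; L-open = λ (r , q<r , s) →
      let t , q<t , t<r = ℚ.<-dense q<r in t , q<t , r , t<r , s
  ; U-open = λ (r , r<q , s) →
      let t , r<t , t<q = ℚ.<-dense r<q in t , t<q , r , r<t , s
  ; disjoint = dis
  ; located = loc
  }
  where
  L′ U′ : Pred ℚ 0ℓ
  L′ q = ∃[ p ] q < p × (p ≤ 0ℚ ⊎ L x (p * p))
  U′ q = ∃[ p ] p < q × 0ℚ < p × U x (p * p)

  dis : ∀ {q} → L′ q → U′ q → ⊥
  dis {q} (p , q<p , inj₁ p≤0) (p′ , p′<q , 0<p′ , _) =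
    ℚ.<-irrefl refl (ℚ.<-trans 0<p′ (ℚ.<-trans p′<q (ℚ.<-≤-trans q<p p≤0)))
  dis {q} (p , q<p , inj₂ Lp) (p′ , p′<q , 0<p′ , Up) =
    disjoint x (L-lower x (square-mono-< {p′} {p} 0<p′ (ℚ.<-trans p′<q q<p)) Lp) Up

  loc : ∀ {p q} → p < q → L′ p ⊎ U′ q
  loc {p} {q} p<q with ≤∨< 0ℚ p
  ... | inj₂ p<0 = inj₁ (0ℚ , p<0 , inj₁ ℚ.≤-refl)
  ... | inj₁ 0≤p with ℚ.<-dense p<q
  ...   | m , p<m , m<q with ℚ.<-dense m<q
  ...     | n , m<n , n<q with located x (square-mono-< {m} {n} (ℚ.≤-<-trans 0≤p p<m) m<n)
  ...       | inj₁ Lm = inj₁ (m , p<m , inj₂ Lm)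
  ...       | inj₂ Un = inj₂ (n , n<q , ℚ.<-trans (ℚ.≤-<-trans 0≤p p<m) m<n , Un)

-- 1/(a + 1) + ⋯ + 1/(a + ℓ)
H : ℕ → ℕ → ℚ
H a zero    = 0ℚ
H a (suc ℓ) = h a + H (suc a) ℓ

-- Riemann sums of mesh 1/n for ∫₁ᵐ dt/t, with n = suc ν: on each
-- subinterval [i/n , (i + 1)/n] the integrand lies between n/(i + 1) and
-- n/i, so the subinterval contributes between 1/(i + 1) and 1/i.
lowerSum upperSum : ℕ → ℕ → ℚ
lowerSum m ν = H (suc ν) ((m ℕ.∸ 1) ℕ.* suc ν)
upperSum m ν = H ν       ((m ℕ.∸ 1) ℕ.* suc ν)

module Harmonic where abstract

  H-+ : ∀ a j k → H a (j ℕ.+ k) ≡ H a j + H (a ℕ.+ j) k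
  H-+ a zero    k = trans (cong (λ t → H t k) (sym (ℕ.+-identityʳ a))) (sym (ℚ.+-identityˡ _))
  H-+ a (suc j) k = trans
    (cong (λ t → h a + t) (trans (H-+ (suc a) j k)
      (cong (λ t → H (suc a) j + H t k) (sym (ℕ.+-suc a j)))))
    (sym (ℚ.+-assoc (h a) (H (suc a) j) (H (a ℕ.+ suc j) k)))

  ι-suc-* : ∀ j p → ι (suc j) * p ≡ p + ι j * p
  ι-suc-* j p = trans (cong (_* p) (ι-suc j)) (trans (ℚ.*-distribʳ-+ p 1ℚ (ι j))
    (cong (λ t → t + ι j * p) (ℚ.*-identityˡ p)))

  H≥ : ∀ a j {b} → a ℕ.+ j ℕ.≤ suc b → ι j * h b ≤ H a j
  H≥ a zero    {b} _  = ℚ.≤-reflexive (ℚ.*-zeroˡ (h b))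
  H≥ a (suc j) {b} le = subst (_≤ H a (suc j)) (sym (ι-suc-* j (h b)))
    (ℚ.+-mono-≤ (h-anti (ℕ.≤-trans (ℕ.m≤m+n a j) (ℕ.≤-pred le′))) (H≥ (suc a) j le′))
    where
    le′ : suc a ℕ.+ j ℕ.≤ suc b
    le′ = subst (ℕ._≤ suc b) (ℕ.+-suc a j) le

  H≤ : ∀ a j {b} → b ℕ.≤ a → H a j ≤ ι j * h b
  H≤ a zero    {b} _  = ℚ.≤-reflexive (sym (ℚ.*-zeroˡ (h b)))
  H≤ a (suc j) {b} le = subst (H a (suc j) ≤_) (sym (ι-suc-* j (h b)))
    (ℚ.+-mono-≤ (h-anti le) (H≤ (suc a) j (ℕ.m≤n⇒m≤1+n le)))

  H-shift : ∀ a ℓ → H (suc a) ℓ ≤ H a ℓ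
  H-shift a zero    = ℚ.≤-refl
  H-shift a (suc ℓ) = ℚ.+-mono-≤ (h-anti (ℕ.n≤1+n a)) (H-shift (suc a) ℓ)

  H-extend : ∀ a ℓ → H a ℓ ≤ H a (suc ℓ)
  H-extend a zero    = subst (0ℚ ≤_) (sym (ℚ.+-identityʳ (h a))) (0≤h a)
  H-extend a (suc ℓ) = ℚ.+-monoʳ-≤ (h a) (H-extend (suc a) ℓ)

  refine-lower : ∀ c a ℓ → H a ℓ ≤ H (suc c ℕ.* a) (suc c ℕ.* ℓ)
  refine-lower c a zero    = ℚ.≤-reflexive (cong (H (suc c ℕ.* a)) (sym (ℕ.*-zeroʳ (suc c))))
  refine-lower c a (suc ℓ) = begin
    h a + H (suc a) ℓ
      ≤⟨ ℚ.+-mono-≤ block (refine-lower c (suc a) ℓ) ⟩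
    H (C ℕ.* a) C + H (C ℕ.* suc a) (C ℕ.* ℓ)
      ≡⟨ cong (λ t → H (C ℕ.* a) C + H t (C ℕ.* ℓ)) next ⟨
    H (C ℕ.* a) C + H (C ℕ.* a ℕ.+ C) (C ℕ.* ℓ)
      ≡⟨ H-+ (C ℕ.* a) C (C ℕ.* ℓ) ⟨
    H (C ℕ.* a) (C ℕ.+ C ℕ.* ℓ)
      ≡⟨ cong (H (C ℕ.* a)) (ℕ.*-suc C ℓ) ⟨
    H (C ℕ.* a) (C ℕ.* suc ℓ) ∎
    where
    open ℚ.≤-Reasoning
    C : ℕ
    C = suc c
    next : C ℕ.* a ℕ.+ C ≡ C ℕ.* suc a
    next = trans (ℕ.+-comm (C ℕ.* a) C) (sym (ℕ.*-suc C a))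
    block : h a ≤ H (C ℕ.* a) C
    block = subst (_≤ H (C ℕ.* a) C) (h-scale c a) (H≥ (C ℕ.* a) C (ℕ.≤-reflexive next))

  refine-upper : ∀ c a ℓ → H (a ℕ.+ c ℕ.* suc a) (suc c ℕ.* ℓ) ≤ H a ℓ
  refine-upper c a zero    = ℚ.≤-reflexive (cong (H (a ℕ.+ c ℕ.* suc a)) (ℕ.*-zeroʳ (suc c)))
  refine-upper c a (suc ℓ) = begin
    H d (C ℕ.* suc ℓ)                  ≡⟨ cong (H d) (ℕ.*-suc C ℓ) ⟩
    H d (C ℕ.+ C ℕ.* ℓ)                ≡⟨ H-+ d C (C ℕ.* ℓ) ⟩
    H d C + H (d ℕ.+ C) (C ℕ.* ℓ)      ≡⟨ cong (λ t → H d C + H t (C ℕ.* ℓ)) next ⟩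
    H d C + H (suc a ℕ.+ c ℕ.* suc (suc a)) (C ℕ.* ℓ)
      ≤⟨ ℚ.+-mono-≤ block (refine-upper c (suc a) ℓ) ⟩
    h a + H (suc a) ℓ ∎
    where
    open ℚ.≤-Reasoning
    C d : ℕ
    C = suc c
    d = a ℕ.+ c ℕ.* suc a
    next : d ℕ.+ C ≡ suc a ℕ.+ c ℕ.* suc (suc a)
    next = trans (ℕ.+-suc d c) (cong suc (trans (ℕ.+-assoc a (c ℕ.* suc a) c)
      (cong (a ℕ.+_) (trans (ℕ.+-comm (c ℕ.* suc a) c) (sym (ℕ.*-suc c (suc a)))))))
    block : H d C ≤ h a
    block = subst (H d C ≤_) (h-scale c a) (H≤ d C ℕ.≤-refl)

  lowerSum≤upperSum : ∀ m ν μ → lowerSum m ν ≤ upperSum m μ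
  lowerSum≤upperSum m ν μ = begin
    H (suc ν) (k ℕ.* suc ν)
      ≤⟨ refine-lower μ (suc ν) (k ℕ.* suc ν) ⟩
    H (suc μ ℕ.* suc ν) (suc μ ℕ.* (k ℕ.* suc ν))
      ≡⟨ cong₂ H (ℕ.*-comm (suc μ) (suc ν)) len ⟩
    H (suc (μ ℕ.+ ν ℕ.* suc μ)) (suc ν ℕ.* (k ℕ.* suc μ))
      ≤⟨ H-shift _ (suc ν ℕ.* (k ℕ.* suc μ)) ⟩
    H (μ ℕ.+ ν ℕ.* suc μ) (suc ν ℕ.* (k ℕ.* suc μ))
      ≤⟨ refine-upper ν μ (k ℕ.* suc μ) ⟩
    H μ (k ℕ.* suc μ) ∎
    where
    open ℚ.≤-Reasoning
    k : ℕ
    k = m ℕ.∸ 1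
    len : suc μ ℕ.* (k ℕ.* suc ν) ≡ suc ν ℕ.* (k ℕ.* suc μ)
    len = trans (ℕ.*-comm (suc μ) (k ℕ.* suc ν)) (trans
      (cong (ℕ._* suc μ) (ℕ.*-comm k (suc ν))) (ℕ.*-assoc (suc ν) k (suc μ)))

  upperSum≤lowerSum+h : ∀ m ν → upperSum m ν ≤ h ν + lowerSum m ν
  upperSum≤lowerSum+h m ν = H-extend ν ((m ℕ.∸ 1) ℕ.* suc ν)

open Harmonic

-- log m = ∫₁ᵐ dt/t for m ≥ 1 (and log 0 = 0 by convention).
log : ℕ → ℝ
log m = record
  { L = L′
  ; U = U′
  ; L-inhabited = lowerSum m 0 - 1ℚ , 0 , p-1<p (lowerSum m 0)
  ; U-inhabited = upperSum m 0 + 1ℚ , 0 , p<p+1 (upperSum m 0)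
  ; L-lower = λ p<q (ν , q<) → ν , ℚ.<-trans p<q q<
  ; U-upper = λ p<q (ν , <p) → ν , ℚ.<-trans <p p<q
  ; L-open = λ (ν , q<) → let r , q<r , r< = ℚ.<-dense q< in r , q<r , ν , r<
  ; U-open = λ (ν , <q) → let r , <r , r<q = ℚ.<-dense <q in r , r<q , ν , <r
  ; disjoint = λ (ν , q<) (μ , <q) →
      ℚ.<-irrefl refl (ℚ.<-≤-trans (ℚ.<-trans <q q<) (lowerSum≤upperSum m ν μ))
  ; located = loc
  }
  where
  L′ U′ : Pred ℚ 0ℓ
  L′ q = ∃[ ν ] q < lowerSum m ν
  U′ q = ∃[ ν ] upperSum m ν < q

  loc : ∀ {p q} → p < q → L′ p ⊎ U′ q
  loc {p} {q} p<q with h-small (<⇒0<- p<q)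
  ... | ν , h< with ≤∨< (lowerSum m ν) p
  ...   | inj₂ p< = inj₁ (ν , p<)
  ...   | inj₁ ≤p = inj₂ (ν , ℚ.≤-<-trans (upperSum≤lowerSum+h m ν)
            (subst (λ t → h ν + lowerSum m ν < t) (-+cancel p q) (ℚ.+-mono-<-≤ h< ≤p)))

-- Ω N S consists of the maps {1,…,S} → {−1,+1}ᴺ.
Ω : ℕ → ℕ → Set
Ω N S = Vec (Vec Sign N) S

words : ∀ {A : Set} → List A → ∀ n → List (Vec A n)
words as zero    = [] List.∷ List.[]
words as (suc n) = cartesianProductWith _∷_ as (words as n)

signs : List Sign
signs = Sign.- List.∷ Sign.+ List.∷ List.[]

outcomes : ∀ N S → List (Ω N S)
outcomes N S = words (words signs N) S

-- The n-th entry, counted from 1; the value outside 1 ≤ n ≤ N is never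
-- used below.
entry : ∀ {N} → Vec Sign N → ℕ → ℤ
entry []       _             = 0ℤ
entry (x ∷ xs) zero          = 0ℤ
entry (x ∷ xs) (suc zero)    = x ◃ 1
entry (x ∷ xs) (suc (suc n)) = entry xs (suc n)

e : ∀ {N S} → Ω N S → ℕ → Fin S → ℤ
e ω n s = entry (lookup ω s) n

-- Given that d is nondecreasing, the second condition for all i amounts
-- to the one for the last i.
Admissible : ∀ {k S} → ℕ → ℕ → Vec ℕ k → Vec (Fin S) k → Set
Admissible N M d s =
  (∀ i j → i Fin.≤ j → lookup d i ℕ.≤ lookup d j) ×
  (∀ i → lookup d i ℕ.< M ℕ.+ lookup d i × M ℕ.+ lookup d i ℕ.≤ N) ×
  (∀ i j → i ≢ j → lookup s i ≡ lookup s j → lookup d i ≢ lookup d j)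

admissible? : ∀ {k S} N M (d : Vec ℕ k) (s : Vec (Fin S) k) → Dec (Admissible N M d s)
admissible? N M d s =
  Fin.all? (λ i → Fin.all? λ j → (i Fin.≤? j) →-dec (lookup d i ℕ.≤? lookup d j)) ×-dec
  Fin.all? (λ i → (lookup d i ℕ.<? M ℕ.+ lookup d i) ×-dec (M ℕ.+ lookup d i ℕ.≤? N)) ×-dec
  Fin.all? (λ i → Fin.all? λ j → ¬? (i Fin.≟ j) →-dec
    ((lookup s i Fin.≟ lookup s j) →-dec ¬? (lookup d i ℕ.≟ lookup d j)))

correlationSum : ∀ {k N S} → Ω N S → ℕ → Vec ℕ k → Vec (Fin S) k → ℤ
correlationSum ω M d s =
  Sum.sum {M} λ n → Product.sum λ i → e ω (suc (toℕ n) ℕ.+ lookup d i) (lookup s i)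

-- The parameters range over finite lists large enough to contain every
-- admissible (M , d , s).
Φ : ∀ {N S} → ℕ → Ω N S → ℕ
Φ {N} {S} k ω = max 0 (map (λ (M , d , s) → ℤ.∣ correlationSum ω M d s ∣)
  (filter (λ (M , d , s) → admissible? N M d s)
    (cartesianProduct (upTo (suc N))
      (cartesianProduct (words (upTo (suc N)) k) (words (allFin S) k)))))

length-cartesianProductWith : ∀ {A B C : Set} (f : A → B → C) xs ys →
  length (cartesianProductWith f xs ys) ≡ length xs ℕ.* length ys
length-cartesianProductWith f List.[]         ys = refl
length-cartesianProductWith f (x List.∷ xs) ys =
  trans (List.length-++ (map (f x) ys))
    (cong₂ ℕ._+_ (List.length-map (f x) ys) (length-cartesianProductWith f xs ys))

length-words : ∀ {A : Set} (as : List A) n → length (words as n) ≡ length as ℕ.^ n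
length-words as zero    = refl
length-words as (suc n) = trans (length-cartesianProductWith _∷_ as (words as n))
  (cong (length as ℕ.*_) (length-words as n))

length-outcomes : ∀ N S → length (outcomes N S) ≡ 2 ℕ.^ (S ℕ.* N)
length-outcomes N S = trans (length-words (words signs N) S)
  (trans (cong (ℕ._^ S) (length-words signs N))
    (trans (ℕ.^-*-assoc 2 N S) (cong (2 ℕ.^_) (ℕ.*-comm N S))))

-- Independent uniform signs give the uniform measure on Ω N S.
ℙ : ∀ {N S} {A : Pred (Ω N S) 0ℓ} → Decidable A → ℚ
ℙ {N} {S} A? = _/_ (+ length (filter A? (outcomes N S))) (2 ℕ.^ (S ℕ.* N))
                   {{ℕ.m^n≢0 2 (S ℕ.* N)}}

-- E has probability at least p.  An event that compares real numbers need
-- not be decidable, so its probability is bounded below through the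
-- decidable events it contains; classically one may take A = E.
ℙ[_]≥_ : ∀ {N S} → Pred (Ω N S) 0ℓ → ℚ → Set₁
ℙ[_]≥_ {N} {S} E p = Σ[ A ∈ Pred (Ω N S) 0ℓ ] Σ[ A? ∈ Decidable A ] A ⊆ E × p ≤ ℙ A?

ℙ[_]→1 : ∀ {S} → (∀ N → Pred (Ω N S) 0ℓ) → Set₁
ℙ[ E ]→1 = ∀ δ → 0ℚ < δ → ∃[ N₀ ] ∀ N → N₀ ℕ.≤ N → ℙ[ E N ]≥ (1ℚ - δ)

module Submission where

-- Let B be the number of k-subsets of {0,…,N−1} × {1,…,S} that meet the
-- first row, B = C(SN,k) − C(S(N−1),k).  Translating the smallest d_i to 0
-- shows that Φ_k is the largest absolute sum over a window of consecutive
-- steps of one of B walks, each with independent uniform signs as steps.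
-- The windows cost nothing: W − min W is the walk reflected at 0, for which
-- x^(d+1) + x^(−d) is an eigenfunction with the same eigenvalue x + 1/x as
-- x^d for the free walk.  So a window sum reaches λ with probability at most
-- 4 e^{−λ²/2N}, which is 4 B^{−(1+ε)²} at the claimed bound, and it remains
-- to see that the sum over k of B · B^{−(1+ε)²} vanishes as N → ∞.
--
-- Only rationals are needed: e^{1/m} is replaced by 1 + 1/m, for an m that
-- is a common multiple of the denominators in a Riemann sum for log B.
open import Defs
open import Level using (0ℓ)
open import Algebra.Bundles using (CommutativeRing)
open import Data.Nat.Base as ℕ using (ℕ; zero; suc; NonZero; z≤n; s≤s)
import Data.Nat.Properties as ℕ
open import Data.Nat.Tactic.RingSolver using (solve-∀)
open import Data.Integer.Base as ℤ using (ℤ)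
import Data.Integer.Properties as ℤ
open import Data.Rational.Base as ℚ using (ℚ; 0ℚ; 1ℚ; ½)
import Data.Rational.Properties as ℚ
open import Data.Rational.Solver using (module +-*-Solver)
open import Data.Rational.Unnormalised.Base as ℚᵘ using (mkℚᵘ; *≡*)
import Data.Rational.Unnormalised.Properties as ℚᵘ
open import Data.Sign.Base as Sign using (Sign)
import Data.Sign.Properties as Sign
open import Data.Fin.Base as Fin using (Fin; zero; suc; toℕ)
import Data.Fin.Properties as Fin
open import Data.List.Base as List
  using (List; []; _∷_; map; _++_; length; filter; upTo; applyUpTo; allFin; cartesianProduct; cartesianProductWith)
import Data.List.Properties as List
open import Data.List.Membership.Propositional using (_∈_; find)
open import Data.List.Membership.Propositional.Properties
  using (∈-map⁺; ∈-map⁻; ∈-++⁺ˡ; ∈-++⁺ʳ; ∈-++⁻; ∈-∃++; ∈-allFin; ∈-upTo⁺; ∈-upTo⁻; ∈-applyUpTo⁺; ∈-applyUpTo⁻;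
         ∈-tabulate⁻; ∈-filter⁻; ∈-cartesianProduct⁺)
open import Data.List.Relation.Unary.Any using (here; there)
open import Data.List.Relation.Unary.All as All using (All)
import Data.List.Relation.Unary.All.Properties as All
open import Data.Vec.Base as Vec using (Vec; []; _∷_; lookup; _[_]≔_)
import Data.Vec.Properties as Vec
open import Data.Product.Base using (_×_; _,_; proj₁; proj₂; ∃-syntax)
open import Data.Sum.Base using (inj₁; inj₂)
open import Data.Empty using (⊥-elim)
open import Function.Base using (_∘_; const; id)
open import Relation.Nullary using (Dec; yes; no; ¬_; ¬?; contradiction)
open import Relation.Unary using (Pred; Decidable)
open import Relation.Binary.PropositionalEquality hiding (J)
open ℝ
open Rational hiding (step)

-- The claimed bound is a real number, so whether Φ_k obeys it need not be decidable, while a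
-- probability here counts a decidable event. Hence an integer threshold is put in front: the least
-- positive λ such that the number W of sign sequences whose reflected walk reaches λ satisfies W ≤
-- 2^(N+1) / B^(1+1/c). Staying below it is decidable and fails with probability at most 2 B W / 2^N
-- ≤ 4 B^(-1/c) for each k. If Φ_k reached a rational above the real bound, the Gaussian tail would
-- make Φ_k itself such a λ, against minimality. The integer c is chosen with 1 + 1/c < 1 + ε; of
-- the exponent (1 + ε)² only 1 + 1/c is kept, since any exponent above 1 will do. For the sum over
-- k, B ≥ C(SN - 1, k - 1). Even at the ends of the range this grows with N, which settles the 4c
-- outermost k. Between them it eventually exceeds (E K)^c for each fixed E, where K = SN - 2, so
-- each of at most K terms is O(1/(E K)).

-- Counting by sums over lists; uniformity of the steps of a walk.

module Counting where

  open import Data.Nat.Base using (_+_; _*_; _∸_; _^_; _≤_; _<_; s<s; ≢-nonZero⁻¹)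
  open import Data.Nat.Properties hiding (_≟_)
  open import Data.List.Properties using (map-++; map-∘; map-cong)
  open import Data.Nat.ListAction using (sum)
  open import Data.Nat.ListAction.Properties using (sum-++)
  open import Algebra.Properties.CommutativeSemigroup +-commutativeSemigroup using (interchange)

  private variable
    A B C : Set

  ∑ : List A → (A → ℕ) → ℕ
  ∑ xs f = sum (map f xs)

  ∑-cong : ∀ (xs : List A) {f g : A → ℕ} → (∀ x → f x ≡ g x) → ∑ xs f ≡ ∑ xs g
  ∑-cong xs f≗g = cong sum (map-cong f≗g xs)

  ∑-mono : ∀ (xs : List A) {f g : A → ℕ} → (∀ {x} → x ∈ xs → f x ≤ g x) → ∑ xs f ≤ ∑ xs g
  ∑-mono []       f≤g = z≤n
  ∑-mono (x ∷ xs) f≤g = +-mono-≤ (f≤g (here refl)) (∑-mono xs (f≤g ∘ there))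

  ∑-+ : ∀ (xs : List A) (f g : A → ℕ) → ∑ xs (λ x → f x + g x) ≡ ∑ xs f + ∑ xs g
  ∑-+ []       f g = refl
  ∑-+ (x ∷ xs) f g = trans (cong (f x + g x +_) (∑-+ xs f g)) (interchange (f x) (g x) (∑ xs f) (∑ xs g))

  ∑-*ˡ : ∀ c (xs : List A) (f : A → ℕ) → ∑ xs (λ x → c * f x) ≡ c * ∑ xs f
  ∑-*ˡ c []       f = sym (*-zeroʳ c)
  ∑-*ˡ c (x ∷ xs) f = trans (cong (c * f x +_) (∑-*ˡ c xs f)) (sym (*-distribˡ-+ c (f x) (∑ xs f)))

  ∑-const : ∀ (xs : List A) c → ∑ xs (const c) ≡ length xs * c
  ∑-const []       c = refl
  ∑-const (x ∷ xs) c = cong (c +_) (∑-const xs c)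

  ∑-swap : ∀ (xs : List A) (ys : List B) (f : A → B → ℕ) →
           ∑ xs (λ x → ∑ ys (f x)) ≡ ∑ ys (λ y → ∑ xs (λ x → f x y))
  ∑-swap []       ys f = sym (trans (∑-const ys 0) (*-zeroʳ (length ys)))
  ∑-swap (x ∷ xs) ys f = trans (cong (∑ ys (f x) +_) (∑-swap xs ys f))
    (sym (∑-+ ys (f x) (λ y → ∑ xs (λ x → f x y))))

  ∑-cartesianProductWith : ∀ (g : A → B → C) xs ys (f : C → ℕ) →
    ∑ (cartesianProductWith g xs ys) f ≡ ∑ xs (λ x → ∑ ys (λ y → f (g x y)))
  ∑-cartesianProductWith g []       ys f = refl
  ∑-cartesianProductWith g (x ∷ xs) ys f = trans
    (cong sum (map-++ f (map (g x) ys) (cartesianProductWith g xs ys)))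
    (trans (sum-++ (map f (map (g x) ys)) (map f (cartesianProductWith g xs ys)))
      (cong₂ _+_ (cong sum (sym (map-∘ ys))) (∑-cartesianProductWith g xs ys f)))

  ⟦_⟧ : {P : Set} → Dec P → ℕ
  ⟦ yes _ ⟧ = 1
  ⟦ no  _ ⟧ = 0

  ⟦⟧-yes : {P : Set} (P? : Dec P) → P → ⟦ P? ⟧ ≡ 1
  ⟦⟧-yes (yes _) p = refl
  ⟦⟧-yes (no ¬p) p = contradiction p ¬p

  ⟦⟧-≤ : {P : Set} (P? : Dec P) {n : ℕ} → (P → 1 ≤ n) → ⟦ P? ⟧ ≤ n
  ⟦⟧-≤ (yes p) f = f p
  ⟦⟧-≤ (no _)  f = z≤n

  ∑-filter : {P : Pred A 0ℓ} (P? : Decidable P) → ∀ xs → length (filter P? xs) ≡ ∑ xs (⟦_⟧ ∘ P?)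
  ∑-filter P? []       = refl
  ∑-filter P? (x ∷ xs) with P? x
  ... | yes _ = cong suc (∑-filter P? xs)
  ... | no  _ = ∑-filter P? xs

  filter-complement : {P : Pred A 0ℓ} (P? : Decidable P) → ∀ xs →
    length (filter P? xs) + length (filter (¬? ∘ P?) xs) ≡ length xs
  filter-complement P? []       = refl
  filter-complement P? (x ∷ xs) with P? x
  ... | yes _ = cong suc (filter-complement P? xs)
  ... | no  _ = trans (+-suc _ _) (cong suc (filter-complement P? xs))

  1≤∑ : ∀ {x : A} {xs} {f : A → ℕ} → x ∈ xs → 1 ≤ f x → 1 ≤ ∑ xs f
  1≤∑ {xs = y ∷ xs} {f} (here refl) 1≤ = ≤-trans 1≤ (m≤m+n (f y) (∑ xs f))
  1≤∑ {xs = y ∷ xs} {f} (there x∈)  1≤ = ≤-trans (1≤∑ x∈ 1≤) (m≤n+m (∑ xs f) (f y))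

  ¬All⇒1≤∑ : ∀ {A : Set} {P : Pred A 0ℓ} (P? : Decidable P) xs {f : A → ℕ} →
    (∀ {x} → ¬ P x → 1 ≤ f x) → ¬ All P xs → 1 ≤ ∑ xs f
  ¬All⇒1≤∑ P? xs bound ¬all with find (All.¬All⇒Any¬ P? xs ¬all)
  ... | x , x∈ , ¬p = 1≤∑ x∈ (bound ¬p)

  ∑-signs : ∀ σ (f : Sign → ℕ) → ∑ signs (λ τ → f (τ Sign.* σ)) ≡ ∑ signs f
  ∑-signs Sign.+ f = refl
  ∑-signs Sign.- f = trans (cong (f Sign.+ +_) (+-comm (f Sign.-) 0)) (trans (+-comm (f Sign.+) (f Sign.-))
    (cong (f Sign.- +_) (+-comm 0 (f Sign.+))))

  -- Conditioning on all letters but the i-th: the other n ∸ 1 letters are free, and resampling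
  -- letter i contributes at most K. The letters will be whole sequences e(s), and i the pivot s₀.
  ∑-words-fix : ∀ (as : List A) {n} (i : Fin n) (g : Vec A n → ℕ) {K} →
    (∀ w → ∑ as (λ a → g (w [ i ]≔ a)) ≤ K) → ∑ (words as n) g ≤ length as ^ (n ∸ 1) * K
  ∑-words-fix as {suc n} zero g {K} bound = begin
    ∑ (words as (suc n)) g                    ≡⟨ ∑-cartesianProductWith _∷_ as (words as n) g ⟩
    ∑ as (λ a → ∑ (words as n) (g ∘ (a ∷_))) ≡⟨ ∑-swap as (words as n) (λ a w → g (a ∷ w)) ⟩
    ∑ (words as n) (λ w → ∑ as (λ a → g (a ∷ w)))
      ≤⟨ ∑-mono (words as n) (λ {w} _ → drop-head as w bound) ⟩
    ∑ (words as n) (const K)                  ≡⟨ ∑-const (words as n) K ⟩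
    length (words as n) * K                   ≡⟨ cong (_* K) (length-words as n) ⟩
    length as ^ n * K                         ∎
    where
    open ≤-Reasoning
    -- `bound` overwrites the head of a full word, so some head must be supplied: the summation list
    -- provides one unless it is empty, and then the sum is 0.
    drop-head : ∀ bs w → (∀ w → ∑ bs (λ a → g (w [ zero ]≔ a)) ≤ K) → ∑ bs (λ a → g (a ∷ w)) ≤ K
    drop-head []       w _     = z≤n
    drop-head (a ∷ _) w bound = bound (a ∷ w)
  ∑-words-fix as {suc (suc n)} (suc i) g {K} bound = begin
    ∑ (words as (suc (suc n))) g
      ≡⟨ ∑-cartesianProductWith _∷_ as (words as (suc n)) g ⟩
    ∑ as (λ a → ∑ (words as (suc n)) (g ∘ (a ∷_)))
      ≤⟨ ∑-mono as (λ {a} _ → ∑-words-fix as i (g ∘ (a ∷_)) (λ w → bound (a ∷ w))) ⟩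
    ∑ as (const (length as ^ n * K))    ≡⟨ ∑-const as _ ⟩
    length as * (length as ^ n * K)     ≡⟨ *-assoc (length as) (length as ^ n) K ⟨
    length as ^ suc n * K               ∎
    where open ≤-Reasoning

  -- Entries counted from 0, and + outside the range.
  at : ∀ {n} → Vec Sign n → ℕ → Sign
  at []       _       = Sign.+
  at (x ∷ v) zero    = x
  at (x ∷ v) (suc i) = at v i

  Position : ℕ → Set
  Position S = ℕ × Fin S

  ∏ : List A → (A → Sign) → Sign → Sign
  ∏ []       f σ = σ
  ∏ (x ∷ xs) f σ = f x Sign.* ∏ xs f σ

  ∏-cong : ∀ (xs : List A) {f g : A → Sign} σ → (∀ {x} → x ∈ xs → f x ≡ g x) → ∏ xs f σ ≡ ∏ xs g σ
  ∏-cong []       σ f≗g = refl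
  ∏-cong (x ∷ xs) σ f≗g = cong₂ Sign._*_ (f≗g (here refl)) (∏-cong xs σ (f≗g ∘ there))

  -- The walk steps σ · e_{n+d₁}(s₁)⋯e_{n+d_k}(s_k), where D lists the (d_i , s_i).
  steps : ∀ {N S} → List (Position S) → Sign → Ω N S → Vec Sign N
  steps {zero}  D σ ω = []
  steps {suc N} D σ ω = ∏ D (λ (d , s) → at (lookup ω s) d) σ ∷ steps D σ (Vec.map Vec.tail ω)

  Separated : ∀ {S} → Fin S → List (Position S) → Set
  Separated s₀ D = ∀ {d s} → (d , s) ∈ D → s ≡ s₀ → NonZero d

  -- Reading e(s₀) backwards in time, each new entry enters exactly one new
  -- step, as a factor, so the steps are uniform.
  ∑-steps : ∀ {N S} (s₀ : Fin S) (D : List (Position S)) σ → Separated s₀ D →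
    (ω : Ω N S) (g : Vec Sign N → ℕ) →
    ∑ (words signs N) (λ v → g (steps ((0 , s₀) ∷ D) σ (ω [ s₀ ]≔ v))) ≡ ∑ (words signs N) g
  ∑-steps {zero}  s₀ D σ sep ω g = refl
  ∑-steps {suc N} {S} s₀ D σ sep ω g = begin
    ∑ (words signs (suc N)) (λ v → g (steps D⁺ σ (ω [ s₀ ]≔ v)))
      ≡⟨ ∑-cartesianProductWith _∷_ signs (words signs N) _ ⟩
    ∑ signs (λ x → ∑ (words signs N) (λ v → g (steps D⁺ σ (ω [ s₀ ]≔ (x ∷ v)))))
      ≡⟨ ∑-cong signs (λ x → ∑-cong (words signs N) (λ v → cong g (split x v))) ⟩
    ∑ signs (λ x → ∑ (words signs N) (λ v → g (x Sign.* factor v ∷ rest v)))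
      ≡⟨ ∑-swap signs (words signs N) (λ x v → g (x Sign.* factor v ∷ rest v)) ⟩
    ∑ (words signs N) (λ v → ∑ signs (λ x → g (x Sign.* factor v ∷ rest v)))
      ≡⟨ ∑-cong (words signs N) (λ v → ∑-signs (factor v) (λ x → g (x ∷ rest v))) ⟩
    ∑ (words signs N) (λ v → ∑ signs (λ x → g (x ∷ rest v)))
      ≡⟨ ∑-swap (words signs N) signs (λ v x → g (x ∷ rest v)) ⟩
    ∑ signs (λ x → ∑ (words signs N) (λ v → g (x ∷ rest v)))
      ≡⟨ ∑-cong signs (λ x → ∑-steps s₀ D σ sep (Vec.map Vec.tail ω) (g ∘ (x ∷_))) ⟩
    ∑ signs (λ x → ∑ (words signs N) (λ v → g (x ∷ v)))
      ≡⟨ ∑-cartesianProductWith _∷_ signs (words signs N) g ⟨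
    ∑ (words signs (suc N)) g ∎
    where
    open ≡-Reasoning
    D⁺ : List (Position S)
    D⁺ = (0 , s₀) ∷ D
    value : Vec Sign (suc N) → Position S → Sign
    value v (d , s) = at (lookup (ω [ s₀ ]≔ v) s) d
    factor : Vec Sign N → Sign
    factor v = ∏ D (value (Sign.+ ∷ v)) σ
    rest : Vec Sign N → Vec Sign N
    rest v = steps D⁺ σ (Vec.map Vec.tail ω [ s₀ ]≔ v)
    -- The product over `D` does not see the current entry x of sequence s₀: each position lies in
    -- another sequence or, by `Separated`, reads a later entry. So `factor` may use + in place of
    -- x, and for fixed v it merely permutes the two signs.
    value-head : ∀ x v {p} → p ∈ D → value (x ∷ v) p ≡ value (Sign.+ ∷ v) p
    value-head x v {d , s} p∈D with s Fin.≟ s₀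
    value-head x v {zero  , s} p∈D | yes s≡s₀ = ⊥-elim (≢-nonZero⁻¹ 0 {{sep p∈D s≡s₀}} refl)
    value-head x v {suc d , s} p∈D | yes refl = trans
      (cong (λ w → at w (suc d)) (Vec.lookup∘update s ω (x ∷ v)))
      (sym (cong (λ w → at w (suc d)) (Vec.lookup∘update s ω (Sign.+ ∷ v))))
    value-head x v {d , s} p∈D | no s≢s₀ = trans
      (cong (λ w → at w d) (Vec.lookup∘update′ s≢s₀ ω (x ∷ v)))
      (sym (cong (λ w → at w d) (Vec.lookup∘update′ s≢s₀ ω (Sign.+ ∷ v))))
    split : ∀ x v → steps D⁺ σ (ω [ s₀ ]≔ (x ∷ v)) ≡ x Sign.* factor v ∷ rest v
    split x v = cong₂ _∷_
      (cong₂ Sign._*_ (cong (λ w → at w 0) (Vec.lookup∘update s₀ ω (x ∷ v)))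
                      (∏-cong D σ (value-head x v)))
      (cong (steps D⁺ σ) (Vec.map-[]≔ Vec.tail ω s₀))

  -- The power of 2 counts the S ∸ 1 sequences other than s₀. Entries beyond N are read as +, so
  -- every configuration gives a full walk of N uniform steps, whatever its largest d.
  ∑-outcomes-steps : ∀ {N S} (s₀ : Fin S) (D : List (Position S)) σ → Separated s₀ D →
    (g : Vec Sign N → ℕ) →
    ∑ (outcomes N S) (g ∘ steps ((0 , s₀) ∷ D) σ) ≤ 2 ^ (N * (S ∸ 1)) * ∑ (words signs N) g
  ∑-outcomes-steps {N} {S} s₀ D σ sep g = subst (λ t → ∑ (outcomes N S) (g ∘ steps ((0 , s₀) ∷ D) σ) ≤ t * ∑ (words signs N) g) pow
    (∑-words-fix (words signs N) s₀ (g ∘ steps ((0 , s₀) ∷ D) σ)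
      (λ ω → ≤-reflexive (∑-steps s₀ D σ sep ω g)))
    where
    pow : length (words signs N) ^ (S ∸ 1) ≡ 2 ^ (N * (S ∸ 1))
    pow = trans (cong (_^ (S ∸ 1)) (length-words signs N)) (^-*-assoc 2 N (S ∸ 1))

  at-tail : ∀ {n} (v : Vec Sign (suc n)) i → at (Vec.tail v) i ≡ at v (suc i)
  at-tail (x ∷ v) i = refl

  at-steps : ∀ {N S} (D : List (Position S)) σ (ω : Ω N S) {i} → i < N →
    at (steps D σ ω) i ≡ ∏ D (λ (d , s) → at (lookup ω s) (i + d)) σ
  at-steps {suc N} D σ ω {zero}  _         = refl
  at-steps {suc N} D σ ω {suc i} (s<s i<N) = trans (at-steps D σ (Vec.map Vec.tail ω) i<N)
    (∏-cong D σ (λ {(d , s)} _ → trans (cong (λ w → at w (i + d)) (Vec.lookup-map s Vec.tail ω))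
      (at-tail (lookup ω s) (i + d))))

open Counting

-- Subsets of positions that meet the first row.

module Configurations where

  open import Data.Nat.Base using (_+_; _*_; _∸_; _^_; _≤_; _<_; _⊔_; pred; s≤s⁻¹; s<s)
  open import Data.Nat.Properties
  open import Data.Nat.Combinatorics using (_C_; nCk+nC[k+1]≡[n+1]C[k+1]; k>n⇒nCk≡0)
  open import Data.Integer.Base using (+_; -[1+_]; _◃_; +≤+)
  open import Data.List.Extrema.Nat using (max<v⁺)
  open import Data.List.Relation.Unary.AllPairs using (_∷_)
  open import Data.List.Relation.Unary.Unique.Propositional using (Unique)
  import Data.List.Relation.Unary.Unique.Propositional.Properties as Unique
  open import Data.List.Relation.Binary.Permutation.Propositional as ↭ using (_↭_; ↭-sym; ↭-trans; ↭⇒↭ₛ)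
  open import Data.List.Relation.Binary.Permutation.Propositional.Properties using (shift; ↭-length; ∈-resp-↭)
  import Data.List.Relation.Binary.Permutation.Setoid.Properties as ↭ₛ
  open import Data.Product.Properties using (≡-dec)
  open import Relation.Binary.Definitions using (DecidableEquality)
  import Algebra.Properties.Monoid.Sum ℤ.+-0-monoid as Sum
  import Algebra.Properties.Monoid.Sum ℤ.*-1-monoid as Product

  private variable
    A : Set

  choose : List A → ℕ → List (List A)
  choose xs       zero    = [] ∷ []
  choose []       (suc k) = []
  choose (x ∷ xs) (suc k) = map (x ∷_) (choose xs k) ++ choose xs (suc k)

  length-choose : ∀ (xs : List A) k → length (choose xs k) ≡ length xs C k
  length-choose xs       zero    = refl
  length-choose []       (suc k) = sym (k>n⇒nCk≡0 (s≤s (z≤n {k})))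
  length-choose (x ∷ xs) (suc k) = trans (List.length-++ (map (x ∷_) (choose xs k)))
    (trans (cong₂ _+_ (trans (List.length-map (x ∷_) (choose xs k)) (length-choose xs k)) (length-choose xs (suc k)))
      (nCk+nC[k+1]≡[n+1]C[k+1] (length xs) k))

  choose-⊆ : ∀ (xs : List A) k {ys} → ys ∈ choose xs k → ∀ {y} → y ∈ ys → y ∈ xs
  choose-⊆ xs       zero    (here refl) ()
  choose-⊆ (x ∷ xs) (suc k) ys∈ y∈ with ∈-++⁻ (map (x ∷_) (choose xs k)) ys∈
  ... | inj₂ ys∈′ = there (choose-⊆ xs (suc k) ys∈′ y∈)
  ... | inj₁ ys∈′ with ∈-map⁻ (x ∷_) ys∈′
  choose-⊆ (x ∷ xs) (suc k) ys∈ (here refl) | inj₁ _ | _ , _    , refl = here refl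
  choose-⊆ (x ∷ xs) (suc k) ys∈ (there y∈)  | inj₁ _ | _ , zs∈ , refl = there (choose-⊆ xs k zs∈ y∈)

  -- The (k + 1)-element sublists of xs ++ ys that meet xs.
  meeting : List A → List A → ℕ → List (List A)
  meeting []       ys k = []
  meeting (x ∷ xs) ys k = map (x ∷_) (choose (xs ++ ys) k) ++ meeting xs ys k

  -- The sublists that miss `xs` are those of `ys`; each element of `xs` in turn is one use of
  -- Pascal's rule. As a sum, the identity avoids truncated subtraction.
  length-meeting : ∀ (xs ys : List A) k →
    length (meeting xs ys k) + length ys C suc k ≡ (length xs + length ys) C suc k
  length-meeting []       ys k = refl
  length-meeting (x ∷ xs) ys k = begin
    length (map (x ∷_) (choose (xs ++ ys) k) ++ meeting xs ys k) + length ys C suc k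
      ≡⟨ cong (_+ length ys C suc k) (List.length-++ (map (x ∷_) (choose (xs ++ ys) k))) ⟩
    length (map (x ∷_) (choose (xs ++ ys) k)) + length (meeting xs ys k) + length ys C suc k
      ≡⟨ +-assoc (length (map (x ∷_) (choose (xs ++ ys) k))) _ _ ⟩
    length (map (x ∷_) (choose (xs ++ ys) k)) + (length (meeting xs ys k) + length ys C suc k)
      ≡⟨ cong₂ _+_ (trans (List.length-map (x ∷_) (choose (xs ++ ys) k)) (length-choose (xs ++ ys) k))
                   (length-meeting xs ys k) ⟩
    length (xs ++ ys) C k + (length xs + length ys) C suc k
      ≡⟨ cong (λ n → n C k + (length xs + length ys) C suc k) (List.length-++ xs) ⟩
    (length xs + length ys) C k + (length xs + length ys) C suc k
      ≡⟨ nCk+nC[k+1]≡[n+1]C[k+1] (length xs + length ys) k ⟩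
    (suc (length xs) + length ys) C suc k ∎
    where open ≡-Reasoning

  -- This supplies the pivot: with the first row for `xs`, every configuration starts with some (0 ,
  -- s) that does not recur in it.
  meeting-head : ∀ (xs ys : List A) k {zs} → Unique (xs ++ ys) → zs ∈ meeting xs ys k →
    ∃[ x ] ∃[ zs′ ] x ∈ xs × zs ≡ x ∷ zs′ × ¬ x ∈ zs′
  meeting-head (x ∷ xs) ys k (x∉ ∷ unique) zs∈ with ∈-++⁻ (map (x ∷_) (choose (xs ++ ys) k)) zs∈
  ... | inj₁ zs∈′ = let zs′ , zs′∈ , eq = ∈-map⁻ (x ∷_) zs∈′
                    in x , zs′ , here refl , eq , λ x∈ → All.lookup x∉ (choose-⊆ (xs ++ ys) k zs′∈ x∈) refl
  ... | inj₂ zs∈′ = let y , zs′ , y∈ , eq , y∉ = meeting-head xs ys k unique zs∈′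
                    in y , zs′ , there y∈ , eq , y∉

  Unique-resp-↭ : ∀ {xs ys : List A} → xs ↭ ys → Unique xs → Unique ys
  Unique-resp-↭ {A} p = ↭ₛ.Unique-resp-↭ (setoid A) (↭⇒↭ₛ p)

  remove : ∀ {x : A} {xs} → x ∈ xs → Unique xs →
    ∃[ ys ] xs ↭ x ∷ ys × Unique ys × ¬ x ∈ ys
  remove {x = x} x∈ unique with ∈-∃++ x∈
  ... | ys , zs , refl with Unique-resp-↭ (shift x ys zs) unique
  ...   | x∉ ∷ unique′ = ys ++ zs , shift x ys zs , unique′ , λ x∈ → All.lookup x∉ x∈ refl

  module _ {A : Set} (_≟_ : DecidableEquality A) where
    open import Data.List.Membership.DecPropositional _≟_ using (_∈?_)

    drop-head : ∀ {x : A} {xs ys} → (∀ {y} → y ∈ ys → y ∈ x ∷ xs) → ¬ x ∈ ys → ∀ {y} → y ∈ ys → y ∈ xs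
    drop-head ys⊆ x∉ y∈ with ys⊆ y∈
    ... | here refl = contradiction y∈ x∉
    ... | there y∈′ = y∈′

    choose-complete : ∀ (xs : List A) k {ys} → Unique ys → length ys ≡ k →
      (∀ {y} → y ∈ ys → y ∈ xs) → ∃[ zs ] zs ∈ choose xs k × ys ↭ zs
    choose-complete xs       zero    {[]}     unique eq ys⊆ = [] , here refl , ↭.refl
    choose-complete []       (suc k) {y ∷ ys} unique eq ys⊆ with () ← ys⊆ (here refl)
    choose-complete (x ∷ xs) (suc k) {ys}     unique eq ys⊆ with x ∈? ys
    ... | no x∉ = let zs , zs∈ , p = choose-complete xs (suc k) unique eq (drop-head ys⊆ x∉)
                  in zs , ∈-++⁺ʳ (map (x ∷_) (choose xs k)) zs∈ , p
    ... | yes x∈ =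
      let ys′ , p , unique′ , x∉ = remove x∈ unique
          zs , zs∈ , p′ = choose-complete xs k unique′ (suc-injective (trans (sym (↭-length p)) eq))
                            (drop-head (ys⊆ ∘ ∈-resp-↭ (↭-sym p) ∘ there) x∉)
      in x ∷ zs , ∈-++⁺ˡ (∈-map⁺ (x ∷_) zs∈) , ↭-trans p (↭.prep x p′)

    -- Only up to permutation, because equal d_i leave the order of their s_i free, so an admissible
    -- tuple need not follow the order of the list. The product of signs does not depend on the
    -- order.
    meeting-complete : ∀ (xs ys : List A) k {zs z} → Unique zs → length zs ≡ suc k →
      (∀ {y} → y ∈ zs → y ∈ xs ++ ys) → z ∈ zs → z ∈ xs → ∃[ D ] D ∈ meeting xs ys k × zs ↭ D
    meeting-complete (x ∷ xs) ys k {zs} unique eq zs⊆ z∈zs z∈xs with x ∈? zs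
    ... | yes x∈ =
      let zs′ , p , unique′ , x∉ = remove x∈ unique
          D , D∈ , p′ = choose-complete (xs ++ ys) k unique′ (suc-injective (trans (sym (↭-length p)) eq))
                            (drop-head (zs⊆ ∘ ∈-resp-↭ (↭-sym p) ∘ there) x∉)
      in x ∷ D , ∈-++⁺ˡ (∈-map⁺ (x ∷_) D∈) , ↭-trans p (↭.prep x p′)
    meeting-complete (x ∷ xs) ys k unique eq zs⊆ z∈zs (here refl) | no x∉ = contradiction z∈zs x∉
    meeting-complete (x ∷ xs) ys k unique eq zs⊆ z∈zs (there z∈)  | no x∉ =
      let D , D∈ , p = meeting-complete xs ys k unique eq (drop-head zs⊆ x∉) z∈zs z∈
      in D , ∈-++⁺ʳ (map (x ∷_) (choose (xs ++ ys) k)) D∈ , p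

  row₀ : ∀ S → List (Position S)
  row₀ S = map (0 ,_) (allFin S)

  laterRows : ∀ N S → List (Position S)
  laterRows N S = cartesianProduct (applyUpTo suc (N ∸ 1)) (allFin S)

  configurations : ∀ N S → ℕ → List (List (Position S))
  configurations N S k = meeting (row₀ S) (laterRows N S) (k ∸ 1)

  length-configurations : ∀ N S k .{{_ : NonZero N}} .{{_ : NonZero k}} →
    length (configurations N S k) ≡ (S * N) C k ∸ (S * (N ∸ 1)) C k
  length-configurations N@(suc n) S k@(suc k-1) = begin
    length (configurations N S k)
      ≡⟨ m+n∸n≡m (length (configurations N S k)) (length (laterRows N S) C k) ⟨
    length (configurations N S k) + length (laterRows N S) C k ∸ length (laterRows N S) C k
      ≡⟨ cong (_∸ length (laterRows N S) C k) (length-meeting (row₀ S) (laterRows N S) k-1) ⟩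
    (length (row₀ S) + length (laterRows N S)) C k ∸ length (laterRows N S) C k
      ≡⟨ cong₂ (λ a b → (a + b) C k ∸ b C k) row₀-length later-length ⟩
    (S + S * n) C k ∸ (S * n) C k
      ≡⟨ cong (λ a → a C k ∸ (S * n) C k) (*-suc S n) ⟨
    (S * N) C k ∸ (S * n) C k ∎
    where
    open ≡-Reasoning
    first : Fin S → Position S
    first s = 0 , s
    row₀-length : length (row₀ S) ≡ S
    row₀-length = trans (List.length-map first (allFin S)) (List.length-tabulate {n = S} id)
    later-length : length (laterRows N S) ≡ S * n
    later-length = trans (length-cartesianProductWith _,_ (applyUpTo suc n) (allFin S))
      (trans (cong₂ _*_ (List.length-applyUpTo suc n) (List.length-tabulate id)) (*-comm n S))

  positions-unique : ∀ N S .{{_ : NonZero N}} → Unique (row₀ S ++ laterRows N S)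
  -- The first row followed by the later rows computes to the product of `upTo (suc n)` and
  -- `allFin S`.
  positions-unique (suc n) S = Unique.cartesianProduct⁺ (Unique.upTo⁺ (suc n)) (Unique.allFin⁺ S)

  ∈-row₀ : ∀ {S} (s : Fin S) → (0 , s) ∈ row₀ S
  ∈-row₀ s = ∈-map⁺ (0 ,_) (∈-allFin s)

  ∈-positions : ∀ {N S d} (s : Fin S) → d < N → (d , s) ∈ row₀ S ++ laterRows N S
  ∈-positions {suc n} s d<N = ∈-cartesianProduct⁺ (∈-upTo⁺ d<N) (∈-allFin s)

  configuration-pivot : ∀ N S k .{{_ : NonZero N}} {D} → D ∈ configurations N S k →
    ∃[ s ] ∃[ D′ ] D ≡ (0 , s) ∷ D′ × Separated s D′
  configuration-pivot N S k D∈ with meeting-head (row₀ S) (laterRows N S) (k ∸ 1) (positions-unique N S) D∈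
  ... | _ , D′ , x∈ , eq , x∉ with ∈-map⁻ (0 ,_) x∈
  ...   | s , _ , refl = s , D′ , eq , λ { {zero} ∈D′ refl → contradiction ∈D′ x∉ ; {suc _} _ _ → _ }

  -- The reflected walk and window sums.

  step : Sign → ℕ → ℕ
  step Sign.+ d = suc d
  step Sign.- d = pred d

  -- The maximum of the walk reflected at 0; it dominates the sums over all
  -- windows, because reflection restarts the walk at each new minimum.
  peak : ∀ {n} → ℕ → Vec Sign n → ℕ
  peak d []      = d
  peak d (x ∷ v) = d ⊔ peak (step x d) v

  step-mono : ∀ x {d d′} → d ≤ d′ → step x d ≤ step x d′
  step-mono Sign.+ d≤d′ = s≤s d≤d′
  step-mono Sign.- d≤d′ = pred-mono-≤ d≤d′

  peak-mono : ∀ {n} (v : Vec Sign n) {d d′} → d ≤ d′ → peak d v ≤ peak d′ v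
  peak-mono []      d≤d′ = d≤d′
  peak-mono (x ∷ v) d≤d′ = ⊔-mono-≤ d≤d′ (peak-mono v (step-mono x d≤d′))

  start≤peak : ∀ {n} d (v : Vec Sign n) → d ≤ peak d v
  start≤peak d []      = ≤-refl
  start≤peak d (x ∷ v) = m≤m⊔n d _

  peak≤ : ∀ {n} d (v : Vec Sign n) → peak d v ≤ d + n
  peak≤ d []      = m≤m+n d 0
  peak≤ {suc n} d (x ∷ v) = ⊔-lub (m≤m+n d _) (≤-trans (peak≤ (step x d) v)
    (≤-trans (+-monoˡ-≤ n (step≤ x)) (≤-reflexive (sym (+-suc d n)))))
    where
    step≤ : ∀ x → step x d ≤ suc d
    step≤ Sign.+ = ≤-refl
    step≤ Sign.- = ≤-trans pred[n]≤n (n≤1+n d)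

  stepsSum : ∀ {N} → Vec Sign N → ℕ → ℕ → ℤ
  stepsSum v a M = Sum.sum {M} (λ n → at v (toℕ n + a) ◃ 1)

  prefix≤peak : ∀ {N} (v : Vec Sign N) d M → M ≤ N → + d ℤ.+ stepsSum v 0 M ℤ.≤ + peak d v
  prefix≤peak v d zero _ = ℤ.≤-trans (ℤ.≤-reflexive (ℤ.+-identityʳ (+ d))) (+≤+ (start≤peak d v))
  prefix≤peak (x ∷ v) d (suc M) (s≤s M≤N) = begin
    + d ℤ.+ ((x ◃ 1) ℤ.+ stepsSum v 0 M)    ≡⟨ ℤ.+-assoc (+ d) (x ◃ 1) _ ⟨
    + d ℤ.+ (x ◃ 1) ℤ.+ stepsSum v 0 M      ≤⟨ ℤ.+-monoˡ-≤ (stepsSum v 0 M) (step≥ x d) ⟩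
    + step x d ℤ.+ stepsSum v 0 M         ≤⟨ prefix≤peak v (step x d) M M≤N ⟩
    + peak (step x d) v                   ≤⟨ +≤+ (m≤n⊔m d _) ⟩
    + peak d (x ∷ v)                      ∎
    where
    open ℤ.≤-Reasoning
    step≥ : ∀ x d → + d ℤ.+ (x ◃ 1) ℤ.≤ + step x d
    step≥ Sign.+ d       = ℤ.≤-reflexive (cong +_ (+-comm d 1))
    step≥ Sign.- zero    = ℤ.-≤+
    step≥ Sign.- (suc d) = ℤ.≤-refl

  -- After a skipped step the reflected walk stands at 0 or higher, and `peak` is monotone in its
  -- start; so windows that open later reduce to prefixes, where truncation at 0 only raises the
  -- walk.
  window≤peak : ∀ {N} (v : Vec Sign N) a M → M + a ≤ N → stepsSum v a M ℤ.≤ + peak 0 v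
  window≤peak v zero M M≤N = ℤ.≤-trans (ℤ.≤-reflexive (sym (ℤ.+-identityˡ _)))
    (prefix≤peak v 0 M (≤-trans (≤-reflexive (sym (+-identityʳ M))) M≤N))
  window≤peak [] (suc a) M M≤N = contradiction (subst (_≤ 0) (+-suc M a) M≤N) λ ()
  window≤peak {suc N} (x ∷ v) (suc a) M M≤N = begin
    stepsSum (x ∷ v) (suc a) M ≡⟨ Sum.sum-cong-≗ {M} (λ n → cong (λ i → at (x ∷ v) i ◃ 1) (+-suc (toℕ n) a)) ⟩
    stepsSum v a M             ≤⟨ window≤peak v a M (s≤s⁻¹ (subst (_≤ suc N) (+-suc M a) M≤N)) ⟩
    + peak 0 v                 ≤⟨ +≤+ (peak-mono v {0} {step x 0} z≤n) ⟩
    + peak (step x 0) v        ∎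
    where open ℤ.≤-Reasoning

  -- Correlation sums as windows of walks, and the union bound for one k.

  ∏-↭ : ∀ {xs ys : List A} (f : A → Sign) σ → xs ↭ ys → ∏ xs f σ ≡ ∏ ys f σ
  ∏-↭ f σ ↭.refl          = refl
  ∏-↭ f σ (↭.prep x p)    = cong (λ t → f x Sign.* t) (∏-↭ f σ p)
  ∏-↭ {ys = _ ∷ _ ∷ ys} f σ (↭.swap x y p) = trans (cong (λ t → f x Sign.* (f y Sign.* t)) (∏-↭ f σ p))
    (trans (sym (Sign.*-assoc (f x) (f y) _)) (trans (cong (Sign._* ∏ ys f σ) (Sign.*-comm (f x) (f y)))
      (Sign.*-assoc (f y) (f x) _)))
  ∏-↭ f σ (↭.trans p q)   = trans (∏-↭ f σ p) (∏-↭ f σ q)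

  ∏-sign : ∀ (xs : List A) f σ → ∏ xs f σ ≡ σ Sign.* ∏ xs f Sign.+
  ∏-sign []       f σ = sym (Sign.*-identityʳ σ)
  ∏-sign (x ∷ xs) f σ = trans (cong (λ t → f x Sign.* t) (∏-sign xs f σ))
    (trans (sym (Sign.*-assoc (f x) σ _)) (trans (cong (Sign._* ∏ xs f Sign.+) (Sign.*-comm (f x) σ))
      (Sign.*-assoc σ (f x) _)))

  product≡∏ : ∀ {k} (p : Fin k → A) (f : A → Sign) (g : Fin k → ℤ) → (∀ i → g i ≡ f (p i) ◃ 1) →
    Product.sum g ≡ ∏ (List.tabulate p) f Sign.+ ◃ 1
  product≡∏ {k = zero}  p f g eq = refl
  product≡∏ {k = suc k} p f g eq = trans
    (cong₂ ℤ._*_ (eq zero) (product≡∏ (p ∘ suc) f (g ∘ suc) (eq ∘ suc)))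
    (sym (ℤ.◃-distrib-* (f (p zero)) _ 1 1))

  entry≡at : ∀ {N} (v : Vec Sign N) {i} → i < N → entry v (suc i) ≡ at v i ◃ 1
  entry≡at (x ∷ v) {zero}  _         = refl
  entry≡at (x ∷ v) {suc i} (s<s i<N) = entry≡at v i<N

  sum-*ˡ : ∀ M i (f : Fin M → ℤ) → i ℤ.* Sum.sum f ≡ Sum.sum (λ n → i ℤ.* f n)
  sum-*ˡ zero    i f = ℤ.*-zeroʳ i
  sum-*ˡ (suc M) i f = trans (ℤ.*-distribˡ-+ i (f zero) _) (cong (λ t → i ℤ.* f zero ℤ.+ t) (sum-*ˡ M i (f ∘ suc)))

  -- An absolute value becomes a plain sum once σ is multiplied into every step, so that only upper
  -- tails of walks are needed.
  sign-out : ∀ i → ∃[ σ ] (σ ◃ 1) ℤ.* i ≡ + ℤ.∣ i ∣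
  sign-out (+ n)    = Sign.+ , ℤ.*-identityˡ (+ n)
  sign-out -[1+ n ] = Sign.- , cong (+_ ∘ suc) (+-identityʳ n)

  -- Shifting the smallest d_i to 0 turns a correlation sum of e into a
  -- sum over a window of consecutive steps.
  correlation≤peak : ∀ {N S k} (ω : Ω N S) M (d : Vec ℕ (suc k)) (s : Vec (Fin S) (suc k)) →
    Admissible N M d s →
    ∃[ σ ] ∃[ D ] D ∈ configurations N S (suc k) × ℤ.∣ correlationSum ω M d s ∣ ≤ peak 0 (steps D σ ω)
  correlation≤peak {N} {S} {k} ω M d s (mono , range , distinct) with sign-out (correlationSum ω M d s)
  ... | σ , σ-eq with meeting-complete (≡-dec _≟_ Fin._≟_) (row₀ S) (laterRows N S) k {z = 0 , lookup s zero}
                        (Unique.tabulate⁺ p-injective) (List.length-tabulate p) p-inside p-zero (∈-row₀ (lookup s zero))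
    where
    d₀ : ℕ
    d₀ = lookup d zero
    p : Fin (suc k) → Position S
    p i = lookup d i ∸ d₀ , lookup s i
    p-injective : ∀ {i j} → p i ≡ p j → i ≡ j
    p-injective {i} {j} eq with i Fin.≟ j
    ... | yes i≡j = i≡j
    -- Truncated subtraction of d₀ is injective here because d₀ is the smallest of the d_i.
    ... | no  i≢j = contradiction
      (∸-cancelʳ-≡ (mono zero i z≤n) (mono zero j z≤n) (cong proj₁ eq))
      (distinct i j i≢j (cong proj₂ eq))
    p-inside : ∀ {x} → x ∈ List.tabulate p → x ∈ row₀ S ++ laterRows N S
    p-inside x∈ with ∈-tabulate⁻ {f = p} x∈
    ... | i , refl = ∈-positions (lookup s i)
      (≤-<-trans (m∸n≤m (lookup d i) d₀) (<-≤-trans (proj₁ (range i)) (proj₂ (range i))))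
    p-zero : (0 , lookup s zero) ∈ List.tabulate p
    p-zero = here (cong (λ t → t , lookup s zero) (sym (n∸n≡0 d₀)))
  ... | D , D∈ , perm = σ , D , D∈ , ℤ.drop‿+≤+ (begin
    + ℤ.∣ correlationSum ω M d s ∣    ≡⟨ σ-eq ⟨
    (σ ◃ 1) ℤ.* correlationSum ω M d s ≡⟨ sum-*ˡ M (σ ◃ 1) _ ⟩
    Sum.sum {M} (λ n → (σ ◃ 1) ℤ.* Product.sum λ i → e ω (suc (toℕ n) + lookup d i) (lookup s i))
      ≡⟨ Sum.sum-cong-≗ {M} term ⟩
    stepsSum (steps D σ ω) d₀ M
      ≤⟨ window≤peak (steps D σ ω) d₀ M (proj₂ (range zero)) ⟩
    + peak 0 (steps D σ ω) ∎)
    where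
    open ℤ.≤-Reasoning
    d₀ : ℕ
    d₀ = lookup d zero
    p : Fin (suc k) → Position S
    p i = lookup d i ∸ d₀ , lookup s i
    term : ∀ (n : Fin M) →
      (σ ◃ 1) ℤ.* Product.sum (λ i → e ω (suc (toℕ n) + lookup d i) (lookup s i)) ≡
      at (steps D σ ω) (toℕ n + d₀) ◃ 1
    term n = trans (cong (λ t → (σ ◃ 1) ℤ.* t) (product≡∏ p f _ factor)) (trans (sym (ℤ.◃-distrib-* σ _ 1 1))
      (cong (_◃ 1) (trans (sym (∏-sign (List.tabulate p) f σ)) (trans (∏-↭ f σ perm)
        (sym (at-steps D σ ω (<-≤-trans (+-monoˡ-< d₀ (Fin.toℕ<n n)) (proj₂ (range zero)))))))))
      where
      f : Position S → Sign
      -- The window starts at time d₀, which undoes the shift: n + d₀ + (d_i ∸ d₀) = n + d_i.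
      f (d , s) = at (lookup ω s) (toℕ n + d₀ + d)
      factor : ∀ i → e ω (suc (toℕ n) + lookup d i) (lookup s i) ≡ f (p i) ◃ 1
      factor i = trans
        (entry≡at (lookup ω (lookup s i)) (<-≤-trans (+-monoˡ-< (lookup d i) (Fin.toℕ<n n)) (proj₂ (range i))))
        (cong (λ j → at (lookup ω (lookup s i)) j ◃ 1)
          (sym (trans (+-assoc (toℕ n) d₀ _) (cong (λ t → toℕ n + t) (m+[n∸m]≡n (mono zero i z≤n))))))

  Φ≤peak : ∀ {N S k} (ω : Ω N S) {λ₀} .{{_ : NonZero k}} → 0 < λ₀ → λ₀ ≤ Φ k ω →
    ∃[ σ ] ∃[ D ] D ∈ configurations N S k × λ₀ ≤ peak 0 (steps D σ ω)
  Φ≤peak {N} {S} {suc k} ω {λ₀} 0<λ λ≤Φ with All.all? (λ (M , d , s) → ℤ.∣ correlationSum ω M d s ∣ <? λ₀) params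
    where
    params : List (ℕ × Vec ℕ (suc k) × Vec (Fin S) (suc k))
    params = filter (λ (M , d , s) → admissible? N M d s)
      (cartesianProduct (upTo (suc N))
        (cartesianProduct (words (upTo (suc N)) (suc k)) (words (allFin S) (suc k))))
  -- The maximum in `Φ` has default value 0, so `0<λ` covers the case of no admissible parameters.
  ... | yes all< = contradiction λ≤Φ (<⇒≱ (max<v⁺ 0<λ (All.map⁺ all<)))
  ... | no ¬all with find (All.¬All⇒Any¬ (λ (M , d , s) → ℤ.∣ correlationSum ω M d s ∣ <? λ₀) _ ¬all)
  ...   | (M , d , s) , in-filter , ≮ =
    let _ , adm = ∈-filter⁻ (λ (M , d , s) → admissible? N M d s) {xs = cartesianProduct (upTo (suc N))
                    (cartesianProduct (words (upTo (suc N)) (suc k)) (words (allFin S) (suc k)))} in-filter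
        σ , D , D∈ , ≤peak = correlation≤peak ω M d s adm
    in σ , D , D∈ , ≤-trans (≮⇒≥ ≮) ≤peak

  walks : ∀ n → ℕ → ℕ → ℕ
  walks n d λ₀ = ∑ (words signs n) (λ v → ⟦ λ₀ ≤? peak d v ⟧)

  ∈-signs : ∀ σ → σ ∈ signs
  ∈-signs Sign.- = here refl
  ∈-signs Sign.+ = there (here refl)

  -- A union bound over two signs and all configurations. By uniformity each pair contributes the
  -- same number of walks, so only the number of configurations enters.
  Φ-tail : ∀ N S k λ₀ .{{_ : NonZero N}} .{{_ : NonZero k}} → 0 < λ₀ →
    ∑ (outcomes N S) (λ ω → ⟦ λ₀ ≤? Φ k ω ⟧) ≤
    2 ^ (N * (S ∸ 1)) * (2 * (((S * N) C k ∸ (S * (N ∸ 1)) C k) * walks N 0 λ₀))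
  Φ-tail N S k λ₀ 0<λ = begin
    ∑ (outcomes N S) (λ ω → ⟦ λ₀ ≤? Φ k ω ⟧)
      ≤⟨ ∑-mono (outcomes N S) (λ {ω} _ → ⟦⟧-≤ (λ₀ ≤? Φ k ω) (covered ω)) ⟩
    ∑ (outcomes N S) (λ ω → ∑ signs (λ σ → ∑ Ds (λ D → exceeds σ D ω)))
      ≡⟨ ∑-swap (outcomes N S) signs (λ ω σ → ∑ Ds (λ D → exceeds σ D ω)) ⟩
    ∑ signs (λ σ → ∑ (outcomes N S) (λ ω → ∑ Ds (λ D → exceeds σ D ω)))
      ≡⟨ ∑-cong signs (λ σ → ∑-swap (outcomes N S) Ds (λ ω D → exceeds σ D ω)) ⟩
    ∑ signs (λ σ → ∑ Ds (λ D → ∑ (outcomes N S) (exceeds σ D)))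
      ≤⟨ ∑-mono signs (λ {σ} _ → ∑-mono Ds (single σ)) ⟩
    ∑ signs (λ σ → ∑ Ds (λ D → T * walks N 0 λ₀))
      ≡⟨ ∑-cong signs (λ σ → ∑-const Ds (T * walks N 0 λ₀)) ⟩
    ∑ signs (λ σ → length Ds * (T * walks N 0 λ₀))
      ≡⟨ ∑-const signs (length Ds * (T * walks N 0 λ₀)) ⟩
    2 * (length Ds * (T * walks N 0 λ₀))
      ≡⟨ cong (λ b → 2 * (b * (T * walks N 0 λ₀))) (length-configurations N S k) ⟩
    2 * (B * (T * walks N 0 λ₀))
      ≡⟨ cong (2 *_) (x∙yz≈y∙xz B T (walks N 0 λ₀)) ⟩
    2 * (T * (B * walks N 0 λ₀))
      ≡⟨ x∙yz≈y∙xz 2 T (B * walks N 0 λ₀) ⟩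
    T * (2 * (B * walks N 0 λ₀)) ∎
    where
    open ≤-Reasoning
    open import Algebra.Properties.CommutativeSemigroup *-commutativeSemigroup using (x∙yz≈y∙xz)
    Ds : List (List (Position S))
    Ds = configurations N S k
    T B : ℕ
    T = 2 ^ (N * (S ∸ 1))
    B = (S * N) C k ∸ (S * (N ∸ 1)) C k
    exceeds : Sign → List (Position S) → Ω N S → ℕ
    exceeds σ D ω = ⟦ λ₀ ≤? peak 0 (steps D σ ω) ⟧
    covered : ∀ ω → λ₀ ≤ Φ k ω → 1 ≤ ∑ signs (λ σ → ∑ Ds (λ D → exceeds σ D ω))
    covered ω λ≤Φ = let σ , D , D∈ , λ≤peak = Φ≤peak ω 0<λ λ≤Φ in
      1≤∑ {f = λ σ → ∑ Ds (λ D → exceeds σ D ω)} (∈-signs σ)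
          (1≤∑ {f = λ D → exceeds σ D ω} D∈ (≤-reflexive (sym (⟦⟧-yes (λ₀ ≤? peak 0 (steps D σ ω)) λ≤peak))))
    single : ∀ σ {D} → D ∈ Ds → ∑ (outcomes N S) (exceeds σ D) ≤ T * walks N 0 λ₀
    single σ D∈ with configuration-pivot N S k D∈
    ... | s , D′ , refl , sep = ∑-outcomes-steps s D′ σ sep (λ v → ⟦ λ₀ ≤? peak 0 v ⟧)

open Configurations

-- Rational powers and the Gaussian tail of the reflected walk.

module Exponential where

  open import Data.Rational.Base using (_+_; _-_; _*_; -_; _≤_; _<_)
  open import Algebra.Properties.CommutativeSemiring.Exp (CommutativeRing.commutativeSemiring ℚ.+-*-commutativeRing)
    using (_^_; ^-homo-*; ^-assocʳ; ^-distrib-*)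
  open +-*-Solver using (solve; _:+_; _:-_; _:*_; :-_; _:=_; con)

  abstract
    ι-+ : ∀ m n → ι (m ℕ.+ n) ≡ ι m + ι n
    ι-+ zero    n = sym (ℚ.+-identityˡ (ι n))
    ι-+ (suc m) n = trans (ι-suc (m ℕ.+ n)) (trans (cong (λ t → 1ℚ + t) (ι-+ m n))
      (trans (sym (ℚ.+-assoc 1ℚ (ι m) (ι n))) (cong (_+ ι n) (sym (ι-suc m)))))

    ι-* : ∀ m n → ι (m ℕ.* n) ≡ ι m * ι n
    ι-* zero    n = sym (ℚ.*-zeroˡ (ι n))
    ι-* (suc m) n = trans (ι-+ n (m ℕ.* n)) (trans (cong (λ t → ι n + t) (ι-* m n))
      (trans (solve 2 (λ m n → n :+ m :* n := (con 1ℚ :+ m) :* n) refl (ι m) (ι n))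
        (cong (_* ι n) (sym (ι-suc m)))))

    ι-^ : ∀ m n → ι (m ℕ.^ n) ≡ ι m ^ n
    ι-^ m zero    = refl
    ι-^ m (suc n) = trans (ι-* m (m ℕ.^ n)) (cong (λ t → ι m * t) (ι-^ m n))

    0≤ι : ∀ n → 0ℚ ≤ ι n
    0≤ι zero    = ℚ.≤-refl
    0≤ι (suc n) = subst (0ℚ ≤_) (sym (ι-suc n)) (ℚ.<⇒≤ (1+-pos (0≤ι n)))

    0<ι : ∀ n .{{_ : NonZero n}} → 0ℚ < ι n
    0<ι (suc n) = subst (0ℚ <_) (sym (ι-suc n)) (1+-pos (0≤ι n))

    ι-mono : ∀ {m n} → m ℕ.≤ n → ι m ≤ ι n
    ι-mono {m} {n} m≤n = by-≤ (0≤ι (n ℕ.∸ m)) (trans (sym (ι-+ m (n ℕ.∸ m))) (cong ι (ℕ.m+[n∸m]≡n m≤n)))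

    ι-cancel : ∀ {m n} → ι m ≤ ι n → m ℕ.≤ n
    ι-cancel {m} {n} le = ℕ.≮⇒≥ λ n<m → ℚ.<-irrefl refl (ℚ.<-≤-trans (ι-strict n<m) le)
      where
      ι-strict : n ℕ.< m → ι n < ι m
      ι-strict n<m = ℚ.<-≤-trans (subst (ι n <_) (sym (ι-suc n)) (by-< 0<1 (ℚ.+-comm (ι n) 1ℚ))) (ι-mono n<m)

    ι-h : ∀ m → ι (suc m) * h m ≡ 1ℚ
    ι-h m = trans (cong (λ t → ι (suc m) * h t) (sym (ℕ.*-identityʳ m))) (h-scale m 0)

    *-mono-≤ : ∀ {p q r s} → 0ℚ ≤ p → 0ℚ ≤ r → p ≤ q → r ≤ s → p * r ≤ q * s
    *-mono-≤ {p} {q} {r} {s} 0≤p 0≤r p≤q r≤s = ℚ.≤-trans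
      (ℚ.*-monoˡ-≤-nonNeg p {{ℚ.nonNegative 0≤p}} r≤s)
      (ℚ.*-monoʳ-≤-nonNeg s {{ℚ.nonNegative (ℚ.≤-trans 0≤r r≤s)}} p≤q)

    *-monoˡ : ∀ {p r s} → 0ℚ ≤ p → r ≤ s → p * r ≤ p * s
    *-monoˡ {p} 0≤p = ℚ.*-monoˡ-≤-nonNeg p {{ℚ.nonNegative 0≤p}}

    *-monoʳ : ∀ {p r s} → 0ℚ ≤ p → r ≤ s → r * p ≤ s * p
    *-monoʳ {p} 0≤p = ℚ.*-monoʳ-≤-nonNeg p {{ℚ.nonNegative 0≤p}}

    *-cancel : ∀ {p r s} → 0ℚ < p → p * r ≤ p * s → r ≤ s
    *-cancel {p} 0<p = ℚ.*-cancelˡ-≤-pos p {{ℚ.positive 0<p}}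

    square-nonNeg : ∀ p → 0ℚ ≤ p * p
    square-nonNeg p with ≤∨< 0ℚ p
    ... | inj₁ 0≤p = *-nonNeg 0≤p 0≤p
    ... | inj₂ p<0 = subst (0ℚ ≤_) (solve 1 (λ p → :- p :* (:- p) := p :* p) refl p) (*-nonNeg 0≤-p 0≤-p)
      where
      0≤-p : 0ℚ ≤ - p
      0≤-p = ℚ.neg-antimono-≤ (ℚ.<⇒≤ p<0)

    ^-pos : ∀ {p} n → 0ℚ < p → 0ℚ < p ^ n
    ^-pos zero    0<p = 0<1
    ^-pos (suc n) 0<p = *-pos 0<p (^-pos n 0<p)

    ^-mono : ∀ {p q} n → 0ℚ ≤ p → p ≤ q → p ^ n ≤ q ^ n
    ^-nonNeg : ∀ {p} n → 0ℚ ≤ p → 0ℚ ≤ p ^ n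
    ^-nonNeg zero    0≤p = ℚ.<⇒≤ 0<1
    ^-nonNeg (suc n) 0≤p = *-nonNeg 0≤p (^-nonNeg n 0≤p)
    ^-mono zero    0≤p p≤q = ℚ.≤-refl
    ^-mono (suc n) 0≤p p≤q = *-mono-≤ 0≤p (^-nonNeg n 0≤p) p≤q (^-mono n 0≤p p≤q)

    1≤^ : ∀ {p} n → 1ℚ ≤ p → 1ℚ ≤ p ^ n
    1≤^ zero    1≤p = ℚ.≤-refl
    1≤^ {p} (suc n) 1≤p = subst (_≤ p ^ suc n) (ℚ.*-identityˡ 1ℚ)
      (*-mono-≤ (ℚ.<⇒≤ 0<1) (ℚ.<⇒≤ 0<1) 1≤p (1≤^ n 1≤p))

    ^-monoʳ : ∀ {p m n} → 1ℚ ≤ p → m ℕ.≤ n → p ^ m ≤ p ^ n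
    ^-monoʳ {n = n} 1≤p z≤n = 1≤^ n 1≤p
    ^-monoʳ {p} 1≤p (s≤s m≤n) = *-monoˡ (ℚ.≤-trans (ℚ.<⇒≤ 0<1) 1≤p) (^-monoʳ 1≤p m≤n)

    bernoulli : ∀ {a} n → 0ℚ ≤ a → 1ℚ + ι n * a ≤ (1ℚ + a) ^ n
    bernoulli {a} zero    0≤a = ℚ.≤-reflexive (solve 1 (λ a → con 1ℚ :+ con 0ℚ :* a := con 1ℚ) refl a)
    bernoulli {a} (suc n) 0≤a = begin
      1ℚ + ι (suc n) * a             ≡⟨ cong (λ t → 1ℚ + t * a) (ι-suc n) ⟩
      1ℚ + (1ℚ + ι n) * a            ≤⟨ by-≤ (*-nonNeg 0≤a (*-nonNeg (0≤ι n) 0≤a))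
         (solve 2 (λ n a → con 1ℚ :+ (con 1ℚ :+ n) :* a :+ a :* (n :* a)
                         := (con 1ℚ :+ a) :* (con 1ℚ :+ n :* a)) refl (ι n) a) ⟩
      (1ℚ + a) * (1ℚ + ι n * a)      ≤⟨ *-monoˡ (ℚ.<⇒≤ (1+-pos 0≤a)) (bernoulli n 0≤a) ⟩
      (1ℚ + a) ^ suc n               ∎
      where open ℚ.≤-Reasoning

    2≤x+1/x : ∀ {x y} → 0ℚ ≤ y → x * y ≡ 1ℚ → 1ℚ + 1ℚ ≤ x + y
    2≤x+1/x {x} {y} 0≤y xy≡1 = by-≤ (*-nonNeg (square-nonNeg (x - 1ℚ)) 0≤y) (begin
      1ℚ + 1ℚ + (x - 1ℚ) * (x - 1ℚ) * y
        ≡⟨ solve 2 (λ x y → con 1ℚ :+ con 1ℚ :+ (x :- con 1ℚ) :* (x :- con 1ℚ) :* y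
                          := con 1ℚ :+ con 1ℚ :+ x :* (x :* y) :- (x :* y :+ x :* y) :+ y) refl x y ⟩
      1ℚ + 1ℚ + x * (x * y) - (x * y + x * y) + y
        ≡⟨ cong (λ t → 1ℚ + 1ℚ + x * t - (t + t) + y) xy≡1 ⟩
      1ℚ + 1ℚ + x * 1ℚ - (1ℚ + 1ℚ) + y
        ≡⟨ solve 2 (λ x y → con 1ℚ :+ con 1ℚ :+ x :* con 1ℚ :- (con 1ℚ :+ con 1ℚ) :+ y := x :+ y) refl x y ⟩
      x + y ∎)
      where open ≡-Reasoning

  walks-zero : ∀ {d λ₀} → ¬ λ₀ ℕ.≤ d → walks 0 d λ₀ ≡ 0
  walks-zero {d} {λ₀} λ≰d with λ₀ ℕ.≤? d
  ... | yes λ≤d = contradiction λ≤d λ≰d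
  ... | no  _   = refl

  walks-suc : ∀ n {d λ₀} → ¬ λ₀ ℕ.≤ d → walks (suc n) d λ₀ ≡ walks n (ℕ.pred d) λ₀ ℕ.+ walks n (suc d) λ₀
  walks-suc n {d} {λ₀} λ≰d = trans
    (∑-cartesianProductWith _∷_ signs (words signs n) (λ v → ⟦ λ₀ ℕ.≤? peak d v ⟧))
    (cong₂ ℕ._+_ (∑-cong (words signs n) (later Sign.-))
      (trans (ℕ.+-identityʳ _) (∑-cong (words signs n) (later Sign.+))))
    where
    ⟦⟧-cong : {P Q : Set} (P? : Dec P) (Q? : Dec Q) → (P → Q) → (Q → P) → ⟦ P? ⟧ ≡ ⟦ Q? ⟧
    ⟦⟧-cong (yes p) Q? f g = sym (⟦⟧-yes Q? (f p))
    ⟦⟧-cong (no ¬p) (yes q) f g = contradiction (g q) ¬p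
    ⟦⟧-cong (no ¬p) (no ¬q) f g = refl
    later : ∀ x (v : Vec Sign n) → ⟦ λ₀ ℕ.≤? d ℕ.⊔ peak (step x d) v ⟧ ≡ ⟦ λ₀ ℕ.≤? peak (step x d) v ⟧
    later x v = ⟦⟧-cong (λ₀ ℕ.≤? _) (λ₀ ℕ.≤? _) f (λ le → ℕ.≤-trans le (ℕ.m≤n⊔m d _))
      where
      f : λ₀ ℕ.≤ d ℕ.⊔ peak (step x d) v → λ₀ ℕ.≤ peak (step x d) v
      f le with ℕ.⊔-sel d (peak (step x d) v)
      ... | inj₁ eq = contradiction (subst (λ₀ ℕ.≤_) eq le) λ≰d
      ... | inj₂ eq = subst (λ₀ ℕ.≤_) eq le

  walks≤2^ : ∀ n d λ₀ → walks n d λ₀ ℕ.≤ 2 ℕ.^ n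
  walks≤2^ n d λ₀ = subst (walks n d λ₀ ℕ.≤_)
    (trans (∑-const (words signs n) 1) (trans (ℕ.*-identityʳ _) (length-words signs n)))
    (∑-mono (words signs n) (λ {v} _ → ⟦⟧-≤ (λ₀ ℕ.≤? peak d v) (λ _ → ℕ.≤-refl)))

  -- Chernoff's bound.  F is an eigenfunction of the walk reflected at 0:
  -- F (d + 1) + F (d ∸ 1) = (x + y) F d, also for d = 0.
  module Chernoff {x y : ℚ} (1≤x : 1ℚ ≤ x) (0≤y : 0ℚ ≤ y) (xy≡1 : x * y ≡ 1ℚ) where
    F : ℕ → ℚ
    F d = x ^ suc d + y ^ d

    abstract
      0≤x : 0ℚ ≤ x
      0≤x = ℚ.≤-trans (ℚ.<⇒≤ 0<1) 1≤x

      F-eigen : ∀ d → F (ℕ.pred d) + F (suc d) ≡ (x + y) * F d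
      F-eigen zero = trans
        (solve 2 (λ x y → (x :* con 1ℚ :+ con 1ℚ) :+ (x :* (x :* con 1ℚ) :+ y :* con 1ℚ)
                       := (x :+ y) :* (x :* con 1ℚ :+ con 1ℚ) :+ (con 1ℚ :- x :* y)) refl x y)
        (trans (cong (λ t → (x + y) * F 0 + (1ℚ - t)) xy≡1) (ℚ.+-identityʳ _))
      F-eigen (suc d) = trans
        (solve 4 (λ x y p q → (p :+ q) :+ (x :* (x :* p) :+ y :* (y :* q))
                     := (x :+ y) :* (x :* p :+ y :* q) :+ (con 1ℚ :- x :* y) :* (p :+ q))
               refl x y (x ^ suc d) (y ^ d))
        (trans (cong (λ t → (x + y) * F (suc d) + (1ℚ - t) * (x ^ suc d + y ^ d)) xy≡1)
          (trans (cong (λ t → (x + y) * F (suc d) + t) (ℚ.*-zeroˡ (x ^ suc d + y ^ d))) (ℚ.+-identityʳ _)))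

      -- Optional stopping at λ₀, by induction on the steps left. From d ≥ λ₀ all 2^n continuations
      -- count, paid for by x + y ≥ 2 and F d ≥ x^(λ₀+1); below λ₀ the first step is absorbed by
      -- `F-eigen`.
      walks-bound : ∀ n d λ₀ → ι (walks n d λ₀) * x ^ suc λ₀ ≤ (x + y) ^ n * F d
      walks-bound n d λ₀ with λ₀ ℕ.≤? d
      ... | yes λ≤d = *-mono-≤ (0≤ι (walks n d λ₀)) (^-nonNeg (suc λ₀) 0≤x)
        (begin
          ι (walks n d λ₀) ≤⟨ ι-mono (walks≤2^ n d λ₀) ⟩
          ι (2 ℕ.^ n)      ≡⟨ ι-^ 2 n ⟩
          ι 2 ^ n          ≤⟨ ^-mono n (0≤ι 2) (2≤x+1/x {x} 0≤y xy≡1) ⟩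
          (x + y) ^ n      ∎)
        (ℚ.≤-trans (^-monoʳ 1≤x (s≤s λ≤d)) (by-≤ (^-nonNeg d 0≤y) refl))
        where open ℚ.≤-Reasoning
      walks-bound zero d λ₀ | no λ≰d = ℚ.≤-trans
        (ℚ.≤-reflexive (trans (cong (λ t → ι t * x ^ suc λ₀) (walks-zero λ≰d)) (ℚ.*-zeroˡ (x ^ suc λ₀))))
        (*-nonNeg (ℚ.<⇒≤ 0<1) (ℚ.+-mono-≤ (^-nonNeg (suc d) 0≤x) (^-nonNeg d 0≤y)))
      walks-bound (suc n) d λ₀ | no λ≰d = begin
        ι (walks (suc n) d λ₀) * X
          ≡⟨ cong (λ t → ι t * X) (walks-suc n λ≰d) ⟩
        ι (walks n (ℕ.pred d) λ₀ ℕ.+ walks n (suc d) λ₀) * X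
          ≡⟨ cong (_* X) (ι-+ (walks n (ℕ.pred d) λ₀) _) ⟩
        (ι (walks n (ℕ.pred d) λ₀) + ι (walks n (suc d) λ₀)) * X
          ≡⟨ ℚ.*-distribʳ-+ X (ι (walks n (ℕ.pred d) λ₀)) _ ⟩
        ι (walks n (ℕ.pred d) λ₀) * X + ι (walks n (suc d) λ₀) * X
          ≤⟨ ℚ.+-mono-≤ (walks-bound n (ℕ.pred d) λ₀) (walks-bound n (suc d) λ₀) ⟩
        (x + y) ^ n * F (ℕ.pred d) + (x + y) ^ n * F (suc d)
          ≡⟨ ℚ.*-distribˡ-+ ((x + y) ^ n) (F (ℕ.pred d)) (F (suc d)) ⟨
        (x + y) ^ n * (F (ℕ.pred d) + F (suc d))
          ≡⟨ cong (λ t → (x + y) ^ n * t) (F-eigen d) ⟩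
        (x + y) ^ n * ((x + y) * F d)
          ≡⟨ solve 3 (λ s p f → p :* (s :* f) := s :* p :* f) refl (x + y) ((x + y) ^ n) (F d) ⟩
        (x + y) ^ suc n * F d ∎
        where
        open ℚ.≤-Reasoning
        X : ℚ
        X = x ^ suc λ₀

      -- F 0 = x + 1 ≤ 2 x, and one factor x cancels: compared with Chernoff's bound for the
      -- endpoint of the free walk, all windows together cost a factor 2.
      tail-bound : ∀ n λ₀ → ι (walks n 0 λ₀) * x ^ λ₀ ≤ (1ℚ + 1ℚ) * (x + y) ^ n
      tail-bound n λ₀ = *-cancel (ℚ.<-≤-trans 0<1 1≤x) (begin
        x * (ι (walks n 0 λ₀) * x ^ λ₀)
          ≡⟨ solve 3 (λ x w p → x :* (w :* p) := w :* (x :* p)) refl x (ι (walks n 0 λ₀)) (x ^ λ₀) ⟩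
        ι (walks n 0 λ₀) * x ^ suc λ₀
          ≤⟨ walks-bound n 0 λ₀ ⟩
        (x + y) ^ n * (x * 1ℚ + 1ℚ)
          ≤⟨ *-monoˡ (^-nonNeg n (ℚ.+-mono-≤ 0≤x 0≤y)) (ℚ.+-monoʳ-≤ (x * 1ℚ) 1≤x) ⟩
        (x + y) ^ n * (x * 1ℚ + x)
          ≡⟨ solve 2 (λ x p → p :* (x :* con 1ℚ :+ x) := x :* ((con 1ℚ :+ con 1ℚ) :* p)) refl x ((x + y) ^ n) ⟩
        x * ((1ℚ + 1ℚ) * (x + y) ^ n) ∎)
        where open ℚ.≤-Reasoning

  -- z = 1 + 1/m plays the role of e^{1/m}, and w that of e^{−1/m}; half the
  -- sum of z^j and w^j is then cosh (j/m).
  module Cosh (μ : ℕ) where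
    m : ℕ
    m = suc μ

    -- `w` is exactly 1/z, and `c` = (z + w)/2 stands for cosh (1/m), with excess `t` = 1/(2m(m+1))
    -- over 1.
    z w t c : ℚ
    z = 1ℚ + h μ
    w = 1ℚ - h m
    t = ½ * (h μ * h m)
    c = 1ℚ + t

    abstract
      h-difference : h μ ≡ h m + h μ * h m
      h-difference = trans (trans (sym (ℚ.*-identityʳ (h μ))) (cong (λ t → h μ * t) (sym (ι-h m))))
        (trans (cong (λ t → h μ * (t * h m)) (ι-suc m))
          (trans (solve 3 (λ a b n → a :* ((con 1ℚ :+ n) :* b) := (n :* a) :* b :+ a :* b) refl (h μ) (h m) (ι m))
            (trans (cong (λ t → t * h m + h μ * h m) (ι-h μ)) (cong (_+ h μ * h m) (ℚ.*-identityˡ (h m))))))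

      zw≡1 : z * w ≡ 1ℚ
      zw≡1 = trans (solve 2 (λ a b → (con 1ℚ :+ a) :* (con 1ℚ :- b) := con 1ℚ :+ (a :- (b :+ a :* b))) refl (h μ) (h m))
        (trans (cong (λ t → 1ℚ + (h μ - t)) (sym h-difference))
          (solve 1 (λ a → con 1ℚ :+ (a :- a) := con 1ℚ) refl (h μ)))

      z+w≡2c : z + w ≡ (1ℚ + 1ℚ) * c
      z+w≡2c = trans (solve 2 (λ a b → (con 1ℚ :+ a) :+ (con 1ℚ :- b) := con 1ℚ :+ con 1ℚ :+ (a :- b)) refl (h μ) (h m))
        (trans (cong (λ s → 1ℚ + 1ℚ + (s - h m)) h-difference)
          (solve 2 (λ a b → con 1ℚ :+ con 1ℚ :+ (b :+ a :* b :- b)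
                         := (con 1ℚ :+ con 1ℚ) :* (con 1ℚ :+ con ½ :* (a :* b))) refl (h μ) (h m)))

      0≤t : 0ℚ ≤ t
      0≤t = *-nonNeg (ℚ.<⇒≤ 0<½) (*-nonNeg (0≤h μ) (0≤h m))

      0<c : 0ℚ < c
      0<c = 1+-pos 0≤t

      0<z : 0ℚ < z
      0<z = 1+-pos (0≤h μ)

      1≤z : 1ℚ ≤ z
      1≤z = by-≤ (0≤h μ) refl

      0<w : 0ℚ < w
      0<w = ℚ.*-cancelˡ-<-nonNeg z {{ℚ.nonNegative (ℚ.<⇒≤ 0<z)}}
        (subst₂ _<_ (sym (ℚ.*-zeroʳ z)) (sym zw≡1) 0<1)

      -- A reversed Bernoulli inequality, (1 + t)^n ≤ 1/(1 - n t), written without division: (1 +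
      -- t)(1 - (n + 1) t) ≤ 1 - n t.
      c^n-bound : ∀ n → c ^ n * (1ℚ - ι n * t) ≤ 1ℚ
      c^n-bound zero = ℚ.≤-reflexive (solve 1 (λ t → con 1ℚ :* (con 1ℚ :- con 0ℚ :* t) := con 1ℚ) refl t)
      c^n-bound (suc n) = begin
        c * c ^ n * (1ℚ - ι (suc n) * t)
          ≡⟨ solve 3 (λ c p q → c :* p :* q := p :* (c :* q)) refl c (c ^ n) _ ⟩
        c ^ n * (c * (1ℚ - ι (suc n) * t))
          ≤⟨ *-monoˡ (^-nonNeg n (ℚ.<⇒≤ 0<c)) shrink ⟩
        c ^ n * (1ℚ - ι n * t)
          ≤⟨ c^n-bound n ⟩
        1ℚ ∎
        where
        open ℚ.≤-Reasoning
        shrink : c * (1ℚ - ι (suc n) * t) ≤ 1ℚ - ι n * t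
        shrink = by-≤ (*-nonNeg 0≤t (*-nonNeg (0≤ι (suc n)) 0≤t))
          (trans (cong (λ s → c * (1ℚ - s * t) + t * (s * t)) (ι-suc n))
            (solve 2 (λ n t → (con 1ℚ :+ t) :* (con 1ℚ :- (con 1ℚ :+ n) :* t) :+ t :* ((con 1ℚ :+ n) :* t)
                           := con 1ℚ :- n :* t) refl (ι n) t))

      -- The counterpart of cosh s ≤ e^(s²/2) at s = 1/m, raised to the power 2m. Since 2 m t =
      -- 1/(m+1) = 1 - w, the preceding bound reads c^(2m) w ≤ 1.
      c^2m≤z : c ^ (2 ℕ.* m) ≤ z
      c^2m≤z = begin
        C                 ≡⟨ ℚ.*-identityʳ C ⟨
        C * 1ℚ            ≡⟨ cong (λ t → C * t) zw≡1 ⟨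
        C * (z * w)       ≡⟨ solve 3 (λ c z w → c :* (z :* w) := z :* (c :* w)) refl C z w ⟩
        z * (C * w)       ≡⟨ cong (λ s → z * (C * (1ℚ - s))) 2mt ⟨
        z * (C * (1ℚ - ι (2 ℕ.* m) * t)) ≤⟨ *-monoˡ (ℚ.<⇒≤ 0<z) (c^n-bound (2 ℕ.* m)) ⟩
        z * 1ℚ            ≡⟨ ℚ.*-identityʳ z ⟩
        z                 ∎
        where
        open ℚ.≤-Reasoning
        C : ℚ
        C = c ^ (2 ℕ.* m)
        2mt : ι (2 ℕ.* m) * t ≡ h m
        2mt = trans (cong (_* t) (ι-* 2 m))
          (trans (solve 3 (λ n a b → (con 1ℚ :+ con 1ℚ) :* n :* (con ½ :* (a :* b)) := n :* a :* b) refl (ι m) (h μ) (h m))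
            (trans (cong (_* h m) (ι-h μ)) (ℚ.*-identityˡ (h m))))

      S : ℕ → ℚ
      S j = z ^ j + w ^ j

      0≤S : ∀ j → 0ℚ ≤ S j
      0≤S j = ℚ.+-mono-≤ (^-nonNeg j (ℚ.<⇒≤ 0<z)) (^-nonNeg j (ℚ.<⇒≤ 0<w))

      S-recurrence : ∀ j → S (suc (suc j)) + S j ≡ (1ℚ + 1ℚ) * c * S (suc j)
      S-recurrence j = trans (sym (trans
        (solve 4 (λ z w p q → (z :+ w) :* (z :* p :+ w :* q)
                           := (z :* (z :* p) :+ w :* (w :* q)) :+ (p :+ q) :+ (z :* w :- con 1ℚ) :* (p :+ q))
               refl z w (z ^ j) (w ^ j))
        (trans (cong (λ s → S (suc (suc j)) + S j + (s - 1ℚ) * (z ^ j + w ^ j)) zw≡1)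
          (solve 2 (λ a b → a :+ (con 1ℚ :- con 1ℚ) :* b := a) refl (S (suc (suc j)) + S j) (z ^ j + w ^ j)))))
        (cong (_* S (suc j)) z+w≡2c)

      -- By the recurrence, S(j+2)/S(j+1) = 2c - S(j)/S(j+1) ≤ 2c - 1/r with r = c^(2j+1), and 2c -
      -- 1/r ≤ c² r because (c r - 1)² ≥ 0. The odd exponents then add up to the square in
      -- `S-bound`.
      S-ratio : ∀ j → S (suc j) ≤ c ^ suc (2 ℕ.* j) * S j
      S-ratio zero = ℚ.≤-reflexive (trans (trans (cong₂ _+_ (ℚ.*-identityʳ z) (ℚ.*-identityʳ w)) z+w≡2c)
        (solve 1 (λ c → (con 1ℚ :+ con 1ℚ) :* c := c :* con 1ℚ :* (con 1ℚ :+ con 1ℚ)) refl c))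
      S-ratio (suc j) = *-cancel 0<r (begin
        r * S (suc (suc j))
          ≡⟨ solve 3 (λ r a b → r :* a := r :* (a :+ b) :- r :* b) refl r (S (suc (suc j))) (S j) ⟩
        r * (S (suc (suc j)) + S j) - r * S j
          ≡⟨ cong (λ s → r * s - r * S j) (S-recurrence j) ⟩
        r * ((1ℚ + 1ℚ) * c * S (suc j)) - r * S j
          ≤⟨ ℚ.+-monoʳ-≤ (r * ((1ℚ + 1ℚ) * c * S (suc j))) (ℚ.neg-antimono-≤ (S-ratio j)) ⟩
        r * ((1ℚ + 1ℚ) * c * S (suc j)) - S (suc j)
          ≤⟨ by-≤ (*-nonNeg (square-nonNeg (c * r - 1ℚ)) (0≤S (suc j)))
               (solve 3 (λ r c s → r :* ((con 1ℚ :+ con 1ℚ) :* c :* s) :- s :+ (c :* r :- con 1ℚ) :* (c :* r :- con 1ℚ) :* s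
                                := r :* (c :* (c :* r) :* s)) refl r c (S (suc j))) ⟩
        r * (c * (c * r) * S (suc j))
          ≡⟨ cong (λ e → r * (c ^ suc e * S (suc j))) (sym (ℕ.*-suc 2 j)) ⟩
        r * (c ^ suc (2 ℕ.* suc j) * S (suc j)) ∎)
        where
        open ℚ.≤-Reasoning
        r : ℚ
        r = c ^ suc (2 ℕ.* j)
        0<r : 0ℚ < r
        0<r = ^-pos (suc (2 ℕ.* j)) 0<c

      -- cosh (j s) ≤ (cosh s)^(j²)
      S-bound : ∀ j → S j ≤ (1ℚ + 1ℚ) * c ^ (j ℕ.* j)
      S-bound zero    = ℚ.≤-refl
      S-bound (suc j) = begin
        S (suc j)                                    ≤⟨ S-ratio j ⟩
        c ^ suc (2 ℕ.* j) * S j                      ≤⟨ *-monoˡ (^-nonNeg (suc (2 ℕ.* j)) (ℚ.<⇒≤ 0<c)) (S-bound j) ⟩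
        c ^ suc (2 ℕ.* j) * ((1ℚ + 1ℚ) * c ^ (j ℕ.* j))
          ≡⟨ solve 2 (λ p q → p :* ((con 1ℚ :+ con 1ℚ) :* q) := (con 1ℚ :+ con 1ℚ) :* (p :* q)) refl
               (c ^ suc (2 ℕ.* j)) (c ^ (j ℕ.* j)) ⟩
        (1ℚ + 1ℚ) * (c ^ suc (2 ℕ.* j) * c ^ (j ℕ.* j))
          ≡⟨ cong (λ s → (1ℚ + 1ℚ) * s) (^-homo-* c (suc (2 ℕ.* j)) (j ℕ.* j)) ⟨
        (1ℚ + 1ℚ) * c ^ (suc (2 ℕ.* j) ℕ.+ j ℕ.* j)
          ≡⟨ cong (λ e → (1ℚ + 1ℚ) * c ^ e) (odd j) ⟩
        (1ℚ + 1ℚ) * c ^ (suc j ℕ.* suc j) ∎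
        where
        open ℚ.≤-Reasoning
        odd : ∀ j → suc (2 ℕ.* j) ℕ.+ j ℕ.* j ≡ suc j ℕ.* suc j
        odd = solve-∀

    -- The tail of a Gaussian of variance n: with m = 2 g n, the power
    -- z^(g λ²) is about e^{λ²/2n}.  Optimising x = e^{λ/n} gives j = 2 g λ.
    abstract
      gaussian-tail : ∀ g n λ₀ → m ≡ 2 ℕ.* g ℕ.* n →
        -- With x = z^j, x^λ₀ = z^(2q), while S(j)^n ≤ 2^n c^(j² n) = 2^n (c^(2m))^q ≤ 2^n z^q; half
        -- of the exponent 2q survives.
        ι (walks n 0 λ₀) * z ^ (g ℕ.* (λ₀ ℕ.* λ₀)) ≤ ι (2 ℕ.* 2 ℕ.^ n)
      gaussian-tail g n λ₀ m≡ = *-cancel (^-pos q 0<z) (begin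
        z ^ q * (W * z ^ q)
          ≡⟨ solve 2 (λ p w → p :* (w :* p) := w :* (p :* p)) refl (z ^ q) W ⟩
        W * (z ^ q * z ^ q)
          ≡⟨ cong (λ s → W * s) (trans (sym (^-homo-* z q q)) (trans (cong (z ^_) (exponent₁ g λ₀)) (sym (^-assocʳ z j λ₀)))) ⟩
        W * (z ^ j) ^ λ₀
          ≤⟨ Chernoff.tail-bound (1≤^ j 1≤z) (^-nonNeg j (ℚ.<⇒≤ 0<w)) inverse n λ₀ ⟩
        (1ℚ + 1ℚ) * S j ^ n
          ≤⟨ *-monoˡ (0≤ι 2) (^-mono n (0≤S j) (S-bound j)) ⟩
        (1ℚ + 1ℚ) * ((1ℚ + 1ℚ) * c ^ (j ℕ.* j)) ^ n
          ≡⟨ cong (λ s → (1ℚ + 1ℚ) * s) (trans (^-distrib-* (1ℚ + 1ℚ) (c ^ (j ℕ.* j)) n)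
               (cong (λ s → (1ℚ + 1ℚ) ^ n * s) (trans (^-assocʳ c (j ℕ.* j) n)
                 (trans (cong (c ^_) exponent₂) (sym (^-assocʳ c (2 ℕ.* m) q)))))) ⟩
        (1ℚ + 1ℚ) * ((1ℚ + 1ℚ) ^ n * (c ^ (2 ℕ.* m)) ^ q)
          ≤⟨ *-monoˡ (0≤ι 2) (*-monoˡ (^-nonNeg n (0≤ι 2)) (^-mono q (^-nonNeg (2 ℕ.* m) (ℚ.<⇒≤ 0<c)) c^2m≤z)) ⟩
        (1ℚ + 1ℚ) * ((1ℚ + 1ℚ) ^ n * z ^ q)
          ≡⟨ solve 3 (λ a b p → a :* (b :* p) := p :* (a :* b)) refl (1ℚ + 1ℚ) ((1ℚ + 1ℚ) ^ n) (z ^ q) ⟩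
        z ^ q * ((1ℚ + 1ℚ) * (1ℚ + 1ℚ) ^ n)
          ≡⟨ cong (λ s → z ^ q * s) (trans (ι-* 2 (2 ℕ.^ n)) (cong (λ s → ι 2 * s) (ι-^ 2 n))) ⟨
        z ^ q * ι (2 ℕ.* 2 ℕ.^ n) ∎)
        where
        open ℚ.≤-Reasoning
        W : ℚ
        W = ι (walks n 0 λ₀)
        j q : ℕ
        j = 2 ℕ.* g ℕ.* λ₀
        q = g ℕ.* (λ₀ ℕ.* λ₀)
        exponent₁ : ∀ g l → g ℕ.* (l ℕ.* l) ℕ.+ g ℕ.* (l ℕ.* l) ≡ 2 ℕ.* g ℕ.* l ℕ.* l
        exponent₁ = solve-∀
        exponent₂ : j ℕ.* j ℕ.* n ≡ 2 ℕ.* m ℕ.* q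
        exponent₂ = trans (rearrange g λ₀ n) (cong (λ k → 2 ℕ.* k ℕ.* q) (sym m≡))
          where
          rearrange : ∀ g l n → 2 ℕ.* g ℕ.* l ℕ.* (2 ℕ.* g ℕ.* l) ℕ.* n ≡ 2 ℕ.* (2 ℕ.* g ℕ.* n) ℕ.* (g ℕ.* (l ℕ.* l))
          rearrange = solve-∀
        inverse : z ^ j * w ^ j ≡ 1ℚ
        inverse = trans (sym (^-distrib-* z w j)) (trans (cong (_^ j) zw≡1) (one j))
          where
          one : ∀ n → 1ℚ ^ n ≡ 1ℚ
          one zero    = refl
          one (suc n) = trans (ℚ.*-identityˡ (1ℚ ^ n)) (one n)

open Exponential

-- Comparison of the tail with the real logarithm and square root.

module Logarithm where

  open import Data.Rational.Base using (_+_; _-_; _*_; _≤_; _<_; _⊔_)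
  open import Algebra.Properties.CommutativeSemiring.Exp (CommutativeRing.commutativeSemiring ℚ.+-*-commutativeRing)
    using (_^_; ^-homo-*; ^-assocʳ; ^-distrib-*)
  open +-*-Solver using (solve; _:+_; _:-_; _:*_; _:=_; con)

  -- Telescoping 1 + 1/i ≤ e^{1/i} over the summands 1/i of H, whose common
  -- denominators are the multiples of g.
  harmonic-exp : ∀ a ℓ → ∃[ g ] NonZero g × (∀ μ r → suc μ ≡ r ℕ.* g →
    ∃[ E ] ι E ≡ ι (suc μ) * H a ℓ × ι (suc a ℕ.+ ℓ) ≤ ι (suc a) * Cosh.z μ ^ E)
  harmonic-exp a zero    = 1 , _ , λ μ r _ → 0 , sym (ℚ.*-zeroʳ (ι (suc μ))) ,
    ℚ.≤-reflexive (trans (cong ι (ℕ.+-identityʳ (suc a))) (sym (ℚ.*-identityʳ (ι (suc a)))))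
  harmonic-exp a (suc ℓ) with harmonic-exp (suc a) ℓ
  ... | g , g≢0 , exp = suc a ℕ.* g , ℕ.m*n≢0 (suc a) g {{_}} {{g≢0}} , λ μ r eq →
    let E , E≡ , bound = exp μ (r ℕ.* suc a) (trans eq (sym (ℕ.*-assoc r (suc a) g)))
    in r ℕ.* g ℕ.+ E , exponent μ r E eq E≡ , grow μ r E eq bound
    where
    ratio : ∀ μ r → suc μ ≡ r ℕ.* (suc a ℕ.* g) → ι (r ℕ.* g) ≡ ι (suc μ) * h a
    ratio μ r eq = sym (begin
      ι (suc μ) * h a                   ≡⟨ cong (λ k → ι k * h a) (trans eq (assoc r (suc a) g)) ⟩
      ι (r ℕ.* g ℕ.* suc a) * h a       ≡⟨ cong (_* h a) (ι-* (r ℕ.* g) (suc a)) ⟩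
      ι (r ℕ.* g) * ι (suc a) * h a     ≡⟨ ℚ.*-assoc (ι (r ℕ.* g)) (ι (suc a)) (h a) ⟩
      ι (r ℕ.* g) * (ι (suc a) * h a)   ≡⟨ cong (λ t → ι (r ℕ.* g) * t) (ι-h a) ⟩
      ι (r ℕ.* g) * 1ℚ                  ≡⟨ ℚ.*-identityʳ (ι (r ℕ.* g)) ⟩
      ι (r ℕ.* g)                       ∎)
      where
      open ≡-Reasoning
      assoc : ∀ r a g → r ℕ.* (a ℕ.* g) ≡ r ℕ.* g ℕ.* a
      assoc = solve-∀
    exponent : ∀ μ r E → suc μ ≡ r ℕ.* (suc a ℕ.* g) → ι E ≡ ι (suc μ) * H (suc a) ℓ →
               ι (r ℕ.* g ℕ.+ E) ≡ ι (suc μ) * H a (suc ℓ)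
    exponent μ r E eq E≡ = trans (ι-+ (r ℕ.* g) E) (trans (cong₂ _+_ (ratio μ r eq) E≡)
      (sym (ℚ.*-distribˡ-+ (ι (suc μ)) (h a) (H (suc a) ℓ))))
    grow : ∀ μ r E → suc μ ≡ r ℕ.* (suc a ℕ.* g) →
           ι (suc (suc a) ℕ.+ ℓ) ≤ ι (suc (suc a)) * Cosh.z μ ^ E →
           ι (suc a ℕ.+ suc ℓ) ≤ ι (suc a) * Cosh.z μ ^ (r ℕ.* g ℕ.+ E)
    grow μ r E eq bound = begin
      ι (suc a ℕ.+ suc ℓ)            ≡⟨ cong ι (ℕ.+-suc (suc a) ℓ) ⟩
      ι (suc (suc a) ℕ.+ ℓ)          ≤⟨ bound ⟩
      ι (suc (suc a)) * z ^ E        ≤⟨ *-monoʳ (^-nonNeg E (ℚ.<⇒≤ (Cosh.0<z μ))) factor ⟩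
      ι (suc a) * z ^ (r ℕ.* g) * z ^ E
        ≡⟨ ℚ.*-assoc (ι (suc a)) (z ^ (r ℕ.* g)) (z ^ E) ⟩
      ι (suc a) * (z ^ (r ℕ.* g) * z ^ E)
        ≡⟨ cong (λ t → ι (suc a) * t) (^-homo-* z (r ℕ.* g) E) ⟨
      ι (suc a) * z ^ (r ℕ.* g ℕ.+ E) ∎
      where
      open ℚ.≤-Reasoning
      z : ℚ
      z = Cosh.z μ
      rg/m : ι (r ℕ.* g) * h μ ≡ h a
      rg/m = trans (cong (_* h μ) (ratio μ r eq))
        (trans (solve 3 (λ m a u → m :* a :* u := a :* (m :* u)) refl (ι (suc μ)) (h a) (h μ))
          (trans (cong (λ t → h a * t) (ι-h μ)) (ℚ.*-identityʳ (h a))))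
      -- Bernoulli gives 1 + 1/(a+1) = 1 + r g · (1/m) ≤ z^(r g): here r g / m = 1/(a+1) holds
      -- exactly, which is why m must be a multiple of (a+1) g.
      factor : ι (suc (suc a)) ≤ ι (suc a) * z ^ (r ℕ.* g)
      factor = begin
        ι (suc (suc a))                 ≡⟨ trans (ι-suc (suc a)) (ℚ.+-comm 1ℚ (ι (suc a))) ⟩
        ι (suc a) + 1ℚ                  ≡⟨ cong (λ t → ι (suc a) + t) (ι-h a) ⟨
        ι (suc a) + ι (suc a) * h a     ≡⟨ solve 2 (λ n u → n :+ n :* u := n :* (con 1ℚ :+ u)) refl (ι (suc a)) (h a) ⟩
        ι (suc a) * (1ℚ + h a)          ≡⟨ cong (λ t → ι (suc a) * (1ℚ + t)) rg/m ⟨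
        ι (suc a) * (1ℚ + ι (r ℕ.* g) * h μ)
          ≤⟨ *-monoˡ (0≤ι (suc a)) (bernoulli (r ℕ.* g) (0≤h μ)) ⟩
        ι (suc a) * z ^ (r ℕ.* g)       ∎

  -- B ≤ e^{upperSum B ν}
  upperSum-exp : ∀ B ν .{{_ : NonZero B}} → ∃[ g ] NonZero g × (∀ μ r → suc μ ≡ r ℕ.* g →
    ∃[ E ] ι E ≡ ι (suc μ) * upperSum B ν × ι B ≤ Cosh.z μ ^ E)
  upperSum-exp B@(suc b) ν with harmonic-exp ν (b ℕ.* suc ν)
  ... | g , g≢0 , exp = g , g≢0 , λ μ r eq →
    let E , E≡ , bound = exp μ r eq
    -- The product telescopes from ν + 1 up to (ν + 1) B, and ν + 1 cancels.
    in E , E≡ , *-cancel (0<ι (suc ν)) (subst (_≤ ι (suc ν) * Cosh.z μ ^ E)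
         (trans (cong ι (ℕ.*-comm B (suc ν))) (ι-* (suc ν) B)) bound)

  -- With c = a + 1, the hypothesis bounds λ₀²/2n below by (1 + 1/c) times an upper sum for log B,
  -- so the Gaussian tail is at most 2^(n+1) / B^(1+1/c). The c-th power clears the root.
  walks-vs-log : ∀ a n λ₀ B ν .{{_ : NonZero n}} .{{_ : NonZero B}} →
    (1ℚ + h a) * (ι (2 ℕ.* n) * upperSum B ν) ≤ ι λ₀ * ι λ₀ →
    walks n 0 λ₀ ℕ.^ suc a ℕ.* B ℕ.^ suc (suc a) ℕ.≤ (2 ℕ.* 2 ℕ.^ n) ℕ.^ suc a
  walks-vs-log a n@(suc _) λ₀ B ν large with upperSum-exp B ν
  -- One m = 2 g n serves both purposes: it is a multiple of the denominator g of the Riemann sum,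
  -- and it is the resolution that `gaussian-tail` requires.
  ... | g@(suc g-1) , _ , exp with 2 ℕ.* g ℕ.* n in m-eq
  ...   | suc μ with exp μ (2 ℕ.* n) (trans (sym m-eq) (swap g n))
    where
    swap : ∀ g n → 2 ℕ.* g ℕ.* n ≡ 2 ℕ.* n ℕ.* g
    swap = solve-∀
  ...     | E , E≡ , B≤ = ι-cancel (begin
    ι (W ℕ.^ C ℕ.* B ℕ.^ suc C)       ≡⟨ trans (ι-* (W ℕ.^ C) (B ℕ.^ suc C)) (cong₂ _*_ (ι-^ W C) (ι-^ B (suc C))) ⟩
    ι W ^ C * ι B ^ suc C             ≤⟨ *-monoˡ (^-nonNeg C (0≤ι W)) (^-mono (suc C) (0≤ι B) B≤) ⟩
    ι W ^ C * (z ^ E) ^ suc C         ≡⟨ cong (λ t → ι W ^ C * t) (^-assocʳ z E (suc C)) ⟩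
    ι W ^ C * z ^ (E ℕ.* suc C)       ≤⟨ *-monoˡ (^-nonNeg C (0≤ι W)) (^-monoʳ (Cosh.1≤z μ) exponents) ⟩
    ι W ^ C * z ^ (q ℕ.* C)           ≡⟨ cong (λ t → ι W ^ C * t) (^-assocʳ z q C) ⟨
    ι W ^ C * (z ^ q) ^ C             ≡⟨ ^-distrib-* (ι W) (z ^ q) C ⟨
    (ι W * z ^ q) ^ C                 ≤⟨ ^-mono C (*-nonNeg (0≤ι W) (^-nonNeg q (ℚ.<⇒≤ (Cosh.0<z μ))))
                                          (Cosh.gaussian-tail μ g n λ₀ (sym m-eq)) ⟩
    ι (2 ℕ.* 2 ℕ.^ n) ^ C             ≡⟨ ι-^ (2 ℕ.* 2 ℕ.^ n) C ⟨
    ι ((2 ℕ.* 2 ℕ.^ n) ℕ.^ C)         ∎)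
    where
    open ℚ.≤-Reasoning
    W C q : ℕ
    W = walks n 0 λ₀
    C = suc a
    q = g ℕ.* (λ₀ ℕ.* λ₀)
    z y : ℚ
    z = Cosh.z μ
    y = upperSum B ν
    exponents : E ℕ.* suc C ℕ.≤ q ℕ.* C
    exponents = ι-cancel (begin
      ι (E ℕ.* suc C)                       ≡⟨ ι-* E (suc C) ⟩
      ι E * ι (suc C)                       ≡⟨ cong₂ _*_ (trans E≡ (cong (_* y) (cong ι (sym m-eq)))) (ι-suc C) ⟩
      ι (2 ℕ.* g ℕ.* n) * y * (1ℚ + ι C)    ≡⟨ cong (λ t → t * y * (1ℚ + ι C))
                                                 (trans (cong ι (pull g n)) (ι-* g (2 ℕ.* n))) ⟩
      ι g * ι (2 ℕ.* n) * y * (1ℚ + ι C)    ≡⟨ cong (λ t → ι g * ι (2 ℕ.* n) * y * (t + ι C)) (ι-h a) ⟨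
      ι g * ι (2 ℕ.* n) * y * (ι C * h a + ι C)
        ≡⟨ solve 5 (λ g m y c u → g :* m :* y :* (c :* u :+ c) := g :* c :* ((con 1ℚ :+ u) :* (m :* y)))
                 refl (ι g) (ι (2 ℕ.* n)) y (ι C) (h a) ⟩
      ι g * ι C * ((1ℚ + h a) * (ι (2 ℕ.* n) * y))
        ≤⟨ *-monoˡ (*-nonNeg (0≤ι g) (0≤ι C)) large ⟩
      ι g * ι C * (ι λ₀ * ι λ₀)             ≡⟨ solve 3 (λ g c l → g :* c :* l := g :* l :* c) refl (ι g) (ι C) (ι λ₀ * ι λ₀) ⟩
      ι g * (ι λ₀ * ι λ₀) * ι C             ≡⟨ cong (_* ι C) (trans (ι-* g (λ₀ ℕ.* λ₀)) (cong (λ t → ι g * t) (ι-* λ₀ λ₀))) ⟨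
      ι q * ι C                             ≡⟨ ι-* q C ⟨
      ι (q ℕ.* C)                           ∎)
      where
      pull : ∀ g n → 2 ℕ.* g ℕ.* n ≡ g ℕ.* (2 ℕ.* n)
      pull = solve-∀

  1+ε-lower : ∀ ε → 0ᴿ <ᴿ ε → ∃[ a ] L (1ᴿ +ᴿ ε) (1ℚ + h a)
  1+ε-lower ε (p , 0<p , Lp) =
    let a , h< = h-small (0<half 0<p)
    -- Membership in the lower cut of a sum asks for rationals strictly below both terms: 1 - p/2 <
    -- 1 and p < ε, with sum 1 + p/2.
    in a , 1ℚ - half p , p , by-< (0<half 0<p) (solve 1 (λ d → con 1ℚ :- d :+ d := con 1ℚ) refl (half p)) , Lp ,
       subst (λ t → 1ℚ + h a < t) (trans (solve 1 (λ d → con 1ℚ :+ d := con 1ℚ :- d :+ (d :+ d)) refl (half p))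
           (half+half (1ℚ - half p) p))
         (ℚ.+-monoʳ-< 1ℚ h<)

  -- A rational above a product bounds it on a whole enclosure, so the bound can be evaluated at
  -- chosen points. This gives x p ≤ q and n · upperSum ≤ p² with x = 1 + `h a`; then x ≤ x² gives
  -- up one factor x.
  above-radius : ∀ ε a n B {q} → L (1ᴿ +ᴿ ε) (1ℚ + h a) → U ((1ᴿ +ᴿ ε) *ᴿ √ (fromℕ n *ᴿ log B)) q →
    0ℚ < q × ∃[ ν ] (1ℚ + h a) * (ι n * upperSum B ν) ≤ q * q
  above-radius ε a n B {q} Lε (record { a = a₀ ; a′ = a₀′ ; b′ = b′ ; La = La ; Ua = Ua ; Lb = Lb
      ; Ub = Ub@(p , p<b′ , 0<p , (record { b′ = b″ ; La = Ln ; Ua = Un ; Lb = Llog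
          ; Ub = ν , sum<b″ } , r′ , r′<pp , all′)) } , r , r<q , all) =
    ℚ.<-≤-trans (*-pos 0<x 0<p) xp≤q , ν , (begin
      x * (ι n * upperSum B ν)    ≤⟨ *-monoˡ (ℚ.<⇒≤ 0<x) (*-monoˡ (0≤ι n) (ℚ.<⇒≤ sum<b″)) ⟩
      x * (ι n * b″)              ≤⟨ *-monoˡ (ℚ.<⇒≤ 0<x) (all′ (ι n) b″ (ℚ.<⇒≤ Ln) (ℚ.<⇒≤ Un)
                                       (ℚ.<⇒≤ (Cut.L<U (log B) Llog (ν , sum<b″))) ℚ.≤-refl) ⟩
      x * r′                      ≤⟨ *-monoˡ (ℚ.<⇒≤ 0<x) (ℚ.<⇒≤ r′<pp) ⟩
      x * (p * p)                 ≤⟨ *-monoʳ (ℚ.<⇒≤ (*-pos 0<p 0<p)) x≤x² ⟩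
      x * x * (p * p)             ≡⟨ solve 2 (λ x p → x :* x :* (p :* p) := x :* p :* (x :* p)) refl x p ⟩
      x * p * (x * p)             ≤⟨ *-mono-≤ 0≤xp 0≤xp xp≤q xp≤q ⟩
      q * q                       ∎)
    where
    open ℚ.≤-Reasoning
    x u : ℚ
    x = 1ℚ + h a
    -- `x` may lie below the enclosure of 1 + ε; its maximum with the lower end lies inside and is
    -- no smaller.
    u = a₀ ⊔ x
    0<x : 0ℚ < x
    0<x = 1+-pos (0≤h a)
    x≤x² : x ≤ x * x
    x≤x² = by-≤ (*-nonNeg (ℚ.<⇒≤ 0<x) (0≤h a))
        (solve 1 (λ u → (con 1ℚ :+ u) :+ (con 1ℚ :+ u) :* u := (con 1ℚ :+ u) :* (con 1ℚ :+ u)) refl (h a))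
    xp≤q : x * p ≤ q
    xp≤q = begin
      x * p    ≤⟨ *-mono-≤ (ℚ.<⇒≤ 0<x) (ℚ.<⇒≤ 0<p) (ℚ.p≤q⊔p a₀ x) (ℚ.<⇒≤ p<b′) ⟩
      u * b′   ≤⟨ all u b′ (ℚ.p≤p⊔q a₀ x) (ℚ.<⇒≤ (Cut.L<U (1ᴿ +ᴿ ε) (Cut.L-⊔ (1ᴿ +ᴿ ε) a₀ x La Lε) Ua))
                    (ℚ.<⇒≤ (Cut.L<U (√ (fromℕ n *ᴿ log B)) Lb Ub)) ℚ.≤-refl ⟩
      r        ≤⟨ ℚ.<⇒≤ r<q ⟩
      q        ∎
    0≤xp : 0ℚ ≤ x * p
    0≤xp = ℚ.<⇒≤ (*-pos 0<x 0<p)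

open Logarithm

-- Lower bounds for binomials and the sum over k.

module Binomials where

  open import Data.Nat.Base
  open import Data.Nat.Properties
  open import Data.Nat.DivMod using (m/n*n≤m; m≡m%n+[m/n]*n; m%n<n; /-monoˡ-≤; m*n/n≡m)
  open import Data.Nat.Combinatorics using (_C_; nCk+nC[k+1]≡[n+1]C[k+1]; nCk≡nC[n∸k])

  C-monoˡ : ∀ {m n} k → m ≤ n → m C k ≤ n C k
  C-monoˡ zero    m≤n = ≤-refl
  C-monoˡ {m} {n} (suc k) m≤n = go (≤⇒≤′ m≤n)
    where
    go : ∀ {n} → m ≤′ n → m C suc k ≤ n C suc k
    go ≤′-refl = ≤-refl
    go (≤′-step {n} p) = ≤-trans (go p)
      (subst (n C suc k ≤_) (nCk+nC[k+1]≡[n+1]C[k+1] n k) (m≤n+m (n C suc k) (n C k)))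

  -- The number of lattice paths with a and b steps in the two directions; in these coordinates the
  -- binomial is symmetric and monotone in both arguments.
  path : ℕ → ℕ → ℕ
  path a b = (a + b) C a

  path-suc : ∀ a b → path a (suc b) + path (suc a) b ≡ path (suc a) (suc b)
  path-suc a b = trans (cong (λ n → (a + suc b) C a + n C suc a) (sym (+-suc a b)))
    (nCk+nC[k+1]≡[n+1]C[k+1] (a + suc b) a)

  path-comm : ∀ a b → path a b ≡ path b a
  path-comm a b = trans (nCk≡nC[n∸k] (m≤m+n a b)) (cong₂ _C_ (+-comm a b) (m+n∸m≡n a b))

  path-monoʳ : ∀ a {b b′} → b ≤ b′ → path a b ≤ path a b′
  path-monoʳ a b≤b′ = C-monoˡ a (+-monoʳ-≤ a b≤b′)

  path-mono : ∀ {a a′ b b′} → a ≤ a′ → b ≤ b′ → path a b ≤ path a′ b′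
  path-mono {a} {a′} {b} {b′} a≤a′ b≤b′ = ≤-trans (path-monoʳ a b≤b′)
    (subst₂ _≤_ (path-comm b′ a) (path-comm b′ a′) (path-monoʳ b′ a≤a′))

  -- Unrolling Pascal's rule r times yields r summands, each at least `path a b`.
  path-+ : ∀ a b r → r * path a b ≤ path (suc a) (b + r)
  path-+ a b zero    = z≤n
  path-+ a b (suc r) = begin
    path a b + r * path a b                 ≤⟨ +-mono-≤ (path-monoʳ a (≤-trans (m≤m+n b r) (n≤1+n (b + r)))) (path-+ a b r) ⟩
    path a (suc (b + r)) + path (suc a) (b + r) ≡⟨ path-suc a (b + r) ⟩
    path (suc a) (suc (b + r))              ≡⟨ cong (path (suc a)) (+-suc b r) ⟨
    path (suc a) (b + suc r)                ∎
    where open ≤-Reasoning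

  ^≤path : ∀ q j → q ^ j ≤ path j (j * q)
  ^≤path q zero    = ≤-refl
  ^≤path q (suc j) = begin
    q * q ^ j              ≤⟨ *-monoʳ-≤ q (^≤path q j) ⟩
    q * path j (j * q)     ≤⟨ path-+ j (j * q) q ⟩
    path (suc j) (j * q + q) ≡⟨ cong (path (suc j)) (+-comm (j * q) q) ⟩
    path (suc j) (suc j * q) ∎
    where open ≤-Reasoning

  -- One of a and b is at least j q because their sum is at least 2 j q; the other is at least j,
  -- and symmetry allows either.
  ^≤path′ : ∀ q j {a b} → j ≤ a → j ≤ b → j * q + j * q ≤ a + b → q ^ j ≤ path a b
  ^≤path′ q j {a} {b} j≤a j≤b large with j * q ≤? b
  ... | yes jq≤b = ≤-trans (^≤path q j) (path-mono j≤a jq≤b)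
  ... | no  jq≰b = ≤-trans (^≤path q j) (≤-trans (path-mono j≤b jq≤a) (≤-reflexive (path-comm b a)))
    where
    jq≤a : j * q ≤ a
    jq≤a = ≮⇒≥ λ a<jq → <⇒≱ (+-mono-< a<jq (≰⇒> jq≰b)) large

  orbits : ℕ → ℕ → ℕ → ℕ
  orbits S N k = (S * N) C k ∸ (S * (N ∸ 1)) C k

  -- Keeping just one of the S positions of the first row: C(SN, k) - C(SN - S, k) ≥ C(SN, k) - C(SN
  -- - 1, k) = C(SN - 1, k - 1), with k = a + 1.
  path≤orbits : ∀ S N a b .{{_ : NonZero S}} .{{_ : NonZero N}} → suc (a + b) ≡ S * N →
    path a b ≤ orbits S N (suc a)
  path≤orbits S@(suc s) N@(suc n) a b eq = subst (λ t → path a b ≤ t C suc a ∸ (S * n) C suc a) eq (begin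
    path a b
      ≡⟨ m+n∸n≡m (path a b) ((a + b) C suc a) ⟨
    path a b + (a + b) C suc a ∸ (a + b) C suc a
      ≡⟨ cong (_∸ (a + b) C suc a) (nCk+nC[k+1]≡[n+1]C[k+1] (a + b) a) ⟩
    suc (a + b) C suc a ∸ (a + b) C suc a
      ≤⟨ ∸-monoʳ-≤ (suc (a + b) C suc a) (C-monoˡ (suc a) Sn≤a+b) ⟩
    suc (a + b) C suc a ∸ (S * n) C suc a ∎)
    where
    open ≤-Reasoning
    Sn≤a+b : S * n ≤ a + b
    Sn≤a+b = s≤s⁻¹ (subst (suc (S * n) ≤_) (sym eq) (subst (suc (S * n) ≤_) (sym (*-suc S n)) (+-monoˡ-≤ (S * n) (s≤s (z≤n {s})))))

  ^-distribʳ-* : ∀ n a b → (a * b) ^ n ≡ a ^ n * b ^ n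
  ^-distribʳ-* zero    a b = refl
  ^-distribʳ-* (suc n) a b = trans (cong (a * b *_) (^-distribʳ-* n a b)) (interchange a b (a ^ n) (b ^ n))
    where open import Algebra.Properties.CommutativeSemigroup *-commutativeSemigroup using (interchange)

  ^-cancelʳ-≤ : ∀ n {a b} .{{_ : NonZero n}} → a ^ n ≤ b ^ n → a ≤ b
  ^-cancelʳ-≤ n {a} {b} le = ≮⇒≥ λ b<a → <⇒≱ (^-monoˡ-< n b<a) le

  -- The hypothesis says W ≤ X / B^{1+1/c}, so that 2 B W ≤ 2 X / B^{1/c}.
  weight : ∀ c {W B T X} .{{_ : NonZero c}} → W ^ c * B ^ suc c ≤ X ^ c → T ^ c ≤ B → 2 * (B * W) * T ≤ 2 * X
  weight c {W} {B} {T} {X} small T^c≤B = ^-cancelʳ-≤ c (begin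
    (2 * (B * W) * T) ^ c
      ≡⟨ trans (^-distribʳ-* c (2 * (B * W)) T)
          (cong (_* T ^ c) (trans (^-distribʳ-* c 2 (B * W)) (cong (2 ^ c *_) (^-distribʳ-* c B W)))) ⟩
    2 ^ c * (B ^ c * W ^ c) * T ^ c
      ≤⟨ *-monoʳ-≤ (2 ^ c * (B ^ c * W ^ c)) T^c≤B ⟩
    2 ^ c * (B ^ c * W ^ c) * B
      ≡⟨ rearrange (2 ^ c) (B ^ c) (W ^ c) B ⟩
    2 ^ c * (W ^ c * (B * B ^ c))
      ≤⟨ *-monoʳ-≤ (2 ^ c) small ⟩
    2 ^ c * X ^ c
      ≡⟨ ^-distribʳ-* c 2 X ⟨
    (2 * X) ^ c ∎)
    where
    open ≤-Reasoning
    rearrange : ∀ p b w x → p * (b * w) * x ≡ p * (w * (x * b))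
    rearrange = solve-∀

  ∑-bound : ∀ {A : Set} (xs : List A) f T {X} → (∀ {x} → x ∈ xs → f x * T ≤ X) → T * ∑ xs f ≤ length xs * X
  ∑-bound xs f T {X} bound = begin
    T * ∑ xs f                 ≡⟨ ∑-*ˡ T xs f ⟨
    ∑ xs (λ x → T * f x)       ≤⟨ ∑-mono xs (λ {x} x∈ → subst (_≤ X) (*-comm (f x) T) (bound x∈)) ⟩
    ∑ xs (λ _ → X)             ≡⟨ ∑-const xs X ⟩
    length xs * X              ∎
    where open ≤-Reasoning

  -- The exponents k = i + 2 with 2 ≤ k < K + 2, the J smallest and the J
  -- largest ones set apart.
  lowest central highest : ℕ → ℕ → List ℕ
  lowest  J K = upTo J
  central J K = applyUpTo (J +_) (K ∸ (J + J))
  highest J K = applyUpTo (λ i → K ∸ suc i) J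

  indices : ℕ → ℕ → List ℕ
  indices J K = lowest J K ++ central J K ++ highest J K

  -- For the union bound the three lists only have to cover the range; overlaps between them do no
  -- harm.
  ∈-indices : ∀ J K {i} → i < K → i ∈ indices J K
  ∈-indices J K {i} i<K with i <? J
  ... | yes i<J = ∈-++⁺ˡ (∈-upTo⁺ i<J)
  ... | no  i≮J with i + J <? K
  ...   | yes i+J<K = ∈-++⁺ʳ (lowest J K) (∈-++⁺ˡ (subst (_∈ central J K) (m+[n∸m]≡n J≤i)
            (∈-applyUpTo⁺ (J +_) (≤-trans (≤-reflexive (+-cancelʳ-≡ (J + J) _ _ shifted)) (∸-monoˡ-≤ (J + J) i+J<K)))))
    where
    J≤i : J ≤ i
    J≤i = ≮⇒≥ i≮J
    shifted : suc (i ∸ J) + (J + J) ≡ suc (i + J) ∸ (J + J) + (J + J)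
    shifted = trans (cong suc (trans (sym (+-assoc (i ∸ J) J J)) (cong (_+ J) (m∸n+n≡m J≤i))))
      (sym (m∸n+n≡m (≤-trans (+-monoˡ-≤ J J≤i) (n≤1+n (i + J)))))
  ...   | no  i+J≮K = ∈-++⁺ʳ (lowest J K) (∈-++⁺ʳ (central J K) (subst (_∈ highest J K) K∸ (∈-applyUpTo⁺ (λ i → K ∸ suc i) i′<J)))
    where
    i′<J : K ∸ suc i < J
    i′<J = +-cancelˡ-< (suc i) (K ∸ suc i) J
      (subst (_< suc i + J) (sym (m+[n∸m]≡n i<K)) (s≤s (≮⇒≥ i+J≮K)))
    K∸ : K ∸ suc (K ∸ suc i) ≡ i
    K∸ = trans (cong (_∸ suc (K ∸ suc i)) (trans (sym (m+[n∸m]≡n i<K)) (sym (+-suc i (K ∸ suc i)))))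
           (m+n∸n≡m i (suc (K ∸ suc i)))

  -- For the middle binomials, of order at least K^{2c}, a crude bound on
  -- their number suffices; of the others there are boundedly many.
  ∑-indices : ∀ c E K (f B : ℕ → ℕ) {X} .{{_ : NonZero c}} .{{_ : NonZero E}} →
    (∀ i → i < K → ∀ T → T ^ c ≤ B i → f i * T ≤ X) →
    (∀ i → i < K → path (suc i) (K ∸ i) ≤ B i) →
    2 * c ≤ K → E ^ c + E ^ c ≤ K → 8 * c * E * (4 * c) ≤ K → 0 < K →
    E * ∑ (indices (2 * c) K) f ≤ (1 + (2 * c + 2 * c)) * X
  ∑-indices c E K f B {X} light path≤ J≤K edge-large mid-large 0<K = begin
    E * ∑ (lowest J K ++ central J K ++ highest J K) f
      ≡⟨ cong (E *_) (trans (∑-++ (lowest J K) (central J K ++ highest J K))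
          (cong (∑ (lowest J K) f +_) (∑-++ (central J K) (highest J K)))) ⟩
    E * (∑ (lowest J K) f + (∑ (central J K) f + ∑ (highest J K) f))
      ≡⟨ trans (*-distribˡ-+ E _ _) (cong (E * ∑ (lowest J K) f +_) (*-distribˡ-+ E _ _)) ⟩
    E * ∑ (lowest J K) f + (E * ∑ (central J K) f + E * ∑ (highest J K) f)
      ≤⟨ +-mono-≤ low-bound (+-mono-≤ central-bound high-bound) ⟩
    J * X + (X + J * X)
      ≡⟨ collect J X ⟩
    (1 + (J + J)) * X ∎
    where
    open ≤-Reasoning
    J : ℕ
    J = 2 * c
    instance
      c4≢0 : NonZero (4 * c)
      c4≢0 = m*n≢0 4 c
      K≢0 : NonZero K
      K≢0 = >-nonZero 0<K
    ∑-++ : ∀ xs ys → ∑ (xs ++ ys) f ≡ ∑ xs f + ∑ ys f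
    ∑-++ []       ys = refl
    ∑-++ (x ∷ xs) ys = trans (cong (f x +_) (∑-++ xs ys)) (sym (+-assoc (f x) _ _))
    collect : ∀ j x → j * x + (x + j * x) ≡ (1 + (j + j)) * x
    collect = solve-∀
    total : ∀ {i} → i < K → suc i + (K ∸ i) ≡ suc K
    total i<K = cong suc (m+[n∸m]≡n (<⇒≤ i<K))
    edge : ∀ {i} → i < K → f i * E ≤ X
    edge {i} i<K = light i i<K E (≤-trans
      (subst (_≤ path (suc i) (K ∸ i)) (*-identityʳ (E ^ c))
        (^≤path′ (E ^ c) 1 (s≤s z≤n) (m<n⇒0<n∸m i<K)
          (subst₂ _≤_ (cong₂ _+_ (sym (+-identityʳ (E ^ c))) (sym (+-identityʳ (E ^ c)))) (sym (total i<K))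
            (≤-trans edge-large (n≤1+n K)))))
      (path≤ i i<K))
    -- The largest q with 2 J q ≤ K, so that `^≤path′` yields B ≥ q^J = (q²)^c. As K ≤ 8 c q, the
    -- assumption K ≥ 8 c E · 4 c, that is q ≥ 8 c E, gives q² ≥ E K.
    q : ℕ
    q = K / (4 * c)
    q-large : 8 * c * E ≤ q
    q-large = subst (_≤ q) (m*n/n≡m (8 * c * E) (4 * c)) (/-monoˡ-≤ (4 * c) mid-large)
    1≤q : 1 ≤ q
    1≤q = ≤-trans (>-nonZero⁻¹ (8 * c * E) {{m*n≢0 (8 * c) E {{m*n≢0 8 c}}}}) q-large
    q*4c≤K : q * (4 * c) ≤ K
    q*4c≤K = m/n*n≤m K (4 * c)
    K≤ : K ≤ q * (8 * c)
    K≤ = begin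
      K                         ≡⟨ m≡m%n+[m/n]*n K (4 * c) ⟩
      K % (4 * c) + q * (4 * c) ≤⟨ +-monoˡ-≤ (q * (4 * c)) (≤-trans (<⇒≤ (m%n<n K (4 * c))) (m≤n*m (4 * c) q {{>-nonZero 1≤q}})) ⟩
      q * (4 * c) + q * (4 * c) ≡⟨ twice q c ⟩
      q * (8 * c)               ∎
      where
      twice : ∀ q c → q * (4 * c) + q * (4 * c) ≡ q * (8 * c)
      twice = solve-∀
    EK≤q² : E * K ≤ q * q
    EK≤q² = begin
      E * K             ≤⟨ *-monoʳ-≤ E K≤ ⟩
      E * (q * (8 * c)) ≡⟨ swap E q c ⟩
      q * (8 * c * E)   ≤⟨ *-monoʳ-≤ q q-large ⟩
      q * q             ∎
      where
      swap : ∀ e q c → e * (q * (8 * c)) ≡ q * (8 * c * e)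
      swap = solve-∀
    mid : ∀ {i} → i ∈ central J K → f i * (E * K) ≤ X
    mid i∈ with ∈-applyUpTo⁻ (J +_) i∈
    ... | i , i< , refl = light (J + i) J+i<K (E * K) (begin
      (E * K) ^ c                    ≤⟨ ^-monoˡ-≤ c EK≤q² ⟩
      (q * q) ^ c                    ≡⟨ cong (λ t → (q * t) ^ c) (*-identityʳ q) ⟨
      (q ^ 2) ^ c                    ≡⟨ ^-*-assoc q 2 c ⟩
      q ^ J                          ≤⟨ ^≤path′ q J (≤-trans (m≤m+n J i) (n≤1+n (J + i))) J≤ large ⟩
      path (suc (J + i)) (K ∸ (J + i)) ≤⟨ path≤ (J + i) J+i<K ⟩
      B (J + i)                      ∎)
      where
      i+2J<K : suc i + (J + J) ≤ K
      i+2J<K = m≤o∸n⇒m+n≤o (suc i) (<⇒≤ (m∸n≢0⇒n<m (m<n⇒n≢0 i<))) i<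
      J+i+J<K : suc (J + i) + J ≤ K
      J+i+J<K = subst (_≤ K) (assoc i J) i+2J<K
        where
        assoc : ∀ i j → suc i + (j + j) ≡ suc (j + i) + j
        assoc = solve-∀
      J+i<K : J + i < K
      J+i<K = m+n≤o⇒m≤o (suc (J + i)) J+i+J<K
      J≤ : J ≤ K ∸ (J + i)
      J≤ = m+n≤o⇒m≤o∸n J (≤-trans (≤-reflexive (+-comm J (J + i))) (≤-trans (n≤1+n _) J+i+J<K))
      large : J * q + J * q ≤ suc (J + i) + (K ∸ (J + i))
      large = subst₂ _≤_ (quadruple q c) (sym (total J+i<K)) (≤-trans q*4c≤K (n≤1+n K))
        where
        quadruple : ∀ q c → q * (4 * c) ≡ 2 * c * q + 2 * c * q
        quadruple = solve-∀
    low-bound : E * ∑ (lowest J K) f ≤ J * X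
    low-bound = subst (λ l → E * ∑ (lowest J K) f ≤ l * X) (List.length-upTo J)
      (∑-bound (lowest J K) f E (λ i∈ → edge (<-≤-trans (∈-upTo⁻ i∈) J≤K)))
    high-bound : E * ∑ (highest J K) f ≤ J * X
    high-bound = subst (λ l → E * ∑ (highest J K) f ≤ l * X) (List.length-applyUpTo (λ i → K ∸ suc i) J)
      (∑-bound (highest J K) f E λ i∈ → let j , _ , eq = ∈-applyUpTo⁻ (λ i → K ∸ suc i) i∈ in
        edge (subst (_< K) (sym eq) (∸-<-self j)))
      where
      ∸-<-self : ∀ j → K ∸ suc j < K
      ∸-<-self j = ≤-<-trans (∸-monoʳ-≤ K (s≤s (z≤n {j}))) (∸-monoʳ-< {K} {1} {0} ≤-refl 0<K)
    -- At most K terms, each of them at most X / (E K).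
    central-bound : E * ∑ (central J K) f ≤ X
    central-bound = *-cancelˡ-≤ K (begin
      K * (E * ∑ (central J K) f)   ≡⟨ trans (sym (*-assoc K E _)) (cong (_* ∑ (central J K) f) (*-comm K E)) ⟩
      E * K * ∑ (central J K) f     ≤⟨ ∑-bound (central J K) f (E * K) mid ⟩
      length (central J K) * X      ≡⟨ cong (_* X) (List.length-applyUpTo (J +_) (K ∸ (J + J))) ⟩
      (K ∸ (J + J)) * X            ≤⟨ *-monoˡ-≤ X (m∸n≤m K (J + J)) ⟩
      K * X                        ∎)

open Binomials

open import Data.Nat.Base using (_*_; _∸_; _≤_; _<_; _+_; _^_)
open import Data.Integer.Base using (+_)
open import Data.Nat.Combinatorics using (_C_)

-- The integer threshold.

least : {P : Pred ℕ 0ℓ} → Decidable P → ∀ n → P n → ∃[ m ] P m × (∀ {l} → l < m → ¬ P l)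
least P? zero    p = 0 , p , λ ()
least P? (suc n) p with P? 0
... | yes p₀ = 0 , p₀ , λ ()
... | no ¬p₀ = let m , pm , minimal = least (P? ∘ suc) n p
               in suc m , pm , λ { {zero} _ → ¬p₀ ; {suc l} (s≤s l<m) → minimal l<m }

module Threshold (c N B : ℕ) .{{_ : NonZero c}} where

  -- W ≤ 2^{N+1} / B^{1+1/c}, cleared of roots.
  Rare : ℕ → Set
  Rare λ₀ = walks N 0 λ₀ ^ c * B ^ suc c ≤ (2 * 2 ^ N) ^ c

  -- Guarantees that the search succeeds: N steps cannot reach height N + 1, so the count vanishes.
  rare-beyond : Rare (suc N)
  rare-beyond = subst (λ w → w ^ c * B ^ suc c ≤ (2 * 2 ^ N) ^ c) (sym none)
    (subst (λ w → w * B ^ suc c ≤ (2 * 2 ^ N) ^ c) (sym (0^ c)) z≤n)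
    where
    0^ : ∀ c .{{_ : NonZero c}} → 0 ^ c ≡ 0
    0^ (suc c) = refl
    none : walks N 0 (suc N) ≡ 0
    none = ℕ.n≤0⇒n≡0 (ℕ.≤-trans
      (∑-mono (words signs N) {g = λ _ → 0}
          (λ {v} _ → ⟦⟧-≤ (suc N ℕ.≤? peak 0 v) (λ le → contradiction le (ℕ.<⇒≱ (s≤s (peak≤ 0 v))))))
      (ℕ.≤-reflexive (trans (∑-const (words signs N) 0) (ℕ.*-zeroʳ (length (words signs N))))))

  -- Runs over positive heights only, since `Φ-tail` needs a positive level.
  search : ∃[ λ₀ ] Rare (suc λ₀) × (∀ {l} → l < λ₀ → ¬ Rare (suc l))
  search = least (λ λ₀ → walks N 0 (suc λ₀) ^ c * B ^ suc c ℕ.≤? (2 * 2 ^ N) ^ c) N rare-beyond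

  threshold : ℕ
  threshold = suc (proj₁ search)

  rare-threshold : Rare threshold
  rare-threshold = proj₁ (proj₂ search)

  below-threshold : ∀ {l} → 0 < l → l < threshold → ¬ Rare l
  below-threshold {suc l} _ (s≤s l<) = proj₂ (proj₂ search) l<

abstract
  ι<-by-contradiction : ∀ n {q} → ¬ q ℚ.≤ ι n → ι n ℚ.< q
  ι<-by-contradiction n {q} ¬q≤ with ≤∨< q (ι n)
  ... | inj₁ q≤ = contradiction q≤ ¬q≤
  ... | inj₂ <q = <q

  ι-positive : ∀ n {q} → 0ℚ ℚ.< q → q ℚ.≤ ι n → 0 < n
  ι-positive zero    0<q q≤0 = contradiction (ℚ.<-≤-trans 0<q q≤0) (ℚ.<-irrefl refl)
  ι-positive (suc _) _   _   = s≤s z≤n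

  /-cancel : ∀ p q .{{_ : NonZero q}} → ι q ℚ.* ((+ p) ℚ./ q) ≡ ι p
  /-cancel p q@(suc q-1) = ℚ.toℚᵘ-injective (begin
    ℚ.toℚᵘ (ι q ℚ.* ((+ p) ℚ./ q))           ≈⟨ ℚ.toℚᵘ-homo-* (ι q) ((+ p) ℚ./ q) ⟩
    ℚ.toℚᵘ (ι q) ℚᵘ.* ℚ.toℚᵘ ((+ p) ℚ./ q)   ≈⟨ ℚᵘ.*-cong (ℚ.toℚᵘ-fromℚᵘ (mkℚᵘ (+ q) 0)) (ℚ.toℚᵘ-fromℚᵘ (mkℚᵘ (+ p) q-1)) ⟩
    mkℚᵘ (+ q) 0 ℚᵘ.* mkℚᵘ (+ p) q-1         ≈⟨ *≡* eq ⟩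
    mkℚᵘ (+ p) 0                             ≈⟨ ℚᵘ.≃-sym (ℚ.toℚᵘ-fromℚᵘ (mkℚᵘ (+ p) 0)) ⟩
    ℚ.toℚᵘ (ι p)                             ∎)
    where
    open ℚᵘ.≃-Reasoning
    eq : (+ q ℤ.* + p) ℤ.* + 1 ≡ + p ℤ.* (+ 1 ℤ.* + q)
    eq = trans (ℤ.*-identityʳ (+ q ℤ.* + p)) (trans (ℤ.*-comm (+ q) (+ p)) (cong (λ t → + p ℤ.* t) (sym (ℤ.*-identityˡ (+ q)))))

  complement-ratio : ∀ {δ} b p r q .{{_ : NonZero q}} → h b ℚ.< δ → p + r ≡ q → suc b * r ≤ q →
    1ℚ ℚ.- δ ℚ.≤ (+ p) ℚ./ q
  complement-ratio {δ} b p r q h<δ p+r≡q br≤q = *-cancel (0<ι q) (begin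
    ι q ℚ.* (1ℚ ℚ.- δ)
      ≡⟨ solve 2 (λ q d → q :* (con 1ℚ :- d) := q :- q :* d) refl (ι q) δ ⟩
    ι q ℚ.- ι q ℚ.* δ
      ≤⟨ ℚ.+-monoʳ-≤ (ι q) (ℚ.neg-antimono-≤ r≤qδ) ⟩
    ι q ℚ.- ι r
      ≡⟨ cong (ℚ._- ι r) (trans (cong ι (sym p+r≡q)) (ι-+ p r)) ⟩
    ι p ℚ.+ ι r ℚ.- ι r
      ≡⟨ solve 2 (λ p r → p :+ r :- r := p) refl (ι p) (ι r) ⟩
    ι p
      ≡⟨ /-cancel p q ⟨
    ι q ℚ.* ((+ p) ℚ./ q) ∎)
    where
    open ℚ.≤-Reasoning
    open +-*-Solver using (solve; _:+_; _:-_; _:*_; _:=_; con)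
    r≤qδ : ι r ℚ.≤ ι q ℚ.* δ
    r≤qδ = begin
      ι r                          ≡⟨ ℚ.*-identityˡ (ι r) ⟨
      1ℚ ℚ.* ι r                   ≡⟨ cong (ℚ._* ι r) (ι-h b) ⟨
      ι (suc b) ℚ.* h b ℚ.* ι r    ≡⟨ solve 3 (λ n u r → n :* u :* r := n :* r :* u) refl (ι (suc b)) (h b) (ι r) ⟩
      ι (suc b) ℚ.* ι r ℚ.* h b    ≡⟨ cong (ℚ._* h b) (ι-* (suc b) r) ⟨
      ι (suc b * r) ℚ.* h b        ≤⟨ *-mono-≤ (0≤ι (suc b * r)) (0≤h b) (ι-mono br≤q) (ℚ.<⇒≤ h<δ) ⟩
      ι q ℚ.* δ                    ∎

abstract
  -- Makes the bound of ∑-indices at most 2^N / (b + 1).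
  scale : ℕ → ℕ → ℕ
  scale b c = suc b * ((1 + (2 * c + 2 * c)) * 4)

  scale≢0 : ∀ b c → NonZero (scale b c)
  scale≢0 b c = _

  scale-≡ : ∀ b c → scale b c ≡ suc b * ((1 + (2 * c + 2 * c)) * 4)
  scale-≡ b c = refl

  -- The sum of all lower bounds that `∑-indices` puts on K; of the 3, two account for SN = K + 2
  -- and one for K > 0.
  start : ℕ → ℕ → ℕ
  start G c = 3 + (2 * c + ((G ^ c + G ^ c) + 8 * c * G * (4 * c)))

  start-positive : ∀ G c → 3 ≤ start G c
  start-positive G c = s≤s (s≤s (s≤s z≤n))

  start-large : ∀ G c {K} → start G c ≤ 2 + K →
    2 * c ≤ K × G ^ c + G ^ c ≤ K × 8 * c * G * (4 * c) ≤ K × 0 < K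
  start-large G c {K} le =
    ℕ.≤-trans (ℕ.m≤m+n x (y + z)) 1+≤ , ℕ.≤-trans (ℕ.m≤m+n y z) y+z≤K ,
    ℕ.≤-trans (ℕ.m≤n+m z y) y+z≤K , ℕ.≤-trans (s≤s z≤n) (ℕ.+-cancelˡ-≤ 2 _ _ le)
    where
    x y z : ℕ
    x = 2 * c
    y = G ^ c + G ^ c
    z = 8 * c * G * (4 * c)
    1+≤ : x + (y + z) ≤ K
    1+≤ = ℕ.≤-trans (ℕ.n≤1+n _) (ℕ.+-cancelˡ-≤ 2 _ _ le)
    y+z≤K : y + z ≤ K
    y+z≤K = ℕ.≤-trans (ℕ.m≤n+m (y + z) x) 1+≤

-- The union bound over all k, for large N.

module Large (S : ℕ) .{{_ : NonZero S}} (a b N : ℕ) (start≤N : start (scale b (suc a)) (suc a) ≤ N) where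

  c J G : ℕ
  c = suc a
  J = 2 * c
  G = scale b c

  3≤N : 3 ≤ N
  3≤N = ℕ.≤-trans (start-positive G c) start≤N

  instance
    N≢0 : NonZero N
    N≢0 = ℕ.>-nonZero (ℕ.≤-trans (s≤s z≤n) 3≤N)

    G≢0 : NonZero G
    G≢0 = scale≢0 b c

  K : ℕ
  K = S * N ∸ 2

  N≤SN : N ≤ S * N
  N≤SN = ℕ.m≤n*m N S

  K+2≡SN : 2 + K ≡ S * N
  K+2≡SN = ℕ.m+[n∸m]≡n (ℕ.≤-trans (s≤s (s≤s z≤n)) (ℕ.≤-trans 3≤N N≤SN))

  K-large : 2 * c ≤ K × G ^ c + G ^ c ≤ K × 8 * c * G * (4 * c) ≤ K × 0 < K
  K-large = start-large G c (ℕ.≤-trans start≤N (ℕ.≤-trans N≤SN (ℕ.≤-reflexive (sym K+2≡SN))))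

  B : ℕ → ℕ
  B i = orbits S N (2 + i)

  path≤B : ∀ i → i < K → path (suc i) (K ∸ i) ≤ B i
  path≤B i i<K = path≤orbits S N (suc i) (K ∸ i) (trans (cong (λ t → 2 + t) (ℕ.m+[n∸m]≡n (ℕ.<⇒≤ i<K))) K+2≡SN)

  B≢0 : ∀ i → i < K → NonZero (B i)
  B≢0 i i<K = ℕ.>-nonZero (ℕ.≤-trans (path-mono {0} {suc i} {0} {K ∸ i} z≤n z≤n) (path≤B i i<K))

  module T i = Threshold c N (B i)

  weightOf : ℕ → ℕ
  weightOf i = 2 * (B i * walks N 0 (T.threshold i))

  Below : Ω N S → ℕ → Set
  Below ω i = Φ (2 + i) ω < T.threshold i

  Good : Pred (Ω N S) 0ℓ
  Good ω = All (Below ω) (indices J K)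

  Good? : Decidable Good
  Good? ω = All.all? (λ i → Φ (2 + i) ω ℕ.<? T.threshold i) (indices J K)

  sum-of-weights : suc b * ∑ (indices J K) weightOf ≤ 2 ^ N
  sum-of-weights = ℕ.*-cancelʳ-≤ _ _ (M * 4) (begin
    suc b * Σ * (M * 4)    ≡⟨ reorder (suc b) Σ (M * 4) ⟩
    suc b * (M * 4) * Σ    ≡⟨ cong (_* Σ) (scale-≡ b c) ⟨
    G * Σ                  ≤⟨ ∑-indices c G K weightOf B {2 * (2 * 2 ^ N)} light path≤B
                                (proj₁ K-large) (proj₁ (proj₂ K-large))
                                    (proj₁ (proj₂ (proj₂ K-large))) (proj₂ (proj₂ (proj₂ K-large))) ⟩
    M * (2 * (2 * 2 ^ N))  ≡⟨ factor M (2 ^ N) ⟩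
    2 ^ N * (M * 4)        ∎)
    where
    open ℕ.≤-Reasoning
    Σ M : ℕ
    Σ = ∑ (indices J K) weightOf
    M = 1 + (J + J)
    light : ∀ i → i < K → ∀ T → T ^ c ≤ B i → weightOf i * T ≤ 2 * (2 * 2 ^ N)
    light i _ T = weight c {walks N 0 (T.threshold i)} {B i} {T} {2 * 2 ^ N} (T.rare-threshold i)
    reorder : ∀ b s m → b * s * m ≡ b * m * s
    reorder = solve-∀
    factor : ∀ m p → m * (2 * (2 * p)) ≡ p * (m * 4)
    factor = solve-∀

  bad-count : suc b * length (filter (¬? ∘ Good?) (outcomes N S)) ≤ 2 ^ (S * N)
  bad-count = begin
    suc b * length (filter (¬? ∘ Good?) (outcomes N S))
      ≡⟨ cong (suc b *_) (∑-filter (¬? ∘ Good?) (outcomes N S)) ⟩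
    suc b * ∑ (outcomes N S) (λ ω → ⟦ ¬? (Good? ω) ⟧)
      ≤⟨ ℕ.*-monoʳ-≤ (suc b) (∑-mono (outcomes N S) (λ {ω} _ → ⟦⟧-≤ (¬? (Good? ω)) (union ω))) ⟩
    suc b * ∑ (outcomes N S) (λ ω → ∑ (indices J K) (λ i → exceeds i ω))
      ≡⟨ cong (suc b *_) (∑-swap (outcomes N S) (indices J K) (λ ω i → exceeds i ω)) ⟩
    suc b * ∑ (indices J K) (λ i → ∑ (outcomes N S) (exceeds i))
      ≤⟨ ℕ.*-monoʳ-≤ (suc b) (∑-mono (indices J K) (λ {i} _ → Φ-tail N S (2 + i) (T.threshold i) (s≤s z≤n))) ⟩
    suc b * ∑ (indices J K) (λ i → R * weightOf i)
      ≡⟨ cong (suc b *_) (∑-*ˡ R (indices J K) weightOf) ⟩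
    suc b * (R * ∑ (indices J K) weightOf)
      ≡⟨ x∙yz≈y∙xz (suc b) R (∑ (indices J K) weightOf) ⟩
    R * (suc b * ∑ (indices J K) weightOf)
      ≤⟨ ℕ.*-monoʳ-≤ R sum-of-weights ⟩
    R * 2 ^ N
      ≡⟨ ℕ.^-distribˡ-+-* 2 (N * (S ∸ 1)) N ⟨
    2 ^ (N * (S ∸ 1) + N)
      ≡⟨ cong (2 ^_) (exponent S) ⟩
    2 ^ (S * N) ∎
    where
    open ℕ.≤-Reasoning
    open import Algebra.Properties.CommutativeSemigroup ℕ.*-commutativeSemigroup using (x∙yz≈y∙xz)
    R : ℕ
    R = 2 ^ (N * (S ∸ 1))
    exceeds : ℕ → Ω N S → ℕ
    exceeds i ω = ⟦ T.threshold i ℕ.≤? Φ (2 + i) ω ⟧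
    union : ∀ ω → ¬ Good ω → 1 ≤ ∑ (indices J K) (λ i → exceeds i ω)
    union ω = ¬All⇒1≤∑ (λ i → Φ (2 + i) ω ℕ.<? T.threshold i) (indices J K)
      (λ {i} ≮ → ℕ.≤-reflexive (sym (⟦⟧-yes (T.threshold i ℕ.≤? Φ (2 + i) ω) (ℕ.≮⇒≥ ≮))))
    exponent : ∀ S .{{_ : NonZero S}} → N * (S ∸ 1) + N ≡ S * N
    exponent (suc s) = trans (ℕ.+-comm (N * s) N) (cong (λ t → N + t) (ℕ.*-comm N s))

  -- The tail estimate is applied at Φ itself, not at the threshold: if q ≤ Φ for some rational q
  -- above the bound, then Φ is positive and `Rare`, yet below the least such height.
  good-bound : ∀ ε → L (1ᴿ +ᴿ ε) (1ℚ ℚ.+ h a) → ∀ {ω} → Good ω → ∀ k → 2 ≤ k → k < S * N →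
    fromℕ (Φ k ω) ≤ᴿ (1ᴿ +ᴿ ε) *ᴿ √ (fromℕ (2 * N) *ᴿ log (orbits S N k))
  good-bound ε Lε {ω} good (suc (suc i)) (s≤s (s≤s z≤n)) k<SN {q} Uq =
    ι<-by-contradiction (Φ (2 + i) ω) λ q≤Φ →
      T.below-threshold i (ι-positive (Φ (2 + i) ω) 0<q q≤Φ) (All.lookup good (∈-indices J K i<K))
        (walks-vs-log a N (Φ (2 + i) ω) (B i) (proj₁ (proj₂ radius)) {{N≢0}} {{B≢0 i i<K}}
          (ℚ.≤-trans (proj₂ (proj₂ radius)) (*-mono-≤ (ℚ.<⇒≤ 0<q) (ℚ.<⇒≤ 0<q) q≤Φ q≤Φ)))
    where
    i<K : i < K
    i<K = ℕ.+-cancelˡ-< 2 i K (subst (2 + i <_) (sym K+2≡SN) k<SN)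
    radius : 0ℚ ℚ.< q × ∃[ ν ] (1ℚ ℚ.+ h a) ℚ.* (ι (2 * N) ℚ.* upperSum (B i) ν) ℚ.≤ q ℚ.* q
    radius = above-radius ε a (2 * N) (B i) Lε Uq
    0<q : 0ℚ ℚ.< q
    0<q = proj₁ radius

  good-probability : ∀ {δ} → h b ℚ.< δ → 1ℚ ℚ.- δ ℚ.≤ ℙ Good?
  good-probability h<δ = complement-ratio b (length (filter Good? (outcomes N S)))
    (length (filter (¬? ∘ Good?) (outcomes N S))) (2 ^ (S * N)) {{ℕ.m^n≢0 2 (S * N)}} h<δ
    (trans (filter-complement Good? (outcomes N S)) (length-outcomes N S)) bad-count

theorem3 : (S : ℕ) → .{{_ : NonZero S}} → (ε : ℝ) → 0ᴿ <ᴿ ε →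
    ℙ[ (λ N (ω : Ω N S) → ∀ k → 2 ≤ k → k < S * N →
    fromℕ (Φ k ω) ≤ᴿ
    (1ᴿ +ᴿ ε) *ᴿ √ (fromℕ (2 * N) *ᴿ log ((S * N) C k ∸ (S * (N ∸ 1)) C k))) ]→1
theorem3 S ε 0<ε δ 0<δ =
  -- `a` fixes the exponent 1 + 1/(a+1) < 1 + ε, and `b` the failure probability 1/(b+1) < δ.
  let a , Lε = 1+ε-lower ε 0<ε
      b , h<δ = h-small 0<δ
  in start (scale b (suc a)) (suc a) , λ N large →
     Large.Good S a b N large , Large.Good? S a b N large ,
     (λ {ω} → Large.good-bound S a b N large ε Lε {ω}) , Large.good-probability S a b N large h<δ
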